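{- Let $q=2^h$ be even, $t\ge 3$ a prime, $q\ge t$. In $\mathrm{PG}(2,q^t)$, let $\mathcal C$ be a conic with nucleus $N$ and tangent to the line $\ell_\infty$ at the point $T$, and let $\mathcal D$ be an André set of $\ell_\infty$ with transversal points $T,N$. For $m\in\{1,\ldots,t-1\}$ perform an André replacement using the André replacement net $\mathcal D^m$, and let $\mathcal D_m(\mathcal C)$ denote the set of points in the André plane $\mathcal P(\mathcal D^m)$ corresponding to the affine points of $\mathcal C$. 1. If $h\equiv 0\pmod t$, then for each $m\in\{1,\ldots,t-1\}$, $\mathcal D_m(\mathcal C)$ is an arc which can be completed to an oval in the André plane $\mathcal P(\mathcal D^m)$. 2. If $h\not\equiv 0\pmod t$, then there is a unique $n\in\{1,\ldots,t-1\}$ for which $\mathcal D_n(\mathcal C)$ is not an arc in the André plane $\mathcal P(\mathcal D^n)$; for the remaining $t-2$ values $m\in\{1,\ldots,t-1\}\setminus\{n\}$, $\mathcal D_m(\mathcal C)$ is an arc which can be completed to an oval in the André plane $\mathcal P(\mathcal D^m)$.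
   Context: Conics are non-degenerate. As $q$ is even, all tangent lines of a conic pass through a common point, its nucleus. Homogeneous coordinates of $\mathrm{PG}(2,q^t)$ are $(x,y,z)$, with $\ell_\infty$ the line $z=0$; the point $(x,y,0)$ of $\ell_\infty\cong\mathrm{PG}(1,q^t)$ is also written $(x,y)$. Affine points are the points not on $\ell_\infty$; $(x,y,1)$ is identified with the vector $(x,y)\in V=\mathbb F_{q^t}^2$. An arc of a projective plane is a set of points, no three collinear; an oval of a projective plane of order $q^t$ is an arc of size $q^t+1$. Norm: $\mathrm N(k)=k^{1+q+\cdots+q^{t-1}}$ for $k\in\mathbb F_{q^t}$. André sets: for distinct points $E,F$ of $\mathrm{PG}(1,q^t)$, let $G\le \mathrm{PGL}(2,q^t)$ be the group (cyclic of order $q^t-1$) of projectivities fixing both $E$ and $F$, and $H$ its unique subgroup of order $q^{t-1}+\cdots+q+1$. The $q-1$ orbits of $H$ on $\mathrm{PG}(1,q^t)\setminus\{E,F\}$ are the André sets with transversal points $E,F$. The André sets with transversal points $(1,0),(0,1)$ are $\mathcal A_\delta=\{(1,\theta)\mid \theta\in\mathbb F_{q^t}^*,\ \mathrm N(\theta)=\delta\}$, $\delta\in\mathbb F_q^*$, and every André set is the image of such a set under a projectivity. Bruck–Bose representation: regard $V$ as a $2t$-dimensional $\mathbb F_q$-space, so affine points of $\mathrm{PG}(2,q^t)$ are the points of $\mathrm{AG}(2t,q)$. A point $P=(x,y)$ of $\ell_\infty$ corresponds to the $t$-dimensional $\mathbb F_q$-subspace $[P]=\{(sx,sy)\mid s\in\mathbb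 F_{q^t}\}$ of $V$ (projectively a $(t-1)$-space of the hyperplane at infinity $\mathrm{PG}(2t-1,q)$); the affine lines through $P$ are the cosets of $[P]$. André replacement nets: for $\mathcal D=\mathcal A_\delta$ and $m\in\{1,\ldots,t-1\}$, $\mathcal D^m=\{X_{m,u}\mid u\in\mathbb F_{q^t}^*,\mathrm N(u)=\delta\}$ where $X_{m,u}=\{(s,s^{q^m}u)\mid s\in\mathbb F_{q^t}\}$, a $t$-dimensional $\mathbb F_q$-subspace of $V$. For a general André set $\mathcal D$, choose $\varphi\in\mathrm{GL}(2,q^t)$ inducing a projectivity mapping some $\mathcal A_\delta$ to $\mathcal D$; the $t-1$ replacement nets of $\mathcal D$ are $\mathcal D^m=\{\varphi(X_{m,u})\}$, the images of those of $\mathcal A_\delta$ (the choice of $\varphi$ is fixed once and for all, and only affects the indexing of the $t-1$ nets). André replacement: a $\mathcal D^m$-block is a coset in $V$ of a member of $\mathcal D^m$. The incidence structure whose points are the affine points of $\mathrm{PG}(2,q^t)$ and whose lines are the affine lines of $\mathrm{PG}(2,q^t)$ meeting $\ell_\infty$ in a point not in $\mathcal D$, together with the $\mathcal D^m$-blocks, is an affine plane of order $q^t$; its projective completion is the André plane $\mathcal P(\mathcal D^m)$. -}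

module Defs where

open import Level using (0ℓ)
open import Algebra.Bundles using (CommutativeRing)
open import Algebra.Structures using (IsCommutativeRing)
import Algebra.Properties.Semiring.Exp as Exp
open import Data.Empty using (⊥)
open import Data.Fin using (Fin)
open import Data.List using (applyUpTo; sum)
open import Data.Maybe using (Maybe; just; nothing)
open import Data.Nat as ℕ using (ℕ; suc)
open import Data.Product using (Σ; ∃; _×_; _,_; proj₁)
open import Data.Sum using (_⊎_; inj₁; inj₂)
open import Data.Sum.Relation.Binary.Pointwise using (Pointwise)
open import Data.Unit using (⊤)
open import Data.Vec using (Vec; []; _∷_; map; zipWith; replicate)
open import Data.Vec.Properties using (∷-injectiveˡ; ∷-injectiveʳ)
open import Function.Bundles using (_⇔_; _↔_)
open import Function.Definitions using (Injective)
open import Relation.Binary.Core using (Rel)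
open import Relation.Binary.PropositionalEquality using (_≡_; _≢_; sym; cong; cong₂)
open import Relation.Nullary using (¬_)
open import Relation.Unary using (Pred; _∈_; _∉_; _⊆_)

-- The set S has exactly n elements, where elements of A are identified
-- along the equivalence _≈_ (S is then automatically closed under _≈_).
HasSize : {A : Set} → Rel A 0ℓ → Pred A 0ℓ → ℕ → Set
HasSize {A} _≈_ S n =
  Σ (Fin n → A) λ f → Injective _≡_ _≈_ f × (∀ a → (a ∈ S) ⇔ ∃ λ i → f i ≈ a)

------------------------------------------------------------------------
-- Incidence structures

record IncidenceStructure : Set₁ where
  field
    Point : Set
    Line  : Set
    _≈_   : Rel Point 0ℓ
    _On_  : Point → Line → Set

  _∥_ : Rel Line 0ℓ
  ℓ ∥ m = (∀ P → (P On ℓ) ⇔ (P On m)) ⊎ (∀ P → ¬ (P On ℓ × P On m))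

  IsArc : Pred Point 0ℓ → Set
  IsArc S = ∀ {P Q R} → P ∈ S → Q ∈ S → R ∈ S →
            ¬ (P ≈ Q) → ¬ (P ≈ R) → ¬ (Q ≈ R) →
            ¬ (∃ λ ℓ → P On ℓ × Q On ℓ × R On ℓ)

  -- n is the order of the projective plane.
  IsOval : ℕ → Pred Point 0ℓ → Set
  IsOval n S = IsArc S × HasSize _≈_ S (suc n)

  CompletesToOval : ℕ → Pred Point 0ℓ → Set₁
  CompletesToOval n S = Σ (Pred Point 0ℓ) λ O → IsOval n O × S ⊆ O

-- The point at infinity `inj₂ ℓ` is the parallel class of ℓ, and `nothing`
-- is the line at infinity.
projectiveCompletion : IncidenceStructure → IncidenceStructure
projectiveCompletion A = record
  { Point = A.Point ⊎ A.Line
  ; Line  = Maybe A.Line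
  ; _≈_   = Pointwise A._≈_ A._∥_
  ; _On_  = on
  }
  where
  module A = IncidenceStructure A

  on : A.Point ⊎ A.Line → Maybe A.Line → Set
  on (inj₁ P) (just ℓ) = P A.On ℓ
  on (inj₁ P) nothing  = ⊥
  on (inj₂ m) (just ℓ) = m A.∥ ℓ
  on (inj₂ m) nothing  = ⊤

------------------------------------------------------------------------
-- Finite fields

record FiniteField (n : ℕ) : Set₁ where
  infixl 6 _+_
  infixl 7 _*_
  infix  8 -_
  field
    Carrier           : Set
    _+_ _*_           : Carrier → Carrier → Carrier
    -_                : Carrier → Carrier
    0# 1#             : Carrier
    isCommutativeRing : IsCommutativeRing _≡_ _+_ _*_ -_ 0# 1#
    0≢1               : 0# ≢ 1#
    inverse           : ∀ x → x ≢ 0# → ∃ λ y → x * y ≡ 1#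
    finite            : Carrier ↔ Fin n

  commutativeRing : CommutativeRing 0ℓ 0ℓ
  commutativeRing = record { isCommutativeRing = isCommutativeRing }

  open Exp (CommutativeRing.semiring commutativeRing) public
    using (_^_)

module Geometry (q t : ℕ) (F : FiniteField (q ℕ.^ t)) where

  open FiniteField F renaming (Carrier to K)

  -- 1 + q + ⋯ + q^(t-1)
  normExponent : ℕ
  normExponent = sum (applyUpTo (q ℕ.^_) t)

  norm : K → K
  norm k = k ^ normExponent

  -- The nonzero elements of the subfield of order q.
  𝔽q* : Pred K 0ℓ
  𝔽q* k = k ≢ 0# × k ^ q ≡ k

  ----------------------------------------------------------------------
  -- Projective spaces

  infixr 7 _•_
  _•_ : ∀ {n} → K → Vec K n → Vec K n
  k • v = map (k *_) v

  infixl 6 _+ᵥ_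
  _+ᵥ_ : ∀ {n} → Vec K n → Vec K n → Vec K n
  _+ᵥ_ = zipWith _+_

  0ᵥ : ∀ {n} → Vec K n
  0ᵥ = replicate _ 0#

  infix 4 _∝_
  _∝_ : ∀ {n} → Rel (Vec K n) 0ℓ
  v ∝ w = ∃ λ k → k ≢ 0# × w ≡ k • v

  -- Points of PG(n-1, q^t), given by homogeneous coordinates.
  PG : ℕ → Set
  PG n = Σ (Vec K n) (_≢ 0ᵥ)

  vec : ∀ {n} → PG n → Vec K n
  vec = proj₁

  infix 4 _∼_
  _∼_ : ∀ {n} → Rel (PG n) 0ℓ
  P ∼ Q = vec P ∝ vec Q

  -- The line [a,b,c] of PG(2, q^t) is ax + by + cz = 0.
  LinePG : Set
  LinePG = PG 3

  dot : Vec K 3 → Vec K 3 → K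
  dot (a ∷ b ∷ c ∷ []) (x ∷ y ∷ z ∷ []) = a * x + b * y + c * z

  _OnLine_ : PG 3 → LinePG → Set
  P OnLine ℓ = dot (vec ℓ) (vec P) ≡ 0#

  ℓ∞ : LinePG
  ℓ∞ = (0# ∷ 0# ∷ 1# ∷ []) ,
       λ eq → 0≢1 (sym (∷-injectiveˡ (∷-injectiveʳ (∷-injectiveʳ eq))))

  at∞ : PG 2 → PG 3
  at∞ ((x ∷ y ∷ []) , nz) = (x ∷ y ∷ 0# ∷ []) ,
    λ eq → nz (cong₂ _∷_ (∷-injectiveˡ eq)
                         (cong (_∷ []) (∷-injectiveˡ (∷-injectiveʳ eq))))

  affine : Vec K 2 → PG 3
  affine (x ∷ y ∷ []) = (x ∷ y ∷ 1# ∷ []) ,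
    λ eq → 0≢1 (sym (∷-injectiveˡ (∷-injectiveʳ (∷-injectiveʳ eq))))

  ----------------------------------------------------------------------
  -- Conics

  -- ax² + by² + cz² + fyz + gxz + hxy
  record QuadraticForm : Set where
    field
      a b c f g h : K

    eval : Vec K 3 → K
    eval (x ∷ y ∷ z ∷ []) =
      a * (x * x) + b * (y * y) + c * (z * z) +
      f * (y * z) + g * (x * z) + h * (x * y)

    polar : Vec K 3 → Vec K 3 → K
    polar v w = eval (v +ᵥ w) + - eval v + - eval w

  -- In characteristic 2 the polar form in three variables always has a
  -- nonzero radical; nondegeneracy asks that the form not vanish at any
  -- nonzero vector of it.
  Nondegenerate : QuadraticForm → Set
  Nondegenerate Q = ∀ v → v ≢ 0ᵥ → (∀ w → polar v w ≡ 0#) → eval v ≢ 0#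
    where open QuadraticForm Q

  record Conic : Set where
    field
      form          : QuadraticForm
      nondegenerate : Nondegenerate form

  _OnConic_ : PG 3 → Conic → Set
  P OnConic C = QuadraticForm.eval (Conic.form C) (vec P) ≡ 0#

  TangentAt : Conic → LinePG → PG 3 → Set
  TangentAt C ℓ P = P OnConic C × P OnLine ℓ ×
                    (∀ R → R OnConic C → R OnLine ℓ → R ∼ P)

  IsNucleus : Conic → PG 3 → Set
  IsNucleus C N = ∀ ℓ → (∃ λ P → TangentAt C ℓ P) → N OnLine ℓ

  ----------------------------------------------------------------------
  -- Projectivities of PG(1, q^t)

  record Matrix : Set where
    constructor mat
    field
      m₀₀ m₀₁ m₁₀ m₁₁ : K

  det : Matrix → K
  det (mat a b c d) = a * d + - (b * c)

  Invertible : Pred Matrix 0ℓ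
  Invertible g = det g ≢ 0#

  act : Matrix → Vec K 2 → Vec K 2
  act (mat a b c d) (x ∷ y ∷ []) = (a * x + b * y) ∷ (c * x + d * y) ∷ []

  identity : Matrix
  identity = mat 1# 0# 0# 1#

  infixl 7 _∙_
  _∙_ : Matrix → Matrix → Matrix
  mat a b c d ∙ mat a′ b′ c′ d′ =
    mat (a * a′ + b * c′) (a * b′ + b * d′)
        (c * a′ + d * c′) (c * b′ + d * d′)

  -- Invertible matrices inducing the same projectivity.
  infix 4 _∼ₘ_
  _∼ₘ_ : Rel Matrix 0ℓ
  mat a b c d ∼ₘ g′ =
    ∃ λ k → k ≢ 0# × g′ ≡ mat (k * a) (k * b) (k * c) (k * d)

  Maps : Matrix → PG 2 → PG 2 → Set
  Maps g P R = act g (vec P) ∝ vec R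

  image : Matrix → Pred (PG 2) 0ℓ → Pred (PG 2) 0ℓ
  image g S R = ∃ λ P → P ∈ S × Maps g P R

  -- Subgroups of PGL(2, q^t), as sets of matrices closed under _∼ₘ_.
  record IsSubgroupPGL (H : Pred Matrix 0ℓ) : Set where
    field
      invertible : ∀ {g} → g ∈ H → Invertible g
      respects   : ∀ {g g′} → g ∼ₘ g′ → g ∈ H → g′ ∈ H
      identity∈  : identity ∈ H
      product∈   : ∀ {g g′} → g ∈ H → g′ ∈ H → (g ∙ g′) ∈ H
      inverse∈   : ∀ {g} → g ∈ H → ∃ λ g′ → g′ ∈ H × (g ∙ g′) ∼ₘ identity

  ----------------------------------------------------------------------
  -- André sets and their replacement nets

  -- The group of projectivities fixing E and F is cyclic, so H is the only
  -- subgroup of its order.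
  IsAndréSet : (E F : PG 2) → Pred (PG 2) 0ℓ → Set₁
  IsAndréSet E F D =
    ¬ (E ∼ F) ×
    Σ (Pred Matrix 0ℓ) λ H →
      IsSubgroupPGL H ×
      (∀ {g} → g ∈ H → Maps g E E × Maps g F F) ×
      HasSize _∼ₘ_ H normExponent ×
      ∃ λ P → ¬ (P ∼ E) × ¬ (P ∼ F) ×
              (∀ R → (R ∈ D) ⇔ ∃ λ g → g ∈ H × Maps g P R)

  𝒜 : K → Pred (PG 2) 0ℓ
  𝒜 δ P = ∃ λ θ → θ ≢ 0# × norm θ ≡ δ × (1# ∷ θ ∷ []) ∝ vec P

  -- The choice of φ (with its δ) that indexes the replacement nets of D.
  record Indexing (D : Pred (PG 2) 0ℓ) : Set where
    field
      φ          : Matrix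
      invertible : Invertible φ
      δ          : K
      δ∈𝔽q*      : δ ∈ 𝔽q*
      maps       : ∀ R → (R ∈ D) ⇔ (R ∈ image φ (𝒜 δ))

  X : ℕ → K → Pred (Vec K 2) 0ℓ
  X m u v = ∃ λ s → v ≡ s ∷ ((s ^ (q ℕ.^ m)) * u) ∷ []

  module _ {D : Pred (PG 2) 0ℓ} (ix : Indexing D) (m : ℕ) where

    open Indexing ix

    data AndréLine : Set where
      old   : (ℓ : LinePG) → ¬ (ℓ ∼ ℓ∞) →
              (P : PG 2) → at∞ P OnLine ℓ → P ∉ D → AndréLine
      -- the coset v + φ(X_{m,u})
      block : (u : K) → u ≢ 0# → norm u ≡ δ → (v : Vec K 2) → AndréLine

    OnAndré : Vec K 2 → AndréLine → Set
    OnAndré w (old ℓ _ _ _ _)   = affine w OnLine ℓ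
    OnAndré w (block u _ _ v) = ∃ λ x → x ∈ X m u × w ≡ v +ᵥ act φ x

    affineAndréPlane : IncidenceStructure
    affineAndréPlane = record
      { Point = Vec K 2
      ; Line  = AndréLine
      ; _≈_   = _≡_
      ; _On_  = OnAndré
      }

    andréPlane : IncidenceStructure
    andréPlane = projectiveCompletion affineAndréPlane

    -- The points of the André plane given by the affine points of C.
    replaced : Conic → Pred (IncidenceStructure.Point andréPlane) 0ℓ
    replaced C (inj₁ v) = affine v OnConic C
    replaced C (inj₂ _) = ⊥

    ReplacedIsArc : Conic → Set
    ReplacedIsArc C = IncidenceStructure.IsArc andréPlane (replaced C)

    ReplacedCompletes : Conic → Set₁
    ReplacedCompletes C =
      IncidenceStructure.CompletesToOval andréPlane (q ℕ.^ t) (replaced C)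

{-# OPTIONS --safe #-}
module Submission where

-- In coordinates (x, y) with respect to the columns of φ, the two transversal points of D
-- are (1, 0) and (0, 1). Indeed, in both coordinate systems D consists of points of constant
-- norm, and comparing two coefficients of the resulting polynomial identity of degree
-- M = 1 + q + ⋯ + q^(t-1), which has M roots, shows that the coordinate change is monomial
-- (here t ≥ 3 is needed). So the conic is y = α x² + γ or x = α y² + γ, according to which
-- transversal point is the nucleus, while each line of the André plane is x = c or
-- y = u x^(2^j) + b with j ∈ {0, h m}. Three common points give y ≠ 0, 1 with
-- y^(2^(h m - 1)) = y, respectively y^(2^(h m + 1)) = y, in a field of order 2^(h t), which
-- is possible only if t divides h m - 1, respectively h m + 1. Conversely, if t divides this
-- exponent, the subfield of order 2^t supplies a block with three points of the conic. The
-- lines x = c meet the conic once, so their point at infinity completes the arc to an oval.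

open import Level using (0ℓ)
open import Algebra.Bundles using (CommutativeRing)
open import Algebra.Bundles.Raw using (RawRing)
import Algebra.Properties.CommutativeMonoid.Sum as MonoidSum
import Algebra.Properties.CommutativeSemiring.Exp as ExpProperties
import Algebra.Properties.Ring as RingProperties
import Algebra.Solver.Ring as RingSolver
open import Algebra.Solver.Ring.AlmostCommutativeRing
  using (AlmostCommutativeRing; fromCommutativeRing; _-Raw-AlmostCommutative⟶_)
open import Data.Bool as Bool using (Bool; true; false)
open import Data.Empty using (⊥; ⊥-elim)
open import Data.Fin using (Fin; zero; suc; punchIn; punchOut)
import Data.Fin.Permutation as Perm
import Data.Fin.Properties as Fin
open import Data.List using (List; []; _∷_; _++_; map; length; drop; replicate; applyUpTo)
import Data.List.Properties as List
open import Data.Maybe using (Maybe; just; nothing)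
open import Data.Nat as ℕ using (ℕ; zero; suc; z≤n; s≤s; NonZero)
open import Data.Nat.Coprimality using (Coprime; coprime-divisor; coprime-Bézout)
open import Data.Nat.DivMod using (_/_; _%_; m≡m%n+[m/n]*n; m%n<n)
open import Data.Nat.Divisibility
  using (_∣_; divides; ∣m+n∣m⇒∣n; m∣m*n; n∣m*n; ∣m⇒∣m*n; ∣-trans; ∣-reflexive; >⇒∤; ∣1⇒≡1; _∣?_)
import Data.Nat.GCD as GCD
open import Data.Nat.ListAction using (sum)
open import Data.Nat.Primality
  using (Prime; prime⇒irreducible; prime⇒nonTrivial; prime⇒nonZero; euclidsLemma)
import Data.Nat.Properties as ℕ
open import Data.Nat.Solver using (module +-*-Solver)
open import Data.Product using (Σ; ∃; ∃₂; _×_; _,_; proj₁; proj₂)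
open import Data.Sum using (_⊎_; inj₁; inj₂)
open import Data.Sum.Relation.Binary.Pointwise using (inj₁; inj₂)
open import Data.Vec using (Vec; []; _∷_)
open import Function.Base using (_∘_)
open import Function.Bundles using (Equivalence; Inverse; _⇔_; mk⇔)
open import Function.Definitions using (Injective)
open import Relation.Binary.PropositionalEquality hiding (J)
open import Relation.Nullary using (¬_; Dec; yes; no; contradiction)
open import Relation.Nullary.Decidable using (map′; ¬?)
open import Relation.Unary using (Pred; _∉_)
open import Defs

-- `Indexing` only says that φ carries some `𝒜 δ` onto D as a set; where the transversal points go
-- has to be deduced. Constant norm with respect to T and N comes from counting: modulo scalars an
-- element of H is determined by the ratio of its eigenvalues at T and N, and these M ratios are
-- closed under products, so each has norm 1 by Lagrange's argument. φ may still interchange the two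
-- points. This exchanges x and y in the equation of the conic and accounts for the two exponents;
-- the two exceptional indices add up to t. Both h m - 1 and h m + 1 are coprime to h, so for prime
-- t their gcd with h t is 1 or t. In the first case y ↦ y^(2^e) fixes only 0 and 1, in the second
-- it fixes the subfield of order 2^t. Collinearity becomes such an equation through chords: the
-- difference of two points removes the additive constants of conic and line, and the quotient of
-- two chords removes the remaining coefficients.

module ≤R = ℕ.≤-Reasoning

-- Injections of finite sets and geometric sums.

injective⇒surjective : ∀ {n} {f : Fin n → Fin n} → Injective _≡_ _≡_ f → ∀ y → ∃ λ x → f x ≡ y
injective⇒surjective {suc n} {f} f-inj y with Fin.any? (λ x → f x Fin.≟ y)
... | yes hit = hit
-- Pigeonhole: deleting a missed value y would inject `Fin (suc n)` into `Fin n`.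
... | no  miss = contradiction (ℕ.n<1+n n) (ℕ.≤⇒≯ (Fin.injective⇒≤ avoid-injective))
  where
  avoid : Fin (suc n) → Fin n
  avoid x = punchOut {i = y} {j = f x} λ y≡fx → miss (x , sym y≡fx)
  avoid-injective : Injective _≡_ _≡_ avoid
  avoid-injective {x} {z} = f-inj ∘ Fin.punchOut-injective (λ eq → miss (x , sym eq)) (λ eq → miss (z , sym eq))

injective⇒permutation : ∀ {n} {f : Fin n → Fin n} → Injective _≡_ _≡_ f → Perm.Permutation n n
injective⇒permutation {f = f} f-inj =
  Perm.permutation f (proj₁ ∘ surj) (proj₂ ∘ surj)
    (λ x → f-inj (proj₂ (surj (f x))))
  where surj = injective⇒surjective f-inj

geometricSum : ℕ → ℕ → ℕ
geometricSum q t = sum (applyUpTo (q ℕ.^_) t)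

sum-applyUpTo-* : ∀ q f n → sum (applyUpTo (λ i → q ℕ.* f i) n) ≡ q ℕ.* sum (applyUpTo f n)
sum-applyUpTo-* q f zero    = sym (ℕ.*-zeroʳ q)
sum-applyUpTo-* q f (suc n) = trans (cong (q ℕ.* f 0 ℕ.+_) (sum-applyUpTo-* q (f ∘ suc) n))
                                    (sym (ℕ.*-distribˡ-+ q (f 0) _))

geometricSum-suc : ∀ q n → geometricSum q (suc n) ≡ suc (q ℕ.* geometricSum q n)
geometricSum-suc q n = cong suc (sum-applyUpTo-* q (q ℕ.^_) n)

geometricSum-last : ∀ q n → geometricSum q (suc n) ≡ geometricSum q n ℕ.+ q ℕ.^ n
geometricSum-last q zero    = refl
geometricSum-last q (suc n) = begin
  geometricSum q (suc (suc n))                       ≡⟨ geometricSum-suc q (suc n) ⟩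
  suc (q ℕ.* geometricSum q (suc n))                 ≡⟨ cong (λ z → suc (q ℕ.* z)) (geometricSum-last q n) ⟩
  suc (q ℕ.* (geometricSum q n ℕ.+ q ℕ.^ n))         ≡⟨ cong suc (ℕ.*-distribˡ-+ q (geometricSum q n) (q ℕ.^ n)) ⟩
  suc (q ℕ.* geometricSum q n) ℕ.+ q ℕ.^ suc n       ≡⟨ cong (ℕ._+ q ℕ.^ suc n) (geometricSum-suc q n) ⟨
  geometricSum q (suc n) ℕ.+ q ℕ.^ suc n             ∎
  where open ≡-Reasoning

-- The factorisation X^n - 1 = (X - 1)(1 + X + ... + X^(n-1)) at X = `suc q`, arranged so that no
-- truncated subtraction occurs.
geometricSum-* : ∀ q n → suc (geometricSum (suc q) n ℕ.* q) ≡ suc q ℕ.^ n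
geometricSum-* q zero    = refl
geometricSum-* q (suc n) = begin
  suc (geometricSum (suc q) (suc n) ℕ.* q)      ≡⟨ cong (λ z → suc (z ℕ.* q)) (geometricSum-suc (suc q) n) ⟩
  suc (suc (suc q ℕ.* G) ℕ.* q)                 ≡⟨ solve 2 (λ q G → con 1 :+ (con 1 :+ (con 1 :+ q) :* G) :* q
                                                     := (con 1 :+ q) :* (con 1 :+ G :* q)) refl q G ⟩
  suc q ℕ.* suc (G ℕ.* q)                       ≡⟨ cong (suc q ℕ.*_) (geometricSum-* q n) ⟩
  suc q ℕ.* suc q ℕ.^ n                         ∎
  where
  open ≡-Reasoning
  open +-*-Solver
  G = geometricSum (suc q) n

-- Divisibility of the exponents h m - 1 and h m + 1.

∣m+n∣n⇒∣m : ∀ {d m n} → d ∣ m ℕ.+ n → d ∣ n → d ∣ m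
∣m+n∣n⇒∣m {d} {m} {n} d∣m+n = ∣m+n∣m⇒∣n (subst (d ∣_) (ℕ.+-comm m n) d∣m+n)

prime-coprime : ∀ {p} n → Prime p → ¬ (p ∣ n) → Coprime n p
prime-coprime n p-prime p∤n (d∣n , d∣p) with prime⇒irreducible p-prime d∣p
... | inj₁ d≡1  = d≡1
... | inj₂ refl = contradiction d∣n p∤n

-- A common divisor of m and n p is coprime to n, hence divides p; a prime not dividing m shares no
-- factor with it.
coprime-*-prime : ∀ {m n p} → Prime p → Coprime m n → ¬ (p ∣ m) → Coprime m (n ℕ.* p)
coprime-*-prime {m} {n} {p} p-prime m⊥n p∤m (d∣m , d∣np) =
  prime-coprime m p-prime p∤m (d∣m , coprime-divisor (λ { (i∣d , i∣n) → m⊥n (∣-trans i∣d d∣m , i∣n) }) d∣np)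

-- The exponents e m with y ^ 2 ^ e m ≡ y for the ratio y of two chords that a conic
-- and a block of the m-th net have in common: h m - 1 or h m + 1.
record ExponentFamily (h t : ℕ) (e : ℕ → ℕ) : Set where
  field
    step    : ∀ {m} → 1 ℕ.≤ m → ∀ d → e (m ℕ.+ d) ≡ e m ℕ.+ h ℕ.* d
    coprime : ∀ {m} → 1 ℕ.≤ m → Coprime (e m) h
    hit     : ¬ (t ∣ h) → ∃ λ n → 1 ℕ.≤ n × n ℕ.< t × t ∣ e n

module _ {h t : ℕ} (t-prime : Prime t) where

  not-divisible : ∀ {e} → ExponentFamily h t e → t ∣ h → ∀ {m} → 1 ℕ.≤ m → ¬ (t ∣ e m)
  not-divisible family t∣h 1≤m t∣em =
    ℕ.nonTrivial⇒≢1 {{prime⇒nonTrivial t-prime}} (ExponentFamily.coprime family 1≤m (t∣em , t∣h))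

  -- `e` is affine in m with slope h, so for two hits at distance d the prime t divides h d; it does
  -- not divide h, and d < t, so d = 0.
  hit-unique : ∀ {e} → ExponentFamily h t e → ¬ (t ∣ h) → ∀ {m n} →
               1 ℕ.≤ m → 1 ℕ.≤ n → m ℕ.< t → n ℕ.< t → t ∣ e m → t ∣ e n → m ≡ n
  hit-unique {e} family t∤h {m} {n} 1≤m 1≤n m<t n<t t∣em t∣en = cases (ℕ.≤-total m n)
    where
    ordered : ∀ {m n} → 1 ℕ.≤ m → (∃ λ d → m ℕ.+ d ≡ n) → n ℕ.< t → t ∣ e m → t ∣ e n → m ≡ n
    ordered {m} 1≤m (zero , refl) _ _ _ = sym (ℕ.+-identityʳ m)
    ordered {m} 1≤m (suc d , refl) n<t t∣em t∣en
      with euclidsLemma h (suc d) t-prime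
             (∣m+n∣m⇒∣n (subst (t ∣_) (ExponentFamily.step family 1≤m (suc d)) t∣en) t∣em)
    ... | inj₁ t∣h = contradiction t∣h t∤h
    ... | inj₂ t∣d = contradiction t∣d (>⇒∤ (ℕ.≤-trans (s≤s (ℕ.m≤n+m (suc d) m)) n<t))
    cases : m ℕ.≤ n ⊎ n ℕ.≤ m → m ≡ n
    cases (inj₁ m≤n) = ordered 1≤m (ℕ.m≤n⇒∃[o]m+o≡n m≤n) n<t t∣em t∣en
    cases (inj₂ n≤m) = sym (ordered 1≤n (ℕ.m≤n⇒∃[o]m+o≡n n≤m) m<t t∣en t∣em)

  -- n is -1/h modulo t: Bézout supplies some solution, which is then reduced to its residue.
  hit⁺ : ¬ (t ∣ h) → ∃ λ n → 1 ℕ.≤ n × n ℕ.< t × t ∣ suc (h ℕ.* n)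
  hit⁺ t∤h = reduce (solution (coprime-Bézout (prime-coprime h t-prime t∤h)))
    where
    instance
      t≢0 : NonZero t
      t≢0 = prime⇒nonZero t-prime

    solution : GCD.Bézout.Identity 1 h t → ∃ λ x → t ∣ suc (h ℕ.* x)
    solution (GCD.Bézout.-+ x y eq) = x , divides y (trans (cong suc (ℕ.*-comm h x)) eq)
    -- Here x is 1/h modulo t; the factor t - 1 plays the role of -1.
    solution (GCD.Bézout.+- x y eq) = ℕ.pred t ℕ.* x ,
      ∣-trans (m∣m*n (suc (ℕ.pred t ℕ.* y))) (∣-reflexive (begin
        t ℕ.* suc (p ℕ.* y)                 ≡⟨ cong (ℕ._* suc (p ℕ.* y)) (ℕ.suc-pred t) ⟨
        suc p ℕ.* suc (p ℕ.* y)             ≡⟨ solve 2 (λ p y → (con 1 :+ p) :* (con 1 :+ p :* y)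
                                                 := con 1 :+ p :* (con 1 :+ y :* (con 1 :+ p))) refl p y ⟩
        suc (p ℕ.* suc (y ℕ.* suc p))       ≡⟨ cong (λ z → suc (p ℕ.* suc (y ℕ.* z))) (ℕ.suc-pred t) ⟩
        suc (p ℕ.* suc (y ℕ.* t))           ≡⟨ cong (λ z → suc (p ℕ.* z)) eq ⟩
        suc (p ℕ.* (x ℕ.* h))               ≡⟨ solve 3 (λ p x h → con 1 :+ p :* (x :* h) := con 1 :+ h :* (p :* x)) refl p x h ⟩
        suc (h ℕ.* (p ℕ.* x))               ∎))
      where
      open ≡-Reasoning
      open +-*-Solver
      p = ℕ.pred t

    reduce : (∃ λ x → t ∣ suc (h ℕ.* x)) → ∃ λ n → 1 ℕ.≤ n × n ℕ.< t × t ∣ suc (h ℕ.* n)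
    reduce (x , t∣) = x % t , ℕ.n≢0⇒n>0 x%t≢0 , m%n<n x t , t∣′
      where
      open ≡-Reasoning
      open +-*-Solver
      t∣′ : t ∣ suc (h ℕ.* (x % t))
      t∣′ = ∣m+n∣n⇒∣m (subst (t ∣_) (begin
        suc (h ℕ.* x)                                    ≡⟨ cong (λ z → suc (h ℕ.* z)) (m≡m%n+[m/n]*n x t) ⟩
        suc (h ℕ.* (x % t ℕ.+ x / t ℕ.* t))              ≡⟨ solve 4 (λ h r d t → con 1 :+ h :* (r :+ d :* t)
                                                              := (con 1 :+ h :* r) :+ h :* d :* t) refl h (x % t) (x / t) t ⟩
        suc (h ℕ.* (x % t)) ℕ.+ h ℕ.* (x / t) ℕ.* t      ∎) t∣) (n∣m*n (h ℕ.* (x / t)))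
      -- Residue 0 would make t divide 1; this excludes the index 0.
      x%t≢0 : x % t ≢ 0
      x%t≢0 eq = ℕ.nonTrivial⇒≢1 {{prime⇒nonTrivial t-prime}}
        (∣1⇒≡1 (subst (t ∣_) (cong suc (trans (cong (h ℕ.*_) eq) (ℕ.*-zeroʳ h))) t∣′))

  family⁺ : ExponentFamily h t (λ m → suc (h ℕ.* m))
  family⁺ = record
    { step    = λ {m} _ d → cong suc (ℕ.*-distribˡ-+ h m d)
    ; coprime = λ {m} _ (d∣e , d∣h) → ∣1⇒≡1 (∣m+n∣n⇒∣m d∣e (∣m⇒∣m*n m d∣h))
    ; hit     = hit⁺
    }

  module _ (1≤h : 1 ℕ.≤ h) where
    suc-e⁻ : ∀ {m} → 1 ℕ.≤ m → suc (h ℕ.* m ℕ.∸ 1) ≡ h ℕ.* m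
    suc-e⁻ 1≤m = ℕ.m+[n∸m]≡n (ℕ.*-mono-≤ 1≤h 1≤m)

    family⁻ : ExponentFamily h t (λ m → h ℕ.* m ℕ.∸ 1)
    family⁻ = record
      { step    = λ {m} 1≤m d → trans (cong (ℕ._∸ 1) (ℕ.*-distribˡ-+ h m d))
                                      (ℕ.+-∸-comm (h ℕ.* d) (ℕ.*-mono-≤ 1≤h 1≤m))
      ; coprime = λ {m} 1≤m {d} (d∣e , d∣h) → ∣1⇒≡1 (∣m+n∣n⇒∣m
          (subst (d ∣_) (sym (suc-e⁻ 1≤m)) (∣m⇒∣m*n m d∣h)) d∣e)
      ; hit     = λ t∤h → reflect (hit⁺ t∤h)
      }
      where
      reflect : (∃ λ n → 1 ℕ.≤ n × n ℕ.< t × t ∣ suc (h ℕ.* n)) → ∃ λ n → 1 ℕ.≤ n × n ℕ.< t × t ∣ h ℕ.* n ℕ.∸ 1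
      -- Replacing r by t - r changes the sign of h r modulo t: the two exponents add up to h t.
      reflect (r , 1≤r , r<t , t∣) = t ℕ.∸ r , ℕ.m<n⇒0<n∸m r<t , ℕ.∸-monoʳ-< {t} 1≤r (ℕ.<⇒≤ r<t) ,
        ∣m+n∣n⇒∣m (subst (t ∣_) (sym (begin
          (h ℕ.* (t ℕ.∸ r) ℕ.∸ 1) ℕ.+ suc (h ℕ.* r) ≡⟨ ℕ.+-suc _ _ ⟩
          suc (h ℕ.* (t ℕ.∸ r) ℕ.∸ 1) ℕ.+ h ℕ.* r   ≡⟨ cong (ℕ._+ h ℕ.* r) (suc-e⁻ (ℕ.m<n⇒0<n∸m r<t)) ⟩
          h ℕ.* (t ℕ.∸ r) ℕ.+ h ℕ.* r               ≡⟨ ℕ.*-distribˡ-+ h (t ℕ.∸ r) r ⟨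
          h ℕ.* (t ℕ.∸ r ℕ.+ r)                     ≡⟨ cong (h ℕ.*_) (ℕ.m∸n+n≡m (ℕ.<⇒≤ r<t)) ⟩
          h ℕ.* t                                   ∎)) (n∣m*n h)) t∣
        where open ≡-Reasoning

-- Finite fields: inverses, Lagrange's argument, polynomials as lists.

module Field {n : ℕ} (F : FiniteField n) where
  open FiniteField F renaming (Carrier to K) public
  open CommutativeRing commutativeRing public
    using ( +-comm; +-identityˡ; +-identityʳ; -‿inverseʳ
          ; *-comm; *-assoc; *-identityˡ; *-identityʳ; zeroˡ; zeroʳ
          ; ring; *-commutativeMonoid; commutativeSemiring)
  open ExpProperties commutativeSemiring public using (^-homo-*; ^-assocʳ; ^-distrib-*)
  open RingProperties ring public using (-‿distribˡ-*; -‿involutive)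
  open ≡-Reasoning

  private
    module ↔ = Inverse finite

  infix 4 _≟_
  _≟_ : (x y : K) → Dec (x ≡ y)
  x ≟ y = map′ (λ eq → trans (sym (↔.strictlyInverseʳ x)) (trans (cong ↔.from eq) (↔.strictlyInverseʳ y)))
               (cong ↔.to) (↔.to x Fin.≟ ↔.to y)

  infix 9 _⁻¹
  -- Made total by giving 0 the inverse 0, so that quotients can be formed before the denominator is
  -- known to be nonzero.
  _⁻¹ : K → K
  x ⁻¹ with x ≟ 0#
  ... | yes _ = 0#
  ... | no x≢0 = proj₁ (inverse x x≢0)

  ⁻¹-inverse : ∀ {x} → x ≢ 0# → x * x ⁻¹ ≡ 1#
  ⁻¹-inverse {x} x≢0 with x ≟ 0#
  ... | yes x≡0 = contradiction x≡0 x≢0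
  ... | no x≢0′ = proj₂ (inverse x x≢0′)

  1≢0 : 1# ≢ 0#
  1≢0 = 0≢1 ∘ sym

  *-cancelˡ : ∀ {x y z} → x ≢ 0# → x * y ≡ x * z → y ≡ z
  *-cancelˡ {x} {y} {z} x≢0 eq = trans (sym (undo y)) (trans (cong (x ⁻¹ *_) eq) (undo z))
    where
    undo : ∀ w → x ⁻¹ * (x * w) ≡ w
    undo w = begin
      x ⁻¹ * (x * w) ≡⟨ sym (*-assoc _ _ _) ⟩
      x ⁻¹ * x * w   ≡⟨ cong (_* w) (trans (*-comm _ _) (⁻¹-inverse x≢0)) ⟩
      1# * w         ≡⟨ *-identityˡ w ⟩
      w              ∎

  quotient : ∀ x {y} → y ≢ 0# → x * y ⁻¹ * y ≡ x
  quotient x {y} y≢0 = begin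
    x * y ⁻¹ * y   ≡⟨ *-assoc x _ y ⟩
    x * (y ⁻¹ * y) ≡⟨ cong (x *_) (trans (*-comm _ y) (⁻¹-inverse y≢0)) ⟩
    x * 1#         ≡⟨ *-identityʳ x ⟩
    x              ∎

  *-nonzero : ∀ {x y} → x ≢ 0# → y ≢ 0# → x * y ≢ 0#
  *-nonzero x≢0 y≢0 eq = y≢0 (*-cancelˡ x≢0 (trans eq (sym (zeroʳ _))))

  *-nonzeroʳ : ∀ x {y} → x * y ≢ 0# → y ≢ 0#
  *-nonzeroʳ x xy≢0 refl = xy≢0 (zeroʳ x)

  ⁻¹-nonzero : ∀ {x} → x ≢ 0# → x ⁻¹ ≢ 0#
  ⁻¹-nonzero {x} x≢0 = *-nonzeroʳ x λ eq → 1≢0 (trans (sym (⁻¹-inverse x≢0)) eq)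

  *-zero⁻¹ : ∀ {x y} → x ≢ 0# → x * y ≡ 0# → y ≡ 0#
  *-zero⁻¹ x≢0 eq = *-cancelˡ x≢0 (trans eq (sym (zeroʳ _)))

  ^-nonzero : ∀ {x} k → x ≢ 0# → x ^ k ≢ 0#
  ^-nonzero zero    x≢0 = 1≢0
  ^-nonzero (suc k) x≢0 = *-nonzero x≢0 (^-nonzero k x≢0)

  1^ : ∀ k → 1# ^ k ≡ 1#
  1^ zero    = refl
  1^ (suc k) = trans (*-identityˡ _) (1^ k)

  0^ : ∀ {k} → 1 ℕ.≤ k → 0# ^ k ≡ 0#
  0^ (s≤s _) = zeroˡ _

  open MonoidSum *-commutativeMonoid
    renaming (sum to ∏; sum-permute to ∏-permute; sum-cong-≗ to ∏-cong; ∑-distrib-+ to ∏-distrib-*)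
    using ()

  ∏-nonzero : ∀ {k} (ρ : Fin k → K) → (∀ i → ρ i ≢ 0#) → ∏ ρ ≢ 0#
  ∏-nonzero {zero}  ρ ρ≢0 = 1≢0
  ∏-nonzero {suc k} ρ ρ≢0 = *-nonzero (ρ≢0 zero) (∏-nonzero (ρ ∘ suc) (ρ≢0 ∘ suc))

  ∏-const : ∀ k x → ∏ {k} (λ _ → x) ≡ x ^ k
  ∏-const zero    x = refl
  ∏-const (suc k) x = cong (x *_) (∏-const k x)

  -- Multiplication by x permutes the ρ i, hence preserves their product.
  lagrange : ∀ {k} (ρ : Fin k → K) → Injective _≡_ _≡_ ρ → (∀ i → ρ i ≢ 0#) →
             ∀ x → x ≢ 0# → (∀ i → ∃ λ j → x * ρ i ≡ ρ j) → x ^ k ≡ 1#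
  lagrange {k} ρ ρ-inj ρ≢0 x x≢0 closed =
    *-cancelˡ (∏-nonzero ρ ρ≢0) (begin
      ∏ ρ * x ^ k              ≡⟨ *-comm _ _ ⟩
      x ^ k * ∏ ρ              ≡⟨ cong (_* ∏ ρ) (∏-const k x) ⟨
      ∏ {k} (λ _ → x) * ∏ ρ    ≡⟨ ∏-distrib-* (λ _ → x) ρ ⟨
      ∏ (λ i → x * ρ i)        ≡⟨ ∏-cong (proj₂ ∘ closed) ⟩
      ∏ (ρ ∘ σ)                ≡⟨ ∏-permute ρ (injective⇒permutation {f = σ} σ-inj) ⟨
      ∏ ρ                      ≡⟨ *-identityʳ _ ⟨
      ∏ ρ * 1#                 ∎)
    where
    σ : Fin k → Fin k
    σ = proj₁ ∘ closed
    σ-inj : Injective _≡_ _≡_ σ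
    σ-inj {i} {j} eq = ρ-inj (*-cancelˡ x≢0
      (trans (proj₂ (closed i)) (trans (cong ρ eq) (sym (proj₂ (closed j))))))

  Nonzeros : ℕ → Set
  Nonzeros k = Σ (Fin k → K) λ ρ →
    Injective _≡_ _≡_ ρ × (∀ i → ρ i ≢ 0#) × (∀ x → x ≢ 0# → ∃ λ i → x ≡ ρ i)

  -- `punchIn` skips the index of 0 in the enumeration of the field.
  nonzeros : ∀ {k} → n ≡ suc k → Nonzeros k
  nonzeros {k} refl = ρ , ρ-inj , ρ≢0 , ρ-surj
    where
    z : Fin (suc k)
    z = ↔.to 0#
    ρ : Fin k → K
    ρ i = ↔.from (punchIn z i)
    from-inj : ∀ {i j} → ↔.from i ≡ ↔.from j → i ≡ j
    from-inj {i} {j} eq = trans (sym (↔.strictlyInverseˡ i)) (trans (cong ↔.to eq) (↔.strictlyInverseˡ j))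
    ρ-inj : Injective _≡_ _≡_ ρ
    ρ-inj = Fin.punchIn-injective z _ _ ∘ from-inj
    ρ≢0 : ∀ i → ρ i ≢ 0#
    ρ≢0 i eq = Fin.punchInᵢ≢i z i (trans (sym (↔.strictlyInverseˡ _)) (cong ↔.to eq))
    ρ-surj : ∀ x → x ≢ 0# → ∃ λ i → x ≡ ρ i
    ρ-surj x x≢0 = punchOut z≢x ,
      sym (trans (cong ↔.from (Fin.punchIn-punchOut z≢x)) (↔.strictlyInverseʳ x))
      where
      z≢x : z ≢ ↔.to x
      z≢x eq = x≢0 (trans (sym (↔.strictlyInverseʳ x)) (trans (cong ↔.from (sym eq)) (↔.strictlyInverseʳ 0#)))

  order≡suc : ∃ λ k → n ≡ suc k
  order≡suc = go n (↔.to 0#)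
    where
    go : ∀ m → Fin m → ∃ λ k → m ≡ suc k
    go (suc k) _ = k , refl

  ^-order-1 : ∀ {k} → n ≡ suc k → ∀ {x} → x ≢ 0# → x ^ k ≡ 1#
  ^-order-1 eq {x} x≢0 with nonzeros eq
  ... | ρ , ρ-inj , ρ≢0 , ρ-surj =
    lagrange ρ ρ-inj ρ≢0 x x≢0 λ i → ρ-surj (x * ρ i) (*-nonzero x≢0 (ρ≢0 i))

  ^-order : ∀ x → x ^ n ≡ x
  ^-order x with order≡suc
  ... | k , eq = trans (cong (x ^_) eq) (go (x ≟ 0#))
    where
    go : Dec (x ≡ 0#) → x ^ suc k ≡ x
    go (yes refl) = zeroˡ _
    go (no x≢0) = trans (cong (x *_) (^-order-1 eq x≢0)) (*-identityʳ x)

  -- Horner's scheme, constant term first. Trailing zeros are allowed, so degree bounds are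
  -- expressed by `length` or by the vanishing of `coeff`.
  eval : List K → K → K
  eval []      x = 0#
  eval (a ∷ p) x = a + x * eval p x

  coeff : List K → ℕ → K
  coeff []      _       = 0#
  coeff (a ∷ p) zero    = a
  coeff (a ∷ p) (suc i) = coeff p i

-- Characteristic 2: Frobenius maps and the number of roots of a polynomial.

module Characteristic2 {n : ℕ} (F : FiniteField n) (2∣n : 2 ∣ n) where
  open Field F public
  open ≡-Reasoning

  -- The characteristic is read off from the parity of the order: x^n = x for every x, while an even
  -- power of -1 is 1.
  -1≡1 : - 1# ≡ 1#
  -1≡1 = begin
    - 1#                ≡⟨ ^-order (- 1#) ⟨
    (- 1#) ^ n          ≡⟨ cong ((- 1#) ^_) (trans n≡k*2 (ℕ.*-comm k 2)) ⟩
    (- 1#) ^ (2 ℕ.* k)  ≡⟨ ^-assocʳ (- 1#) 2 k ⟨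
    ((- 1#) ^ 2) ^ k    ≡⟨ cong (_^ k) (cong (- 1# *_) (*-identityʳ _)) ⟩
    (- 1# * - 1#) ^ k   ≡⟨ cong (_^ k) (sym (-‿distribˡ-* 1# (- 1#))) ⟩
    (- (1# * - 1#)) ^ k ≡⟨ cong (λ z → (- z) ^ k) (*-identityˡ _) ⟩
    (- (- 1#)) ^ k      ≡⟨ cong (_^ k) (-‿involutive 1#) ⟩
    1# ^ k              ≡⟨ 1^ k ⟩
    1#                  ∎
    where open _∣_ 2∣n renaming (quotient to k; equality to n≡k*2)

  𝔽₂ : RawRing 0ℓ 0ℓ
  𝔽₂ = record { Carrier = Bool ; _≈_ = _≡_ ; _+_ = Bool._xor_ ; _*_ = Bool._∧_ ; -_ = λ b → b ; 0# = false ; 1# = true }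

  private
    almostRing : AlmostCommutativeRing 0ℓ 0ℓ
    almostRing = fromCommutativeRing commutativeRing

    ⟦_⟧ᵇ : Bool → K
    ⟦ false ⟧ᵇ = 0#
    ⟦ true  ⟧ᵇ = 1#

    morphism : 𝔽₂ -Raw-AlmostCommutative⟶ almostRing
    morphism = record
      { ⟦_⟧    = ⟦_⟧ᵇ
      ; +-homo = λ { false b → sym (+-identityˡ _) ; true false → sym (+-identityʳ _)
                   ; true true → sym (trans (cong (1# +_) (sym -1≡1)) (-‿inverseʳ 1#)) }
      ; *-homo = λ { false b → sym (zeroˡ _) ; true b → sym (*-identityˡ _) }
      ; -‿homo = λ { false → sym (trans (sym (+-identityˡ _)) (-‿inverseʳ 0#)) ; true → sym -1≡1 }
      ; 0-homo = refl
      ; 1-homo = refl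
      }

    coefficient≟ : ∀ x y → Maybe (⟦ x ⟧ᵇ ≡ ⟦ y ⟧ᵇ)
    coefficient≟ false false = just refl
    coefficient≟ true  true  = just refl
    coefficient≟ _     _     = nothing

  -- Normalisation is over 𝔽₂, so the solver knows that x + x ≡ 0#.
  open RingSolver 𝔽₂ almostRing morphism coefficient≟ public
    using (solve; _:=_; _:+_; _:*_; :-_; con)

  x+x≡0 : ∀ x → x + x ≡ 0#
  x+x≡0 = solve 1 (λ x → x :+ x := con false) refl

  +-≡0⇒≡ : ∀ {x y} → x + y ≡ 0# → x ≡ y
  +-≡0⇒≡ {x} {y} eq = begin
    x           ≡⟨ solve 2 (λ x y → x := (x :+ y) :+ y) refl x y ⟩
    (x + y) + y ≡⟨ cong (_+ y) eq ⟩
    0# + y      ≡⟨ +-identityˡ y ⟩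
    y           ∎

  ≡⇒+-≡0 : ∀ {x y} → x ≡ y → x + y ≡ 0#
  ≡⇒+-≡0 refl = x+x≡0 _

  square-+ : ∀ x y → (x + y) ^ 2 ≡ x ^ 2 + y ^ 2
  square-+ = solve 2 (λ x y → (x :+ y) :* ((x :+ y) :* con true) := x :* (x :* con true) :+ y :* (y :* con true)) refl

  frobenius-+ : ∀ k x y → (x + y) ^ (2 ℕ.^ k) ≡ x ^ (2 ℕ.^ k) + y ^ (2 ℕ.^ k)
  frobenius-+ zero    x y = solve 2 (λ x y → (x :+ y) :* con true := x :* con true :+ y :* con true) refl x y
  frobenius-+ (suc k) x y = begin
    (x + y) ^ (2 ℕ.* 2 ℕ.^ k)   ≡⟨ ^-assocʳ _ 2 (2 ℕ.^ k) ⟨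
    ((x + y) ^ 2) ^ (2 ℕ.^ k)   ≡⟨ cong (_^ (2 ℕ.^ k)) (square-+ x y) ⟩
    (x ^ 2 + y ^ 2) ^ (2 ℕ.^ k) ≡⟨ frobenius-+ k _ _ ⟩
    (x ^ 2) ^ (2 ℕ.^ k) + (y ^ 2) ^ (2 ℕ.^ k) ≡⟨ cong₂ _+_ (^-assocʳ x 2 (2 ℕ.^ k)) (^-assocʳ y 2 (2 ℕ.^ k)) ⟩
    x ^ (2 ℕ.* 2 ℕ.^ k) + y ^ (2 ℕ.* 2 ℕ.^ k) ∎

  2^≥1 : ∀ k → 1 ℕ.≤ 2 ℕ.^ k
  2^≥1 = ℕ.m^n>0 2

  ^-zero⁻¹ : ∀ {x} k → x ^ k ≡ 0# → x ≡ 0#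
  ^-zero⁻¹ {x} k eq with x ≟ 0#
  ... | yes x≡0 = x≡0
  ... | no x≢0 = contradiction eq (^-nonzero k x≢0)

  frobenius-injective : ∀ k {x y} → x ^ (2 ℕ.^ k) ≡ y ^ (2 ℕ.^ k) → x ≡ y
  frobenius-injective k {x} {y} eq =
    +-≡0⇒≡ (^-zero⁻¹ (2 ℕ.^ k) (trans (frobenius-+ k x y) (≡⇒+-≡0 eq)))

  -- Synthetic division: the coefficients of (p(X) - p(r)) / (X - r) are the intermediate values of
  -- Horner's scheme at r. The list keeps the length of p and ends in a zero.
  quot : K → List K → List K
  quot r []      = []
  quot r (a ∷ p) = eval p r ∷ quot r p

  eval-quot : ∀ r p x → eval p x + eval p r ≡ (x + r) * eval (quot r p) x
  eval-quot r []      x = solve 2 (λ x r → con false :+ con false := (x :+ r) :* con false) refl x r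
  eval-quot r (a ∷ p) x = begin
    (a + x * P x) + (a + r * P r)        ≡⟨ solve 5 (λ a x r Px Pr →
      (a :+ x :* Px) :+ (a :+ r :* Pr) := x :* (Px :+ Pr) :+ (x :+ r) :* Pr) refl a x r (P x) (P r) ⟩
    x * (P x + P r) + (x + r) * P r      ≡⟨ cong (λ z → x * z + (x + r) * P r) (eval-quot r p x) ⟩
    x * ((x + r) * Q) + (x + r) * P r    ≡⟨ solve 4 (λ x r Pr Q →
      x :* ((x :+ r) :* Q) :+ (x :+ r) :* Pr := (x :+ r) :* (Pr :+ x :* Q)) refl x r (P r) Q ⟩
    (x + r) * (P r + x * Q)              ∎
    where
    P = eval p
    Q = eval (quot r p) x

  eval-drop : ∀ p j x → eval (drop j p) x ≡ coeff p j + x * eval (drop (suc j) p) x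
  eval-drop []      zero    x = solve 1 (λ x → con false := con false :+ x :* con false) refl x
  eval-drop []      (suc j) x = solve 1 (λ x → con false := con false :+ x :* con false) refl x
  eval-drop (a ∷ p) zero    x = refl
  eval-drop (a ∷ p) (suc j) x = eval-drop p j x

  coeff-quot : ∀ r p j → coeff (quot r p) j ≡ eval (drop (suc j) p) r
  coeff-quot r []      j       = refl
  coeff-quot r (a ∷ p) zero    = refl
  coeff-quot r (a ∷ p) (suc j) = coeff-quot r p j

  zero-coeffs⇒eval-drop≡0 : ∀ p j → (∀ i → j ℕ.≤ i → coeff p i ≡ 0#) → ∀ x → eval (drop j p) x ≡ 0#
  zero-coeffs⇒eval-drop≡0 []      zero    zs x = refl
  zero-coeffs⇒eval-drop≡0 []      (suc j) zs x = refl
  zero-coeffs⇒eval-drop≡0 (a ∷ p) zero    zs x = begin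
    a + x * eval p x ≡⟨ cong₂ (λ u v → u + x * v) (zs 0 z≤n)
                          (zero-coeffs⇒eval-drop≡0 p 0 (λ i _ → zs (suc i) z≤n) x) ⟩
    0# + x * 0#      ≡⟨ solve 1 (λ x → con false :+ x :* con false := con false) refl x ⟩
    0#               ∎
  zero-coeffs⇒eval-drop≡0 (a ∷ p) (suc j) zs x = zero-coeffs⇒eval-drop≡0 p j (λ i j≤i → zs (suc i) (s≤s j≤i)) x

  -- Induction on the number of roots: the quotient by X - `ρ zero` has the other roots and a degree
  -- bound lowered by one. Its coefficients are the Horner tails of p at `ρ zero`, from which those
  -- of p are recovered.
  many-roots⇒zero : ∀ k p (ρ : Fin k → K) → Injective _≡_ _≡_ ρ →
                    (∀ j → k ℕ.≤ j → coeff p j ≡ 0#) → (∀ i → eval p (ρ i) ≡ 0#) →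
                    ∀ j → coeff p j ≡ 0#
  many-roots⇒zero zero    p ρ ρ-inj deg root j = deg j z≤n
  many-roots⇒zero (suc k) p ρ ρ-inj deg root = λ j →
    begin
      coeff p j                                         ≡⟨ solve 2 (λ a b → a := (a :+ b) :+ b) refl (coeff p j) (r * D (suc j)) ⟩
      (coeff p j + r * D (suc j)) + r * D (suc j)       ≡⟨ cong (_+ r * D (suc j)) (eval-drop p j r) ⟨
      D j + r * D (suc j)                               ≡⟨ cong₂ (λ u v → u + r * v) (D≡0 j) (D≡0 (suc j)) ⟩
      0# + r * 0#                                       ≡⟨ solve 1 (λ x → con false :+ x :* con false := con false) refl r ⟩
      0#                                                ∎
    where
    r = ρ zero
    D : ℕ → K
    D j = eval (drop j p) r
    quot-deg : ∀ j → k ℕ.≤ j → coeff (quot r p) j ≡ 0#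
    quot-deg j k≤j = trans (coeff-quot r p j)
      (zero-coeffs⇒eval-drop≡0 p (suc j) (λ i j<i → deg i (ℕ.≤-trans (s≤s k≤j) j<i)) r)
    quot-root : ∀ i → eval (quot r p) (ρ (suc i)) ≡ 0#
    quot-root i = *-zero⁻¹ {ρ (suc i) + r}
      (λ eq → Fin.0≢1+n (sym (ρ-inj (+-≡0⇒≡ eq))))
      (trans (sym (eval-quot r p (ρ (suc i)))) (≡⇒+-≡0 (trans (root (suc i)) (sym (root zero)))))
    D≡0 : ∀ j → D j ≡ 0#
    D≡0 zero    = root zero
    D≡0 (suc j) = trans (sym (coeff-quot r p j))
      (many-roots⇒zero k (quot r p) (ρ ∘ suc) (Fin.suc-injective ∘ ρ-inj) quot-deg quot-root j)

-- Powers of linear forms with exponent 1 + q + ... + q^(k-1).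

module NormPolynomials {n : ℕ} (F : FiniteField n) (2∣n : 2 ∣ n) (h : ℕ) (1≤h : 1 ℕ.≤ h) where
  open Characteristic2 F 2∣n
  open ≡-Reasoning

  q : ℕ
  q = 2 ℕ.^ h

  2≤q : 2 ℕ.≤ q
  2≤q = ℕ.^-monoʳ-≤ 2 1≤h

  0^q : 0# ^ q ≡ 0#
  0^q = 0^ (2^≥1 h)

  coeff-length : ∀ p j → length p ℕ.≤ j → coeff p j ≡ 0#
  coeff-length []      j       _         = refl
  coeff-length (a ∷ p) (suc j) (s≤s len) = coeff-length p j len

  shift : ℕ → List K → List K
  shift k p = replicate k 0# ++ p

  eval-shift : ∀ k p x → eval (shift k p) x ≡ x ^ k * eval p x
  eval-shift zero    p x = sym (*-identityˡ _)
  eval-shift (suc k) p x = begin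
    0# + x * eval (shift k p) x ≡⟨ +-identityˡ _ ⟩
    x * eval (shift k p) x      ≡⟨ cong (x *_) (eval-shift k p x) ⟩
    x * (x ^ k * eval p x)      ≡⟨ *-assoc _ _ _ ⟨
    x * x ^ k * eval p x        ∎

  coeff-shift : ∀ k p j → coeff (shift k p) (k ℕ.+ j) ≡ coeff p j
  coeff-shift zero    p j = refl
  coeff-shift (suc k) p j = coeff-shift k p j

  coeff-shift-< : ∀ k p {j} → j ℕ.< k → coeff (shift k p) j ≡ 0#
  coeff-shift-< (suc k) p {zero}  _         = refl
  coeff-shift-< (suc k) p {suc j} (s≤s j<k) = coeff-shift-< k p j<k

  length-shift : ∀ k p → length (shift k p) ≡ k ℕ.+ length p
  length-shift k p = trans (List.length-++ (replicate k 0#)) (cong (ℕ._+ length p) (List.length-replicate k))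

  infixl 6 _⊞_
  _⊞_ : List K → List K → List K
  []      ⊞ p′       = p′
  (a ∷ p) ⊞ []       = a ∷ p
  (a ∷ p) ⊞ (b ∷ p′) = a + b ∷ p ⊞ p′

  coeff-⊞ : ∀ p p′ j → coeff (p ⊞ p′) j ≡ coeff p j + coeff p′ j
  coeff-⊞ []      p′       j       = sym (+-identityˡ _)
  coeff-⊞ (a ∷ p) []       j       = sym (+-identityʳ _)
  coeff-⊞ (a ∷ p) (b ∷ p′) zero    = refl
  coeff-⊞ (a ∷ p) (b ∷ p′) (suc j) = coeff-⊞ p p′ j

  eval-⊞ : ∀ p p′ x → eval (p ⊞ p′) x ≡ eval p x + eval p′ x
  eval-⊞ []      p′       x = sym (+-identityˡ _)
  eval-⊞ (a ∷ p) []       x = sym (+-identityʳ _)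
  eval-⊞ (a ∷ p) (b ∷ p′) x = trans (cong (λ z → a + b + x * z) (eval-⊞ p p′ x))
    (solve 5 (λ a b x u v → a :+ b :+ x :* (u :+ v) := (a :+ x :* u) :+ (b :+ x :* v)) refl
      a b x (eval p x) (eval p′ x))

  scale : K → List K → List K
  scale e = map (e *_)

  coeff-scale : ∀ e p j → coeff (scale e p) j ≡ e * coeff p j
  coeff-scale e []      j       = sym (zeroʳ e)
  coeff-scale e (a ∷ p) zero    = refl
  coeff-scale e (a ∷ p) (suc j) = coeff-scale e p j

  eval-scale : ∀ e p x → eval (scale e p) x ≡ e * eval p x
  eval-scale e []      x = sym (zeroʳ e)
  eval-scale e (a ∷ p) x = trans (cong (λ z → e * a + x * z) (eval-scale e p x))
    (solve 4 (λ e a x u → e :* a :+ x :* (e :* u) := e :* (a :+ x :* u)) refl e a x (eval p x))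

  module _ (c d : K) where

    -- The coefficients of (d + c X) p(X)^q.
    expand : List K → List K
    expand []          = []
    expand (a ∷ [])    = d * a ^ q ∷ c * a ^ q ∷ []
    -- Each coefficient yields a pair of entries, and consecutive pairs start q places apart. No
    -- zeros follow the last pair, which keeps the degree bound sharp.
    expand (a ∷ b ∷ p) = d * a ^ q ∷ c * a ^ q ∷ shift (q ℕ.∸ 2) (expand (b ∷ p))

    -- Raising to the power q is additive, so p(X)^q has the coefficients a^q at the multiples of q.
    eval-expand : ∀ p x → eval (expand p) x ≡ (d + c * x) * eval p x ^ q
    eval-expand []       x = sym (trans (cong ((d + c * x) *_) 0^q) (zeroʳ _))
    eval-expand (a ∷ []) x = begin
      d * a ^ q + x * (c * a ^ q + x * 0#) ≡⟨ solve 4 (λ c d x α →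
        d :* α :+ x :* (c :* α :+ x :* con false) := (d :+ c :* x) :* α) refl c d x (a ^ q) ⟩
      (d + c * x) * a ^ q                  ≡⟨ cong (λ z → (d + c * x) * z ^ q)
                                               (solve 2 (λ a x → a := a :+ x :* con false) refl a x) ⟩
      (d + c * x) * (a + x * 0#) ^ q       ∎
    eval-expand (a ∷ p@(_ ∷ _)) x = begin
      d * a ^ q + x * (c * a ^ q + x * eval (shift (q ℕ.∸ 2) (expand p)) x)
        ≡⟨ cong (λ z → d * a ^ q + x * (c * a ^ q + x * z)) (trans (eval-shift (q ℕ.∸ 2) (expand p) x)
             (cong (x ^ (q ℕ.∸ 2) *_) (eval-expand p x))) ⟩
      d * a ^ q + x * (c * a ^ q + x * (x ^ (q ℕ.∸ 2) * ((d + c * x) * eval p x ^ q)))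
        ≡⟨ solve 6 (λ c d x α y β → d :* α :+ x :* (c :* α :+ x :* (y :* ((d :+ c :* x) :* β)))
             := (d :+ c :* x) :* (α :+ x :* (x :* y) :* β)) refl c d x (a ^ q) (x ^ (q ℕ.∸ 2)) (eval p x ^ q) ⟩
      (d + c * x) * (a ^ q + x ^ (2 ℕ.+ (q ℕ.∸ 2)) * eval p x ^ q)
        ≡⟨ cong (λ k → (d + c * x) * (a ^ q + x ^ k * eval p x ^ q)) (ℕ.m+[n∸m]≡n 2≤q) ⟩
      (d + c * x) * (a ^ q + x ^ q * eval p x ^ q)
        ≡⟨ cong (λ z → (d + c * x) * (a ^ q + z)) (sym (^-distrib-* x (eval p x) q)) ⟩
      (d + c * x) * (a ^ q + (x * eval p x) ^ q)
        ≡⟨ cong ((d + c * x) *_) (sym (frobenius-+ h a _)) ⟩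
      (d + c * x) * (a + x * eval p x) ^ q ∎

    *0^q : ∀ e → e * 0# ^ q ≡ 0#
    *0^q e = trans (cong (e *_) 0^q) (zeroʳ e)

    coeff₀-expand : ∀ p → coeff (expand p) 0 ≡ d * coeff p 0 ^ q
    coeff₀-expand []          = sym (*0^q d)
    coeff₀-expand (a ∷ [])    = refl
    coeff₀-expand (a ∷ _ ∷ _) = refl

    coeff₁-expand : ∀ p → coeff (expand p) 1 ≡ c * coeff p 0 ^ q
    coeff₁-expand []          = sym (*0^q c)
    coeff₁-expand (a ∷ [])    = refl
    coeff₁-expand (a ∷ _ ∷ _) = refl

    suc-q : suc q ≡ 2 ℕ.+ ((q ℕ.∸ 2) ℕ.+ 1)
    suc-q = cong suc (trans (sym (ℕ.m+[n∸m]≡n 2≤q)) (cong suc (ℕ.+-comm 1 _)))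

    -- The pair coming from the coefficient of X occupies the places q and q + 1.
    coeff-suc-q-expand : ∀ p → coeff (expand p) (suc q) ≡ c * coeff p 1 ^ q
    coeff-suc-q-expand []       = sym (*0^q c)
    coeff-suc-q-expand (a ∷ []) = trans (cong (coeff (expand (a ∷ []))) suc-q) (sym (*0^q c))
    coeff-suc-q-expand (a ∷ p@(_ ∷ _)) = begin
      coeff (expand (a ∷ p)) (suc q)                                  ≡⟨ cong (coeff (expand (a ∷ p))) suc-q ⟩
      coeff (shift (q ℕ.∸ 2) (expand p)) ((q ℕ.∸ 2) ℕ.+ 1)            ≡⟨ coeff-shift (q ℕ.∸ 2) (expand p) 1 ⟩
      coeff (expand p) 1                                              ≡⟨ coeff₁-expand p ⟩
      c * coeff p 0 ^ q                                               ∎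

    length-expand : ∀ p {m} → length p ℕ.≤ suc m → length (expand p) ℕ.≤ 2 ℕ.+ q ℕ.* m
    length-expand []       _ = z≤n
    length-expand (a ∷ []) _ = s≤s (s≤s z≤n)
    length-expand (a ∷ p@(_ ∷ _)) {suc m} (s≤s len) = s≤s (s≤s (≤R.begin
      length (shift (q ℕ.∸ 2) (expand p))     ≤R.≡⟨ length-shift (q ℕ.∸ 2) (expand p) ⟩
      (q ℕ.∸ 2) ℕ.+ length (expand p)         ≤R.≤⟨ ℕ.+-monoʳ-≤ (q ℕ.∸ 2) (length-expand p len) ⟩
      (q ℕ.∸ 2) ℕ.+ (2 ℕ.+ q ℕ.* m)           ≤R.≡⟨ ℕ.+-assoc (q ℕ.∸ 2) 2 _ ⟨
      ((q ℕ.∸ 2) ℕ.+ 2) ℕ.+ q ℕ.* m           ≤R.≡⟨ cong (ℕ._+ q ℕ.* m) (ℕ.m∸n+n≡m 2≤q) ⟩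
      q ℕ.+ q ℕ.* m                           ≤R.≡⟨ ℕ.*-suc q m ⟨
      q ℕ.* suc m                             ≤R.∎))

    -- The expansion of (d + c X)^(1 + q + ... + q^(k-1)). The recursion multiplies the exponent by
    -- q and adds 1, so the low coefficients of one stage are determined by those of the stage
    -- before.
    normPolynomial : ℕ → List K
    normPolynomial zero    = 1# ∷ []
    normPolynomial (suc k) = expand (normPolynomial k)

    eval-normPolynomial : ∀ k x → eval (normPolynomial k) x ≡ (d + c * x) ^ geometricSum q k
    eval-normPolynomial zero    x = solve 1 (λ x → con true :+ x :* con false := con true) refl x
    eval-normPolynomial (suc k) x = begin
      eval (expand (normPolynomial k)) x ≡⟨ eval-expand (normPolynomial k) x ⟩
      z * eval (normPolynomial k) x ^ q  ≡⟨ cong (λ y → z * y ^ q) (eval-normPolynomial k x) ⟩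
      z * (z ^ geometricSum q k) ^ q     ≡⟨ cong (z *_) (^-assocʳ z (geometricSum q k) q) ⟩
      z ^ suc (geometricSum q k ℕ.* q)   ≡⟨ cong (λ j → z ^ suc j) (ℕ.*-comm (geometricSum q k) q) ⟩
      z ^ suc (q ℕ.* geometricSum q k)   ≡⟨ cong (z ^_) (geometricSum-suc q k) ⟨
      z ^ geometricSum q (suc k)         ∎
      where z = d + c * x

    length-normPolynomial : ∀ k → length (normPolynomial k) ℕ.≤ suc (geometricSum q k)
    length-normPolynomial zero    = s≤s z≤n
    length-normPolynomial (suc k) = ℕ.≤-trans (length-expand (normPolynomial k) (length-normPolynomial k))
      (ℕ.≤-reflexive (cong suc (sym (geometricSum-suc q k))))

    constantTerm : ℕ → K
    constantTerm k = coeff (normPolynomial k) 0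

    constantTerm-zero : ∀ k → d ≡ 0# → constantTerm (suc k) ≡ 0#
    constantTerm-zero k refl = trans (coeff₀-expand (normPolynomial k)) (zeroˡ _)

    constantTerm-nonzero : ∀ k → d ≢ 0# → constantTerm k ≢ 0#
    constantTerm-nonzero zero    d≢0 = 1≢0
    constantTerm-nonzero (suc k) d≢0 eq = *-nonzero d≢0 (^-nonzero q (constantTerm-nonzero k d≢0))
      (trans (sym (coeff₀-expand (normPolynomial k))) eq)

  monomialMinusConstant : K → ℕ → List K
  monomialMinusConstant δ m = δ ∷ shift m (1# ∷ [])

  eval-monomialMinusConstant : ∀ δ m x → eval (monomialMinusConstant δ m) x ≡ δ + x ^ suc m
  eval-monomialMinusConstant δ m x = cong (δ +_) (begin
    x * eval (shift m (1# ∷ [])) x ≡⟨ cong (x *_) (eval-shift m (1# ∷ []) x) ⟩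
    x * (x ^ m * (1# + x * 0#))    ≡⟨ solve 2 (λ x y → x :* (y :* (con true :+ x :* con false)) := x :* y) refl x (x ^ m) ⟩
    x * x ^ m                      ∎)

  -- Such a p is a multiple of X^(1+m) - δ.
  middle-coeffs-vanish : ∀ m p δ (θ : Fin (suc m) → K) → Injective _≡_ _≡_ θ →
    length p ℕ.≤ suc (suc m) → (∀ i → θ i ^ suc m ≡ δ) → (∀ i → eval p (θ i) ≡ 0#) →
    ∀ j → j ℕ.< m → coeff p (suc j) ≡ 0#
  middle-coeffs-vanish m p δ θ θ-inj len θ^ root j j<m = begin
    coeff p (suc j)                        ≡⟨ solve 2 (λ a k → a := a :+ k :* con false) refl _ k ⟩
    coeff p (suc j) + k * 0#               ≡⟨ cong (λ z → coeff p (suc j) + k * z) (coeff-shift-< m (1# ∷ []) j<m) ⟨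
    coeff p (suc j) + k * coeff mono (suc j) ≡⟨ coeff-r (suc j) ⟨
    coeff r (suc j)                        ≡⟨ many-roots⇒zero (suc m) r θ θ-inj deg root-r (suc j) ⟩
    0#                                     ∎
    where
    -- Adding k times X^(1+m) - δ cancels the coefficient of X^(1+m). The remainder has degree at
    -- most m and 1 + m roots, so it vanishes.
    k = coeff p (suc m)
    mono = monomialMinusConstant δ m
    r = p ⊞ scale k mono
    coeff-r : ∀ j → coeff r j ≡ coeff p j + k * coeff mono j
    coeff-r j = trans (coeff-⊞ p (scale k mono) j) (cong (coeff p j +_) (coeff-scale k mono j))
    length-mono : length mono ≡ suc (suc m)
    length-mono = cong suc (trans (length-shift m (1# ∷ [])) (ℕ.+-comm m 1))
    deg : ∀ j → suc m ℕ.≤ j → coeff r j ≡ 0#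
    deg j m<j with ℕ.m≤n⇒m<n∨m≡n m<j
    ... | inj₁ m+1<j = trans (coeff-r j) (trans
      (cong₂ (λ u v → u + k * v) (coeff-length p j (ℕ.≤-trans len m+1<j))
        (coeff-length mono j (ℕ.≤-trans (ℕ.≤-reflexive length-mono) m+1<j)))
      (solve 1 (λ k → con false :+ k :* con false := con false) refl k))
    ... | inj₂ refl = trans (coeff-r j) (trans
      (cong (λ v → k + k * v) (trans (cong (coeff (shift m (1# ∷ []))) (sym (ℕ.+-identityʳ m))) (coeff-shift m (1# ∷ []) 0)))
      (solve 1 (λ k → k :+ k :* con true := con false) refl k))
    root-r : ∀ i → eval r (θ i) ≡ 0#
    root-r i = begin
      eval r (θ i)                           ≡⟨ eval-⊞ p (scale k mono) (θ i) ⟩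
      eval p (θ i) + eval (scale k mono) (θ i) ≡⟨ cong₂ _+_ (root i) (eval-scale k mono (θ i)) ⟩
      0# + k * eval mono (θ i)               ≡⟨ cong (λ z → 0# + k * z) (eval-monomialMinusConstant δ m (θ i)) ⟩
      0# + k * (δ + θ i ^ suc m)             ≡⟨ cong (λ z → 0# + k * (δ + z)) (θ^ i) ⟩
      0# + k * (δ + δ)                       ≡⟨ solve 2 (λ k δ → con false :+ k :* (δ :+ δ) := con false) refl k δ ⟩
      0#                                     ∎

  -- Compare the coefficients of X and of X^(q+1): for t ≥ 3 both exponents lie strictly
  -- between 0 and M.
  norm-proportional⇒monomial : ∀ k a b c d e₁ e₂ δ →
    let M = geometricSum q (3 ℕ.+ k) in
    (θ : Fin M → K) → Injective _≡_ _≡_ θ → (∀ i → θ i ^ M ≡ δ) →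
    (∀ i → e₁ * (d + c * θ i) ^ M ≡ e₂ * (b + a * θ i) ^ M) →
    e₁ ≢ 0# → e₂ ≢ 0# → a * d + b * c ≢ 0# →
    (a ≡ 0# × d ≡ 0#) ⊎ (b ≡ 0# × c ≡ 0#)
  norm-proportional⇒monomial k a b c d e₁ e₂ δ θ θ-inj θ^ prop e₁≢0 e₂≢0 det≢0 = cases (d ≟ 0#) (b ≟ 0#)
    where
    t = 3 ℕ.+ k
    -- Written so that M reduces to `suc M-1`, the form that `middle-coeffs-vanish` expects.
    M-1 = sum (applyUpTo (λ i → q ℕ.^ suc i) (2 ℕ.+ k))
    q<M-1 : q ℕ.< M-1
    q<M-1 = ≤R.begin
      suc q                               ≤R.≡⟨ ℕ.+-comm 1 q ⟩
      q ℕ.+ 1                             ≤R.≤⟨ ℕ.+-monoʳ-≤ q (2^≥1 h) ⟩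
      q ℕ.+ q                             ≤R.≤⟨ ℕ.+-monoʳ-≤ q (ℕ.m≤m*n q _ {{ℕ.>-nonZero (s≤s z≤n)}}) ⟩
      q ℕ.+ q ℕ.* suc (q ℕ.* geometricSum q k) ≤R.≡⟨ cong (λ z → q ℕ.+ q ℕ.* z) (geometricSum-suc q k) ⟨
      q ℕ.+ q ℕ.* geometricSum q (suc k)  ≤R.≡⟨ ℕ.*-suc q _ ⟨
      q ℕ.* suc (geometricSum q (suc k))  ≤R.≤⟨ ℕ.*-monoʳ-≤ q (s≤s (ℕ.m≤n*m _ q {{ℕ.>-nonZero (2^≥1 h)}})) ⟩
      q ℕ.* suc (q ℕ.* geometricSum q (suc k)) ≤R.≡⟨ cong (q ℕ.*_) (geometricSum-suc q (suc k)) ⟨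
      q ℕ.* geometricSum q (2 ℕ.+ k)      ≤R.≡⟨ sum-applyUpTo-* q (q ℕ.^_) (2 ℕ.+ k) ⟨
      M-1                                 ≤R.∎

    p₁ p₂ p : List K
    p₁ = normPolynomial c d t
    p₂ = normPolynomial a b t
    p = scale e₁ p₁ ⊞ scale e₂ p₂

    length-⊞ : ∀ u v {m} → length u ℕ.≤ m → length v ℕ.≤ m → length (u ⊞ v) ℕ.≤ m
    length-⊞ []      v       _        lv       = lv
    length-⊞ (x ∷ u) []      lu       _        = lu
    length-⊞ (x ∷ u) (y ∷ v) (s≤s lu) (s≤s lv) = s≤s (length-⊞ u v lu lv)

    length-scaled : ∀ e c d → length (scale e (normPolynomial c d t)) ℕ.≤ suc (suc M-1)
    length-scaled e c d = ℕ.≤-trans (ℕ.≤-reflexive (List.length-map (e *_) (normPolynomial c d t)))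
                                    (length-normPolynomial c d t)

    root : ∀ i → eval p (θ i) ≡ 0#
    root i = begin
      eval p (θ i)                                               ≡⟨ eval-⊞ (scale e₁ p₁) (scale e₂ p₂) (θ i) ⟩
      eval (scale e₁ p₁) (θ i) + eval (scale e₂ p₂) (θ i)        ≡⟨ cong₂ _+_ (eval-scaled e₁ c d) (eval-scaled e₂ a b) ⟩
      e₁ * (d + c * θ i) ^ suc M-1 + e₂ * (b + a * θ i) ^ suc M-1 ≡⟨ ≡⇒+-≡0 (prop i) ⟩
      0#                                                         ∎
      where
      eval-scaled : ∀ e c d → eval (scale e (normPolynomial c d t)) (θ i) ≡ e * (d + c * θ i) ^ suc M-1
      eval-scaled e c d = trans (eval-scale e (normPolynomial c d t) (θ i)) (cong (e *_) (eval-normPolynomial c d t (θ i)))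

    equal-coeffs : ∀ j → j ℕ.< M-1 → e₁ * coeff p₁ (suc j) ≡ e₂ * coeff p₂ (suc j)
    equal-coeffs j j<M-1 = +-≡0⇒≡ (begin
      e₁ * coeff p₁ (suc j) + e₂ * coeff p₂ (suc j)                     ≡⟨ cong₂ _+_ (coeff-scale e₁ p₁ (suc j)) (coeff-scale e₂ p₂ (suc j)) ⟨
      coeff (scale e₁ p₁) (suc j) + coeff (scale e₂ p₂) (suc j)         ≡⟨ coeff-⊞ (scale e₁ p₁) (scale e₂ p₂) (suc j) ⟨
      coeff p (suc j)                                                   ≡⟨ middle-coeffs-vanish M-1 p δ θ θ-inj
        (length-⊞ (scale e₁ p₁) (scale e₂ p₂) (length-scaled e₁ c d) (length-scaled e₂ a b)) θ^ root j j<M-1 ⟩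
      0#                                                                ∎)

    -- `Z c d` is d to the power q + ... + q^(k+1). This exponent is positive because t ≥ 3, so
    -- `Z c d` vanishes exactly when d does.
    Z : K → K → K
    Z c d = constantTerm c d (suc k) ^ q

    coeff₁ : ∀ c d → coeff (normPolynomial c d t) 1 ≡ c * (d * Z c d) ^ q
    coeff₁ c d = trans (coeff₁-expand c d (normPolynomial c d (2 ℕ.+ k)))
      (cong (λ z → c * z ^ q) (coeff₀-expand c d (normPolynomial c d (suc k))))

    coeff-suc-q : ∀ c d → coeff (normPolynomial c d t) (suc q) ≡ c * (c * Z c d) ^ q
    coeff-suc-q c d = trans (coeff-suc-q-expand c d (normPolynomial c d (2 ℕ.+ k)))
      (cong (λ z → c * z ^ q) (coeff₁-expand c d (normPolynomial c d (suc k))))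

    eq₁ : e₁ * (c * (d * Z c d) ^ q) ≡ e₂ * (a * (b * Z a b) ^ q)
    eq₁ = trans (cong (e₁ *_) (sym (coeff₁ c d))) (trans (equal-coeffs 0 (ℕ.≤-trans (s≤s z≤n) q<M-1)) (cong (e₂ *_) (coeff₁ a b)))

    eq₂ : e₁ * (c * (c * Z c d) ^ q) ≡ e₂ * (a * (a * Z a b) ^ q)
    eq₂ = trans (cong (e₁ *_) (sym (coeff-suc-q c d))) (trans (equal-coeffs q q<M-1) (cong (e₂ *_) (coeff-suc-q a b)))

    Z-zero : ∀ c {d} → d ≡ 0# → Z c d ≡ 0#
    Z-zero c d≡0 = trans (cong (_^ q) (constantTerm-zero c _ k d≡0)) 0^q

    Z-nonzero : ∀ c {d} → d ≢ 0# → Z c d ≢ 0#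
    Z-nonzero c d≢0 = ^-nonzero q (constantTerm-nonzero c _ (suc k) d≢0)

    leading-zero : ∀ e {x z} → e ≢ 0# → z ≢ 0# → e * (x * (x * z) ^ q) ≡ 0# → x ≡ 0#
    leading-zero e {x} e≢0 z≢0 eq with x ≟ 0#
    ... | yes x≡0 = x≡0
    ... | no x≢0 = contradiction eq (*-nonzero e≢0 (*-nonzero x≢0 (^-nonzero q (*-nonzero x≢0 z≢0))))

    leading-at-zero : ∀ e x {z} → z ≡ 0# → e * (x * (x * z) ^ q) ≡ 0#
    leading-at-zero e x refl = begin
      e * (x * (x * 0#) ^ q) ≡⟨ cong (λ z → e * (x * z ^ q)) (zeroʳ x) ⟩
      e * (x * 0# ^ q)       ≡⟨ cong (λ z → e * (x * z)) 0^q ⟩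
      e * (x * 0#)           ≡⟨ cong (e *_) (zeroʳ x) ⟩
      e * 0#                 ≡⟨ zeroʳ e ⟩
      0#                     ∎

    zero-at-zero : ∀ e x {z} → x ≡ 0# → e * (x * z) ≡ 0#
    zero-at-zero e x {z} refl = trans (cong (e *_) (zeroˡ z)) (zeroʳ e)

    det-zero : ∀ {a b c d} → a * d ≡ 0# → b * c ≡ 0# → a * d + b * c ≡ 0#
    det-zero eq eq′ = trans (cong₂ _+_ eq eq′) (+-identityˡ 0#)

    cases : Dec (d ≡ 0#) → Dec (b ≡ 0#) → (a ≡ 0# × d ≡ 0#) ⊎ (b ≡ 0# × c ≡ 0#)
    -- The determinant forces b ≠ 0, and then the coefficient of X^(q+1) forces a = 0.
    cases (yes d≡0) _ = inj₁
      ( leading-zero e₂ e₂≢0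
          (Z-nonzero a λ b≡0 → det≢0 (det-zero (trans (cong (a *_) d≡0) (zeroʳ a)) (trans (cong (_* c) b≡0) (zeroˡ c))))
          (trans (sym eq₂) (leading-at-zero e₁ c (Z-zero c d≡0)))
      , d≡0)
    cases (no d≢0) (yes b≡0) = inj₂
      ( b≡0
      , leading-zero e₁ e₁≢0 (Z-nonzero c d≢0) (trans eq₂ (leading-at-zero e₂ a (Z-zero a b≡0))))
    -- Here a and c are nonzero as well, and dividing one coefficient equation by the other gives a
    -- d = b c, contrary to the determinant.
    cases (no d≢0) (no b≢0) = contradiction (≡⇒+-≡0 ad≡bc) det≢0
      where
      A = Z c d
      B = Z a b
      A≢0 : A ≢ 0#
      A≢0 = Z-nonzero c d≢0
      B≢0 : B ≢ 0#
      B≢0 = Z-nonzero a b≢0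
      c≡0⇒a≡0 : c ≡ 0# → a ≡ 0#
      c≡0⇒a≡0 c≡0 = leading-zero e₂ e₂≢0 B≢0 (trans (sym eq₂) (zero-at-zero e₁ c c≡0))
      a≡0⇒c≡0 : a ≡ 0# → c ≡ 0#
      a≡0⇒c≡0 a≡0 = leading-zero e₁ e₁≢0 A≢0 (trans eq₂ (zero-at-zero e₂ a a≡0))
      det-degenerate : a ≡ 0# → c ≡ 0# → a * d + b * c ≡ 0#
      det-degenerate a≡0 c≡0 = det-zero (trans (cong (_* d) a≡0) (zeroˡ d)) (trans (cong (b *_) c≡0) (zeroʳ b))
      c≢0 : c ≢ 0#
      c≢0 c≡0 = det≢0 (det-degenerate (c≡0⇒a≡0 c≡0) c≡0)
      a≢0 : a ≢ 0#
      a≢0 a≡0 = det≢0 (det-degenerate a≡0 (a≡0⇒c≡0 a≡0))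
      cross : ∀ u v u′ v′ → e₁ * (c * u) ≡ e₂ * (a * v) → e₁ * (c * u′) ≡ e₂ * (a * v′) → u * v′ ≡ v * u′
      cross u v u′ v′ eq eq′ = *-cancelˡ (*-nonzero (*-nonzero e₁≢0 c≢0) (*-nonzero e₂≢0 a≢0)) (begin
        (e₁ * c) * (e₂ * a) * (u * v′)     ≡⟨ solve 6 (λ e₁ c e₂ a u v → (e₁ :* c) :* (e₂ :* a) :* (u :* v)
                                                := (e₁ :* (c :* u)) :* (e₂ :* (a :* v))) refl e₁ c e₂ a u v′ ⟩
        (e₁ * (c * u)) * (e₂ * (a * v′))   ≡⟨ cong₂ _*_ eq (sym eq′) ⟩
        (e₂ * (a * v)) * (e₁ * (c * u′))   ≡⟨ solve 6 (λ e₁ c e₂ a v u → (e₂ :* (a :* v)) :* (e₁ :* (c :* u))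
                                                := (e₁ :* c) :* (e₂ :* a) :* (v :* u)) refl e₁ c e₂ a v u′ ⟩
        (e₁ * c) * (e₂ * a) * (v * u′)     ∎)
      ad≡bc : a * d ≡ b * c
      ad≡bc = *-cancelˡ (*-nonzero A≢0 B≢0) (begin
        A * B * (a * d)     ≡⟨ solve 4 (λ A B a d → A :* B :* (a :* d) := (d :* A) :* (a :* B)) refl A B a d ⟩
        (d * A) * (a * B)   ≡⟨ frobenius-injective h (begin
          ((d * A) * (a * B)) ^ q       ≡⟨ ^-distrib-* _ _ q ⟩
          (d * A) ^ q * (a * B) ^ q     ≡⟨ cross _ _ _ _ eq₁ eq₂ ⟩
          (b * B) ^ q * (c * A) ^ q     ≡⟨ ^-distrib-* _ _ q ⟨
          ((b * B) * (c * A)) ^ q       ∎) ⟩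
        (b * B) * (c * A)   ≡⟨ solve 4 (λ A B b c → (b :* B) :* (c :* A) := A :* B :* (b :* c)) refl A B b c ⟩
        A * B * (b * c)     ∎)

2∣2^h^t : ∀ h t → 1 ℕ.≤ h → 1 ℕ.≤ t → 2 ∣ (2 ℕ.^ h) ℕ.^ t
2∣2^h^t (suc h) (suc t) _ _ = ∣m⇒∣m*n _ (m∣m*n (2 ℕ.^ h))

-- Linear algebra of PG(1, q^t) and the transversal points of an André set.

module Plane (h k : ℕ) (1≤h : 1 ℕ.≤ h) (F : FiniteField ((2 ℕ.^ h) ℕ.^ (3 ℕ.+ k))) where
  t : ℕ
  t = 3 ℕ.+ k

  2∣order : 2 ∣ (2 ℕ.^ h) ℕ.^ t
  2∣order = 2∣2^h^t h t 1≤h (s≤s z≤n)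

  open Characteristic2 F 2∣order public
  open NormPolynomials F 2∣order h 1≤h public
  open Geometry (2 ℕ.^ h) t F public
  open ≡-Reasoning

  e₀ e₁ : Matrix → Vec K 2
  e₀ (mat a b c d) = a ∷ c ∷ []
  e₁ (mat a b c d) = b ∷ d ∷ []

  infix 8 _∧_
  -- The determinant of two vectors, without sign in characteristic 2. Dependence of vectors and
  -- coordinates along a basis are both expressed through it.
  _∧_ : Vec K 2 → Vec K 2 → K
  (a ∷ b ∷ []) ∧ (c ∷ d ∷ []) = a * d + b * c

  ∧-comm : ∀ v w → v ∧ w ≡ w ∧ v
  ∧-comm (a ∷ b ∷ []) (c ∷ d ∷ []) =
    solve 4 (λ a b c d → a :* d :+ b :* c := c :* b :+ d :* a) refl a b c d

  •-∧ : ∀ x v w → (x • v) ∧ w ≡ x * v ∧ w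
  •-∧ x (a ∷ b ∷ []) (c ∷ d ∷ []) =
    solve 5 (λ x a b c d → x :* a :* d :+ x :* b :* c := x :* (a :* d :+ b :* c)) refl x a b c d

  0∧ : ∀ w → 0ᵥ ∧ w ≡ 0#
  0∧ (c ∷ d ∷ []) = solve 2 (λ c d → con false :* d :+ con false :* c := con false) refl c d

  ∧-self : ∀ v → v ∧ v ≡ 0#
  ∧-self (a ∷ b ∷ []) = solve 2 (λ a b → a :* b :+ b :* a := con false) refl a b

  ∷₂-injective : ∀ {a b c d : K} → _≡_ {A = Vec K 2} (a ∷ b ∷ []) (c ∷ d ∷ []) → a ≡ c × b ≡ d
  ∷₂-injective refl = refl , refl

  ∧≡0⇒∝ : ∀ {v w : Vec K 2} → v ≢ 0ᵥ → w ≢ 0ᵥ → v ∧ w ≡ 0# → v ∝ w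
  ∧≡0⇒∝ {a ∷ b ∷ []} {c ∷ d ∷ []} v≢0 w≢0 eq with a ≟ 0# | b ≟ 0#
  ... | no a≢0 | _ = multiple (c * a ⁻¹) (cong₂ _∷_
        (sym (quotient c a≢0))
        (cong (_∷ []) (*-cancelˡ a≢0 (begin
          a * d              ≡⟨ +-≡0⇒≡ eq ⟩
          b * c              ≡⟨ cong (b *_) (quotient c a≢0) ⟨
          b * (c * a ⁻¹ * a) ≡⟨ solve 4 (λ a b c i → b :* (c :* i :* a) := a :* (c :* i :* b)) refl a b c (a ⁻¹) ⟩
          a * (c * a ⁻¹ * b) ∎))))
    where
    multiple : ∀ m → (c ∷ d ∷ []) ≡ m • (a ∷ b ∷ []) → (a ∷ b ∷ []) ∝ (c ∷ d ∷ [])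
    multiple m w≡mv = m , (λ { refl → w≢0 (trans w≡mv (cong₂ (λ x y → x ∷ y ∷ []) (zeroˡ a) (zeroˡ b))) }) , w≡mv
  ... | yes refl | yes refl = contradiction refl v≢0
  ... | yes refl | no b≢0 = m , (λ m≡0 → w≢0 (cong₂ (λ x y → x ∷ y ∷ []) c≡0 (trans d≡mb (trans (cong (_* b) m≡0) (zeroˡ b))))) ,
        cong₂ (λ x y → x ∷ y ∷ []) (trans c≡0 (sym (zeroʳ m))) d≡mb
    where
    m = d * b ⁻¹
    c≡0 : c ≡ 0#
    c≡0 = *-zero⁻¹ b≢0 (begin
      b * c           ≡⟨ solve 3 (λ b c d → b :* c := con false :* d :+ b :* c) refl b c d ⟩
      0# * d + b * c  ≡⟨ eq ⟩
      0#              ∎)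
    d≡mb : d ≡ m * b
    d≡mb = sym (quotient d b≢0)

  ∝⇒∧≡0 : ∀ {v w : Vec K 2} → v ∝ w → v ∧ w ≡ 0#
  ∝⇒∧≡0 {v} (m , _ , refl) = begin
    v ∧ (m • v) ≡⟨ ∧-comm v (m • v) ⟩
    (m • v) ∧ v ≡⟨ •-∧ m v v ⟩
    m * v ∧ v   ≡⟨ cong (m *_) (∧-self v) ⟩
    m * 0#      ≡⟨ zeroʳ m ⟩
    0#          ∎

  det≡∧ : ∀ g → det g ≡ e₀ g ∧ e₁ g
  det≡∧ (mat a b c d) = solve 4 (λ a b c d → a :* d :+ :- (b :* c) := a :* d :+ c :* b) refl a b c d

  ∧-plücker : ∀ u v w x → (v ∧ w) * (u ∧ x) + (u ∧ w) * (v ∧ x) ≡ (w ∧ x) * (u ∧ v)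
  ∧-plücker (u₀ ∷ u₁ ∷ []) (v₀ ∷ v₁ ∷ []) (w₀ ∷ w₁ ∷ []) (x₀ ∷ x₁ ∷ []) =
    solve 8 (λ u₀ u₁ v₀ v₁ w₀ w₁ x₀ x₁ →
      (v₀ :* w₁ :+ v₁ :* w₀) :* (u₀ :* x₁ :+ u₁ :* x₀) :+ (u₀ :* w₁ :+ u₁ :* w₀) :* (v₀ :* x₁ :+ v₁ :* x₀)
      := (w₀ :* x₁ :+ w₁ :* x₀) :* (u₀ :* v₁ :+ u₁ :* v₀)) refl u₀ u₁ v₀ v₁ w₀ w₁ x₀ x₁

  act-∙ : ∀ g g′ v → act (g ∙ g′) v ≡ act g (act g′ v)
  act-∙ (mat a b c d) (mat a′ b′ c′ d′) (x ∷ y ∷ []) = cong₂ (λ u v → u ∷ v ∷ []) (row a b) (row c d)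
    where
    row : ∀ a b → (a * a′ + b * c′) * x + (a * b′ + b * d′) * y ≡ a * (a′ * x + b′ * y) + b * (c′ * x + d′ * y)
    row a b = solve 8 (λ a b a′ b′ c′ d′ x y →
      (a :* a′ :+ b :* c′) :* x :+ (a :* b′ :+ b :* d′) :* y := a :* (a′ :* x :+ b′ :* y) :+ b :* (c′ :* x :+ d′ :* y))
      refl a b a′ b′ c′ d′ x y

  act-• : ∀ g m v → act g (m • v) ≡ m • act g v
  act-• (mat a b c d) m (x ∷ y ∷ []) = cong₂ (λ u v → u ∷ v ∷ []) (row a b) (row c d)
    where
    row : ∀ a b → a * (m * x) + b * (m * y) ≡ m * (a * x + b * y)
    row a b = solve 5 (λ a b m x y → a :* (m :* x) :+ b :* (m :* y) := m :* (a :* x :+ b :* y)) refl a b m x y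

  •-assoc : ∀ l m (v : Vec K 2) → l • m • v ≡ (l * m) • v
  •-assoc l m (x ∷ y ∷ []) = sym (cong₂ (λ u v → u ∷ v ∷ []) (*-assoc l m x) (*-assoc l m y))

  •-identity : ∀ (v : Vec K 2) → 1# • v ≡ v
  •-identity (x ∷ y ∷ []) = cong₂ (λ u v → u ∷ v ∷ []) (*-identityˡ x) (*-identityˡ y)

  scaleₘ : K → Matrix → Matrix
  scaleₘ m (mat a b c d) = mat (m * a) (m * b) (m * c) (m * d)

  act-scaleₘ : ∀ m g v → act (scaleₘ m g) v ≡ m • act g v
  act-scaleₘ m (mat a b c d) (x ∷ y ∷ []) = cong₂ (λ u v → u ∷ v ∷ []) (row a b) (row c d)
    where
    row : ∀ a b → m * a * x + m * b * y ≡ m * (a * x + b * y)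
    row a b = solve 5 (λ a b m x y → m :* a :* x :+ m :* b :* y := m :* (a :* x :+ b :* y)) refl a b m x y

  ∼ₘ-refl : ∀ g → g ∼ₘ g
  ∼ₘ-refl (mat a b c d) = 1# , 1≢0 ,
    sym (trans (cong₂ (λ x y → mat x y _ _) (*-identityˡ a) (*-identityˡ b))
               (cong₂ (mat a b) (*-identityˡ c) (*-identityˡ d)))

  -- Cramer's rule: the two images determine each entry up to the factor `v ∧ w`.
  act-injective : ∀ {v w} → v ∧ w ≢ 0# → ∀ g g′ → act g v ≡ act g′ v → act g w ≡ act g′ w → g ≡ g′
  act-injective {v₀ ∷ v₁ ∷ []} {w₀ ∷ w₁ ∷ []} vw≢0 (mat a b c d) (mat a′ b′ c′ d′) eqv eqw =
    trans (cong₂ (λ x y → mat x y c d) (entry₀ a b a′ b′ top top′) (entry₁ a b a′ b′ top top′))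
          (cong₂ (mat a′ b′) (entry₀ c d c′ d′ bot bot′) (entry₁ c d c′ d′ bot bot′))
    where
    top = proj₁ (∷₂-injective eqv)
    bot = proj₂ (∷₂-injective eqv)
    top′ = proj₁ (∷₂-injective eqw)
    bot′ = proj₂ (∷₂-injective eqw)
    Δ = v₀ * w₁ + v₁ * w₀
    entry₀ : ∀ a b a′ b′ → a * v₀ + b * v₁ ≡ a′ * v₀ + b′ * v₁ → a * w₀ + b * w₁ ≡ a′ * w₀ + b′ * w₁ → a ≡ a′
    entry₀ a b a′ b′ eq eq′ = *-cancelˡ vw≢0 (trans (expand₀ a b) (trans
      (cong₂ (λ x y → w₁ * x + v₁ * y) eq eq′) (sym (expand₀ a′ b′))))
      where
      expand₀ : ∀ a b → Δ * a ≡ w₁ * (a * v₀ + b * v₁) + v₁ * (a * w₀ + b * w₁)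
      expand₀ a b = solve 6 (λ a b v₀ v₁ w₀ w₁ → (v₀ :* w₁ :+ v₁ :* w₀) :* a :=
        w₁ :* (a :* v₀ :+ b :* v₁) :+ v₁ :* (a :* w₀ :+ b :* w₁)) refl a b v₀ v₁ w₀ w₁
    entry₁ : ∀ a b a′ b′ → a * v₀ + b * v₁ ≡ a′ * v₀ + b′ * v₁ → a * w₀ + b * w₁ ≡ a′ * w₀ + b′ * w₁ → b ≡ b′
    entry₁ a b a′ b′ eq eq′ = *-cancelˡ vw≢0 (trans (expand₁ a b) (trans
      (cong₂ (λ x y → w₀ * x + v₀ * y) eq eq′) (sym (expand₁ a′ b′))))
      where
      expand₁ : ∀ a b → Δ * b ≡ w₀ * (a * v₀ + b * v₁) + v₀ * (a * w₀ + b * w₁)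
      expand₁ a b = solve 6 (λ a b v₀ v₁ w₀ w₁ → (v₀ :* w₁ :+ v₁ :* w₀) :* b :=
        w₀ :* (a :* v₀ :+ b :* v₁) :+ v₀ :* (a :* w₀ :+ b :* w₁)) refl a b v₀ v₁ w₀ w₁

  module Diagonal (v w : Vec K 2) (vw≢0 : v ∧ w ≢ 0#) where

    -- A projectivity fixing the points v and w is diagonal in this basis; modulo scalars only the
    -- ratio of its eigenvalues remains.
    record Eigenvalues (g : Matrix) : Set where
      constructor eigenvalues
      field
        {λ₀ λ₁} : K
        λ₀≢0  : λ₀ ≢ 0#
        λ₁≢0  : λ₁ ≢ 0#
        act-v : act g v ≡ λ₀ • v
        act-w : act g w ≡ λ₁ • w

      ratio : K
      ratio = λ₀ * λ₁ ⁻¹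

      ratio-nonzero : ratio ≢ 0#
      ratio-nonzero = *-nonzero λ₀≢0 (⁻¹-nonzero λ₁≢0)

      ratio-* : ratio * λ₁ ≡ λ₀
      ratio-* = quotient λ₀ λ₁≢0

    open Eigenvalues

    private
      ∝-eigen : ∀ {u u′ : Vec K 2} → u ∝ u′ → ∃ λ m → m ≢ 0# × u ≡ m • u′
      ∝-eigen {u} (m , m≢0 , refl) = m ⁻¹ , ⁻¹-nonzero m≢0 , (begin
        u                ≡⟨ •-identity u ⟨
        1# • u           ≡⟨ cong (_• u) (trans (sym (⁻¹-inverse m≢0)) (*-comm m (m ⁻¹))) ⟩
        (m ⁻¹ * m) • u   ≡⟨ •-assoc (m ⁻¹) m u ⟨
        m ⁻¹ • m • u     ∎)

    eigen : ∀ {g} → act g v ∝ v → act g w ∝ w → Eigenvalues g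
    eigen fix-v fix-w with ∝-eigen fix-v | ∝-eigen fix-w
    ... | l , l≢0 , eqv | m , m≢0 , eqw = eigenvalues l≢0 m≢0 eqv eqw

    ratio≡⇒cross : ∀ {g g′} (E : Eigenvalues g) (E′ : Eigenvalues g′) → ratio E ≡ ratio E′ → λ₀ E * λ₁ E′ ≡ λ₀ E′ * λ₁ E
    ratio≡⇒cross E E′ eq = begin
      λ₀ E * λ₁ E′            ≡⟨ cong (_* λ₁ E′) (ratio-* E) ⟨
      ratio E * λ₁ E * λ₁ E′  ≡⟨ cong (λ r → r * λ₁ E * λ₁ E′) eq ⟩
      ratio E′ * λ₁ E * λ₁ E′ ≡⟨ solve 3 (λ r x y → r :* x :* y := r :* y :* x) refl (ratio E′) (λ₁ E) (λ₁ E′) ⟩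
      ratio E′ * λ₁ E′ * λ₁ E ≡⟨ cong (_* λ₁ E) (ratio-* E′) ⟩
      λ₀ E′ * λ₁ E            ∎

    -- The hypothesis is equality of eigenvalue ratios with denominators cleared. The scalar between
    -- g and g′ is read off at v, and the hypothesis makes it correct at w.
    cross⇒∼ₘ : ∀ {g g′} (E : Eigenvalues g) (E′ : Eigenvalues g′) → λ₀ E * λ₁ E′ ≡ λ₀ E′ * λ₁ E → g ∼ₘ g′
    cross⇒∼ₘ {g} {g′} E E′ eq = m , *-nonzero (λ₀≢0 E′) (⁻¹-nonzero (λ₀≢0 E)) ,
      act-injective vw≢0 g′ (scaleₘ m g)
        (agree v (act-v E′) (act-v E) (λ₀-eq))
        (agree w (act-w E′) (act-w E) (*-cancelˡ (λ₀≢0 E) (begin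
          λ₀ E * λ₁ E′         ≡⟨ eq ⟩
          λ₀ E′ * λ₁ E         ≡⟨ cong (_* λ₁ E) λ₀-eq ⟩
          m * λ₀ E * λ₁ E      ≡⟨ solve 3 (λ m x y → m :* x :* y := x :* (m :* y)) refl m (λ₀ E) (λ₁ E) ⟩
          λ₀ E * (m * λ₁ E)    ∎)))
      where
      m = λ₀ E′ * λ₀ E ⁻¹
      λ₀-eq : λ₀ E′ ≡ m * λ₀ E
      λ₀-eq = sym (quotient (λ₀ E′) (λ₀≢0 E))
      agree : ∀ u {l l′} → act g′ u ≡ l′ • u → act g u ≡ l • u → l′ ≡ m * l → act g′ u ≡ act (scaleₘ m g) u
      agree u {l} {l′} eq′ eq″ l′≡ml = begin
        act g′ u             ≡⟨ eq′ ⟩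
        l′ • u               ≡⟨ cong (_• u) l′≡ml ⟩
        (m * l) • u          ≡⟨ •-assoc m l u ⟨
        m • l • u            ≡⟨ cong (m •_) eq″ ⟨
        m • act g u          ≡⟨ act-scaleₘ m g u ⟨
        act (scaleₘ m g) u   ∎

    eigen-∙ : ∀ {g g′} → Eigenvalues g → Eigenvalues g′ → Eigenvalues (g ∙ g′)
    eigen-∙ {g} {g′} E E′ = eigenvalues
      (*-nonzero (λ₀≢0 E) (λ₀≢0 E′)) (*-nonzero (λ₁≢0 E) (λ₁≢0 E′))
      (compose v (act-v E) (act-v E′)) (compose w (act-w E) (act-w E′))
      where
      compose : ∀ u {l l′} → act g u ≡ l • u → act g′ u ≡ l′ • u → act (g ∙ g′) u ≡ (l * l′) • u
      compose u {l} {l′} eq eq′ = begin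
        act (g ∙ g′) u     ≡⟨ act-∙ g g′ u ⟩
        act g (act g′ u)   ≡⟨ cong (act g) eq′ ⟩
        act g (l′ • u)     ≡⟨ act-• g l′ u ⟩
        l′ • act g u       ≡⟨ cong (l′ •_) eq ⟩
        l′ • l • u         ≡⟨ •-assoc l′ l u ⟩
        (l′ * l) • u       ≡⟨ cong (_• u) (*-comm l′ l) ⟩
        (l * l′) • u       ∎

    ∼ₘ⇒cross : ∀ {g g′} (E : Eigenvalues g) (E′ : Eigenvalues g′) → g ∼ₘ g′ → λ₀ E * λ₁ E′ ≡ λ₀ E′ * λ₁ E
    ∼ₘ⇒cross {g} E E′ (m , _ , refl) = begin
      λ₀ E * λ₁ E′        ≡⟨ cong (λ₀ E *_) (scaled w v (vw≢0 ∘ trans (∧-comm v w)) (act-w E) (act-w E′)) ⟩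
      λ₀ E * (m * λ₁ E)   ≡⟨ solve 3 (λ x m y → x :* (m :* y) := m :* x :* y) refl (λ₀ E) m (λ₁ E) ⟩
      m * λ₀ E * λ₁ E     ≡⟨ cong (_* λ₁ E) (scaled v w vw≢0 (act-v E) (act-v E′)) ⟨
      λ₀ E′ * λ₁ E        ∎
      where
      scaled : ∀ u u′ {l l′} → u ∧ u′ ≢ 0# → act g u ≡ l • u → act (scaleₘ m g) u ≡ l′ • u → l′ ≡ m * l
      scaled u u′ {l} {l′} uu′≢0 eq eq′ = *-cancelˡ uu′≢0 (begin
        u ∧ u′ * l′         ≡⟨ *-comm _ l′ ⟩
        l′ * u ∧ u′         ≡⟨ •-∧ l′ u u′ ⟨
        (l′ • u) ∧ u′       ≡⟨ cong (_∧ u′) (trans (sym eq′) (trans (act-scaleₘ m g u) (trans (cong (m •_) eq) (•-assoc m l u)))) ⟩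
        ((m * l) • u) ∧ u′  ≡⟨ •-∧ (m * l) u u′ ⟩
        m * l * u ∧ u′      ≡⟨ *-comm _ _ ⟩
        u ∧ u′ * (m * l)    ∎)

  -- Up to the factor `v ∧ w`, the value `u ∧ w` is the coordinate of u along v, which g multiplies
  -- by its eigenvalue.
  act-∧ : ∀ {g v w l m} → v ∧ w ≢ 0# → act g v ≡ l • v → act g w ≡ m • w → ∀ u → act g u ∧ w ≡ l * u ∧ w
  act-∧ {g@(mat a b c d)} {v@(v₀ ∷ v₁ ∷ [])} {w@(w₀ ∷ w₁ ∷ [])} {l} {m} vw≢0 eqv eqw u@(u₀ ∷ u₁ ∷ []) =
    *-cancelˡ vw≢0 (begin
      v ∧ w * act g u ∧ w
        ≡⟨ solve 10 (λ a b c d v₀ v₁ w₀ w₁ u₀ u₁ →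
             (v₀ :* w₁ :+ v₁ :* w₀) :* ((a :* u₀ :+ b :* u₁) :* w₁ :+ (c :* u₀ :+ d :* u₁) :* w₀)
             := (u₀ :* w₁ :+ u₁ :* w₀) :* ((a :* v₀ :+ b :* v₁) :* w₁ :+ (c :* v₀ :+ d :* v₁) :* w₀)
                :+ (u₀ :* v₁ :+ u₁ :* v₀) :* ((a :* w₀ :+ b :* w₁) :* w₁ :+ (c :* w₀ :+ d :* w₁) :* w₀))
             refl a b c d v₀ v₁ w₀ w₁ u₀ u₁ ⟩
      u ∧ w * act g v ∧ w + u ∧ v * act g w ∧ w
        ≡⟨ cong₂ (λ x y → u ∧ w * x ∧ w + u ∧ v * y ∧ w) eqv eqw ⟩
      u ∧ w * (l • v) ∧ w + u ∧ v * (m • w) ∧ w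
        ≡⟨ cong₂ (λ x y → u ∧ w * x + u ∧ v * y) (•-∧ l v w) (trans (•-∧ m w w) (trans (cong (m *_) (∧-self w)) (zeroʳ m))) ⟩
      u ∧ w * (l * v ∧ w) + u ∧ v * 0#
        ≡⟨ solve 4 (λ x l y z → x :* (l :* y) :+ z :* con false := y :* (l :* x)) refl (u ∧ w) l (v ∧ w) (u ∧ v) ⟩
      v ∧ w * (l * u ∧ w) ∎)

  -- For each of the M points of D, the determinants with N and with T are computed twice: from the
  -- eigenvalues, whose norms agree, and as κ times a linear form in θ. Taking norms and eliminating
  -- κ leaves the identity required by `norm-proportional⇒monomial`.
  andréSet-transversals : ∀ {T N D} → IsAndréSet T N D → (ix : Indexing D) →
    let open Indexing ix in
    (e₁ φ ∧ vec N ≡ 0# × e₀ φ ∧ vec T ≡ 0#) ⊎ (e₀ φ ∧ vec N ≡ 0# × e₁ φ ∧ vec T ≡ 0#)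
  andréSet-transversals {T , T≢0} {N , N≢0} (T≁N , H , H-group , H-fixes , (f , f-inj , f-enum) , (P , P≢0) , P≁T , P≁N , D-orbit) ix =
    norm-proportional⇒monomial k _ _ _ _ _ _ δ θ θ-inj θ-norm proportional
      (^-nonzero normExponent PN≢0) (^-nonzero normExponent PT≢0)
      -- By the Plücker relation the determinant of the two linear forms is (N ∧ T)(e₀ φ ∧ e₁ φ).
      (λ eq → *-nonzero NT≢0 (invertible ∘ trans (det≡∧ φ)) (trans (sym (∧-plücker (e₀ φ) (e₁ φ) N T)) eq))
    where
    open Indexing ix
    TN≢0 : T ∧ N ≢ 0#
    TN≢0 = T≁N ∘ ∧≡0⇒∝ T≢0 N≢0
    NT≢0 : N ∧ T ≢ 0#
    NT≢0 = TN≢0 ∘ trans (∧-comm T N)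
    PN≢0 : P ∧ N ≢ 0#
    PN≢0 = P≁N ∘ ∧≡0⇒∝ P≢0 N≢0
    PT≢0 : P ∧ T ≢ 0#
    PT≢0 = P≁T ∘ ∧≡0⇒∝ P≢0 T≢0
    open Diagonal T N TN≢0
    open Eigenvalues

    f∈H : ∀ i → H (f i)
    f∈H i = Equivalence.from (f-enum (f i)) (i , ∼ₘ-refl (f i))

    E : ∀ i → Eigenvalues (f i)
    E i = eigen (proj₁ (H-fixes (f∈H i))) (proj₂ (H-fixes (f∈H i)))

    ρ : Fin normExponent → K
    ρ i = ratio (E i)

    ρ-inj : Injective _≡_ _≡_ ρ
    ρ-inj {i} {j} eq = f-inj (cross⇒∼ₘ (E i) (E j) (ratio≡⇒cross (E i) (E j) eq))

    -- The enumeration contains a product in H only up to a scalar, so the ratios are compared after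
    -- clearing all λ₁.
    ρ-closed : ∀ i j → ∃ λ l → ρ i * ρ j ≡ ρ l
    ρ-closed i j with Equivalence.to (f-enum (f i ∙ f j)) (IsSubgroupPGL.product∈ H-group (f∈H i) (f∈H j))
    ... | l , fl∼ = l , *-cancelˡ (*-nonzero (λ₁≢0 (E l)) (*-nonzero (λ₁≢0 (E i)) (λ₁≢0 (E j)))) (begin
      λ₁ (E l) * (λ₁ (E i) * λ₁ (E j)) * (ρ i * ρ j)
        ≡⟨ solve 5 (λ x y z r s → x :* (y :* z) :* (r :* s) := x :* ((r :* y) :* (s :* z))) refl
             (λ₁ (E l)) (λ₁ (E i)) (λ₁ (E j)) (ρ i) (ρ j) ⟩
      λ₁ (E l) * ((ρ i * λ₁ (E i)) * (ρ j * λ₁ (E j)))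
        ≡⟨ cong (λ₁ (E l) *_) (cong₂ _*_ (ratio-* (E i)) (ratio-* (E j))) ⟩
      λ₁ (E l) * (λ₀ (E i) * λ₀ (E j))
        ≡⟨ trans (*-comm _ _) (sym (∼ₘ⇒cross (E l) (eigen-∙ (E i) (E j)) fl∼)) ⟩
      λ₀ (E l) * (λ₁ (E i) * λ₁ (E j))
        ≡⟨ cong (_* (λ₁ (E i) * λ₁ (E j))) (ratio-* (E l)) ⟨
      ρ l * λ₁ (E l) * (λ₁ (E i) * λ₁ (E j))
        ≡⟨ solve 3 (λ r x y → r :* x :* y := x :* y :* r) refl (ρ l) (λ₁ (E l)) (λ₁ (E i) * λ₁ (E j)) ⟩
      λ₁ (E l) * (λ₁ (E i) * λ₁ (E j)) * ρ l ∎)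

    norm-λ : ∀ i → norm (λ₀ (E i)) ≡ norm (λ₁ (E i))
    norm-λ i = begin
      norm (λ₀ (E i))              ≡⟨ cong norm (ratio-* (E i)) ⟨
      norm (ρ i * λ₁ (E i))        ≡⟨ ^-distrib-* (ρ i) _ normExponent ⟩
      norm (ρ i) * norm (λ₁ (E i)) ≡⟨ cong (_* norm (λ₁ (E i)))
        (lagrange ρ ρ-inj (λ j → ratio-nonzero (E j)) (ρ i) (ratio-nonzero (E i)) (ρ-closed i)) ⟩
      1# * norm (λ₁ (E i))         ≡⟨ *-identityˡ _ ⟩
      norm (λ₁ (E i))              ∎

    act-∧N : ∀ i → act (f i) P ∧ N ≡ λ₀ (E i) * P ∧ N
    act-∧N i = act-∧ TN≢0 (act-v (E i)) (act-w (E i)) P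

    act-∧T : ∀ i → act (f i) P ∧ T ≡ λ₁ (E i) * P ∧ T
    act-∧T i = act-∧ NT≢0 (act-w (E i)) (act-v (E i)) P

    R : Fin normExponent → PG 2
    R i = act (f i) P , λ eq → *-nonzero (λ₀≢0 (E i)) PN≢0 (trans (sym (act-∧N i)) (trans (cong (_∧ N) eq) (0∧ N)))

    coordinate : ∀ i → ∃ λ θ → norm θ ≡ δ × ∃ λ κ → κ ≢ 0# × act (f i) P ≡ κ • act φ (1# ∷ θ ∷ [])
    coordinate i with Equivalence.to (maps (R i)) (Equivalence.from (D-orbit (R i)) (f i , f∈H i , 1# , 1≢0 , sym (•-identity _)))
    ... | (_ , _) , (θ , _ , θ-norm , κ , κ≢0 , refl) , (κ′ , κ′≢0 , eq) =
      θ , θ-norm , κ′ * κ , *-nonzero κ′≢0 κ≢0 , trans eq (trans (cong (κ′ •_) (act-• φ κ _)) (•-assoc κ′ κ _))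

    θ κ : Fin normExponent → K
    θ = proj₁ ∘ coordinate
    κ i = proj₁ (proj₂ (proj₂ (coordinate i)))

    κ≢0 : ∀ i → κ i ≢ 0#
    κ≢0 i = proj₁ (proj₂ (proj₂ (proj₂ (coordinate i))))

    θ-norm : ∀ i → norm (θ i) ≡ δ
    θ-norm i = proj₁ (proj₂ (coordinate i))

    coordinate-∧ : ∀ i u → act (f i) P ∧ u ≡ κ i * (e₀ φ ∧ u + e₁ φ ∧ u * θ i)
    coordinate-∧ i u = trans (cong (_∧ u) (proj₂ (proj₂ (proj₂ (proj₂ (coordinate i)))))) (trans (•-∧ (κ i) (act φ (1# ∷ θ i ∷ [])) u) (cong (κ i *_) (linear φ u)))
      where
      linear : ∀ g u → act g (1# ∷ θ i ∷ []) ∧ u ≡ e₀ g ∧ u + e₁ g ∧ u * θ i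
      linear (mat a b c d) (x ∷ y ∷ []) = solve 7 (λ a b c d x y θ →
        (a :* con true :+ b :* θ) :* y :+ (c :* con true :+ d :* θ) :* x :=
        (a :* y :+ c :* x) :+ (b :* y :+ d :* x) :* θ) refl a b c d x y (θ i)

    coordinate-N : ∀ i → λ₀ (E i) * P ∧ N ≡ κ i * (e₀ φ ∧ N + e₁ φ ∧ N * θ i)
    coordinate-N i = trans (sym (act-∧N i)) (coordinate-∧ i N)

    coordinate-T : ∀ i → λ₁ (E i) * P ∧ T ≡ κ i * (e₀ φ ∧ T + e₁ φ ∧ T * θ i)
    coordinate-T i = trans (sym (act-∧T i)) (coordinate-∧ i T)

    -- Equal θ means that `f i` and `f j` send P to the same point; as P is neither T nor N, their
    -- eigenvalue ratios agree.
    θ-inj : Injective _≡_ _≡_ θ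
    θ-inj {i} {j} eq = f-inj (cross⇒∼ₘ (E i) (E j) (*-cancelˡ (*-nonzero (κ≢0 i) (κ≢0 j)) (begin
      κ i * κ j * (λ₀ (E i) * λ₁ (E j))   ≡⟨ solve 4 (λ x y l m → x :* y :* (l :* m) := (y :* l) :* (x :* m)) refl (κ i) (κ j) (λ₀ (E i)) (λ₁ (E j)) ⟩
      (κ j * λ₀ (E i)) * (κ i * λ₁ (E j)) ≡⟨ cong₂ _*_ (swap-κ N PN≢0 (λ l → λ₀ (E l)) coordinate-N) (sym (swap-κ T PT≢0 (λ l → λ₁ (E l)) coordinate-T)) ⟩
      (κ i * λ₀ (E j)) * (κ j * λ₁ (E i)) ≡⟨ solve 4 (λ x y l m → (x :* l) :* (y :* m) := x :* y :* (l :* m)) refl (κ i) (κ j) (λ₀ (E j)) (λ₁ (E i)) ⟩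
      κ i * κ j * (λ₀ (E j) * λ₁ (E i))   ∎)))
      where
      swap-κ : ∀ u → P ∧ u ≢ 0# → (l : Fin normExponent → K) →
               (∀ i → l i * P ∧ u ≡ κ i * (e₀ φ ∧ u + e₁ φ ∧ u * θ i)) → κ j * l i ≡ κ i * l j
      swap-κ u Pu≢0 l eqn = *-cancelˡ Pu≢0 (begin
        P ∧ u * (κ j * l i)       ≡⟨ solve 3 (λ p y l → p :* (y :* l) := y :* (l :* p)) refl (P ∧ u) (κ j) (l i) ⟩
        κ j * (l i * P ∧ u)       ≡⟨ cong (κ j *_) (trans (eqn i) (cong (λ z → κ i * (e₀ φ ∧ u + e₁ φ ∧ u * z)) eq)) ⟩
        κ j * (κ i * z)           ≡⟨ solve 3 (λ x y z → y :* (x :* z) := x :* (y :* z)) refl (κ i) (κ j) z ⟩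
        κ i * (κ j * z)           ≡⟨ cong (κ i *_) (eqn j) ⟨
        κ i * (l j * P ∧ u)       ≡⟨ solve 3 (λ p y l → y :* (l :* p) := p :* (y :* l)) refl (P ∧ u) (κ i) (l j) ⟩
        P ∧ u * (κ i * l j)       ∎)
        where z = e₀ φ ∧ u + e₁ φ ∧ u * θ j

    proportional : ∀ i → norm (P ∧ N) * norm (e₀ φ ∧ T + e₁ φ ∧ T * θ i) ≡ norm (P ∧ T) * norm (e₀ φ ∧ N + e₁ φ ∧ N * θ i)
    proportional i = *-cancelˡ (*-nonzero (^-nonzero normExponent (κ≢0 i)) (^-nonzero normExponent (λ₀≢0 (E i)))) (begin
      norm κᵢ * norm l * (norm (P ∧ N) * norm zT)
        ≡⟨ solve 4 (λ κ l p z → κ :* l :* (p :* z) := (l :* p) :* (κ :* z)) refl (norm κᵢ) (norm l) (norm (P ∧ N)) (norm zT) ⟩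
      (norm l * norm (P ∧ N)) * (norm κᵢ * norm zT)
        ≡⟨ cong₂ _*_ (norms l (P ∧ N) κᵢ zN (coordinate-N i)) (sym (norms m (P ∧ T) κᵢ zT (coordinate-T i))) ⟩
      (norm κᵢ * norm zN) * (norm m * norm (P ∧ T))
        ≡⟨ cong (λ x → (norm κᵢ * norm zN) * (x * norm (P ∧ T))) (sym (norm-λ i)) ⟩
      (norm κᵢ * norm zN) * (norm l * norm (P ∧ T))
        ≡⟨ solve 4 (λ κ l p z → (κ :* z) :* (l :* p) := κ :* l :* (p :* z)) refl (norm κᵢ) (norm l) (norm (P ∧ T)) (norm zN) ⟩
      norm κᵢ * norm l * (norm (P ∧ T) * norm zN) ∎)
      where
      κᵢ = κ i
      l = λ₀ (E i)
      m = λ₁ (E i)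
      zN = e₀ φ ∧ N + e₁ φ ∧ N * θ i
      zT = e₀ φ ∧ T + e₁ φ ∧ T * θ i
      norms : ∀ x y x′ y′ → x * y ≡ x′ * y′ → norm x * norm y ≡ norm x′ * norm y′
      norms x y x′ y′ eq = trans (sym (^-distrib-* x y normExponent)) (trans (cong norm eq) (^-distrib-* x′ y′ normExponent))

-- Elements fixed by Frobenius powers, square roots and norms.

module Arithmetic (h k : ℕ) (1≤h : 1 ℕ.≤ h) (F : FiniteField ((2 ℕ.^ h) ℕ.^ (3 ℕ.+ k))) where
  open Plane h k 1≤h F public
  open ≡-Reasoning

  -- Fixed by the e-th iterate of squaring: e = 1 gives the prime field, e = h t the whole field.
  Fixed : ℕ → K → Set
  Fixed e y = y ^ (2 ℕ.^ e) ≡ y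

  frobenius-∘ : ∀ i j y → y ^ (2 ℕ.^ (i ℕ.+ j)) ≡ (y ^ (2 ℕ.^ i)) ^ (2 ℕ.^ j)
  frobenius-∘ i j y = trans (cong (y ^_) (ℕ.^-distribˡ-+-* 2 i j)) (sym (^-assocʳ y (2 ℕ.^ i) (2 ℕ.^ j)))

  fixed-* : ∀ a e {y} → Fixed e y → Fixed (a ℕ.* e) y
  fixed-* zero    e {y} fix = *-identityʳ y
  fixed-* (suc a) e {y} fix = trans (frobenius-∘ e (a ℕ.* e) y) (trans (cong (_^ (2 ℕ.^ (a ℕ.* e))) fix) (fixed-* a e fix))

  fixed-suc : ∀ j {y} → Fixed j y → Fixed (suc j) y → Fixed 1 y
  fixed-suc j {y} fix fix′ = begin
    y ^ 2                          ≡⟨ cong (_^ 2) fix ⟨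
    (y ^ (2 ℕ.^ j)) ^ 2            ≡⟨ frobenius-∘ j 1 y ⟨
    y ^ (2 ℕ.^ (j ℕ.+ 1))          ≡⟨ cong (λ i → y ^ (2 ℕ.^ i)) (ℕ.+-comm j 1) ⟩
    y ^ (2 ℕ.^ suc j)              ≡⟨ fix′ ⟩
    y                              ∎

  -- Exponents fixing y are closed under multiples, and Bézout gives a multiple of i and a multiple
  -- of j that differ by 1.
  fixed-coprime : ∀ {i j} → Coprime i j → ∀ {y} → Fixed i y → Fixed j y → Fixed 1 y
  fixed-coprime {i} {j} i⊥j {z} fixᵢ fixⱼ with coprime-Bézout i⊥j
  ... | GCD.Bézout.+- x y eq = fixed-suc (y ℕ.* j) (fixed-* y j fixⱼ) (subst (λ e → Fixed e z) (sym eq) (fixed-* x i fixᵢ))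
  ... | GCD.Bézout.-+ x y eq = fixed-suc (x ℕ.* i) (fixed-* x i fixᵢ) (subst (λ e → Fixed e z) (sym eq) (fixed-* y j fixⱼ))

  fixed-1 : ∀ {y} → y ≢ 0# → Fixed 1 y → y ≡ 1#
  fixed-1 {y} y≢0 fix = *-cancelˡ y≢0 (trans (cong (y *_) (sym (*-identityʳ y))) (trans fix (sym (*-identityʳ y))))

  order≡2^ : (2 ℕ.^ h) ℕ.^ t ≡ 2 ℕ.^ (h ℕ.* t)
  order≡2^ = ℕ.^-*-assoc 2 h t

  fixed-order : ∀ y → Fixed (h ℕ.* t) y
  fixed-order y = trans (cong (y ^_) (sym order≡2^)) (^-order y)

  fixed-coprime⇒1 : ∀ {e} → Coprime e (h ℕ.* t) → ∀ {y} → y ≢ 0# → Fixed e y → y ≡ 1#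
  fixed-coprime⇒1 e⊥ht y≢0 fix = fixed-1 y≢0 (fixed-coprime e⊥ht fix (fixed-order _))

  1≤h*t : 1 ℕ.≤ h ℕ.* t
  1≤h*t = ℕ.*-mono-≤ 1≤h (s≤s z≤n)

  -- The h t-th iterate of squaring is the identity, so the iterate before it inverts squaring.
  √_ : K → K
  √ x = x ^ (2 ℕ.^ (h ℕ.* t ℕ.∸ 1))

  √-square : ∀ x → √ x * √ x ≡ x
  √-square x = begin
    √ x * √ x                               ≡⟨ cong (√ x *_) (*-identityʳ _) ⟨
    (√ x) ^ 2                               ≡⟨ frobenius-∘ (h ℕ.* t ℕ.∸ 1) 1 x ⟨
    x ^ (2 ℕ.^ (h ℕ.* t ℕ.∸ 1 ℕ.+ 1))       ≡⟨ cong (λ i → x ^ (2 ℕ.^ i)) (ℕ.m∸n+n≡m 1≤h*t) ⟩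
    x ^ (2 ℕ.^ (h ℕ.* t))                   ≡⟨ fixed-order x ⟩
    x                                       ∎

  -- With E (2^t - 1) = q^t - 1, not every nonzero element is a root of X^E - 1.
  fixed-nontrivial : ∃ λ y → y ≢ 0# × y ≢ 1# × Fixed t y
  fixed-nontrivial = found (Fin.any? λ i → ¬? (ρ i ^ E ≟ 1#))
    where
    Q = ℕ.pred (2 ℕ.^ t)
    suc-Q : suc Q ≡ 2 ℕ.^ t
    suc-Q = ℕ.suc-pred (2 ℕ.^ t) {{ℕ.m^n≢0 2 t}}
    E = geometricSum (suc Q) h
    E-1 = ℕ.pred E

    size : (2 ℕ.^ h) ℕ.^ t ≡ suc (E ℕ.* Q)
    size = begin
      (2 ℕ.^ h) ℕ.^ t   ≡⟨ order≡2^ ⟩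
      2 ℕ.^ (h ℕ.* t)   ≡⟨ cong (2 ℕ.^_) (ℕ.*-comm h t) ⟩
      2 ℕ.^ (t ℕ.* h)   ≡⟨ ℕ.^-*-assoc 2 t h ⟨
      (2 ℕ.^ t) ℕ.^ h   ≡⟨ cong (ℕ._^ h) suc-Q ⟨
      suc Q ℕ.^ h       ≡⟨ geometricSum-* Q h ⟨
      suc (E ℕ.* Q)     ∎

    1≤E : 1 ℕ.≤ E
    1≤E = ℕ.≤-trans (ℕ.m≤m+n 1 _) (ℕ.≤-reflexive (trans (sym (geometricSum-suc (suc Q) (ℕ.pred h)))
      (cong (geometricSum (suc Q)) (ℕ.suc-pred h {{ℕ.>-nonZero 1≤h}}))))

    suc-E-1 : suc E-1 ≡ E
    suc-E-1 = ℕ.suc-pred E {{ℕ.>-nonZero 1≤E}}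

    2≤Q : 2 ℕ.≤ Q
    2≤Q = ℕ.s≤s⁻¹ (ℕ.≤-trans (ℕ.m≤n+m 3 1) (ℕ.≤-trans (ℕ.^-monoʳ-≤ 2 (ℕ.m≤m+n 2 (suc k))) (ℕ.≤-reflexive (sym suc-Q))))

    many : suc (suc E-1) ℕ.≤ E ℕ.* Q
    many = ≤R.begin
      suc (suc E-1) ≤R.≡⟨ cong suc suc-E-1 ⟩
      1 ℕ.+ E       ≤R.≤⟨ ℕ.+-monoˡ-≤ E 1≤E ⟩
      E ℕ.+ E       ≤R.≡⟨ cong (E ℕ.+_) (ℕ.+-identityʳ E) ⟨
      2 ℕ.* E       ≤R.≡⟨ ℕ.*-comm 2 E ⟩
      E ℕ.* 2       ≤R.≤⟨ ℕ.*-monoʳ-≤ E 2≤Q ⟩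
      E ℕ.* Q       ≤R.∎

    units : Nonzeros (E ℕ.* Q)
    units = nonzeros size
    ρ = proj₁ units
    ρ≢0 = proj₁ (proj₂ (proj₂ units))

    p = monomialMinusConstant 1# E-1

    length-p : length p ≡ suc (suc E-1)
    length-p = cong suc (trans (length-shift E-1 (1# ∷ [])) (ℕ.+-comm E-1 1))

    leading : coeff p (suc (E-1 ℕ.+ 0)) ≡ 1#
    leading = coeff-shift E-1 (1# ∷ []) 0

    found : Dec (∃ λ i → ρ i ^ E ≢ 1#) → ∃ λ y → y ≢ 0# × y ≢ 1# × Fixed t y
    -- The Q-th power of ρ^E is ρ^(q^t - 1) = 1, so ρ^E is fixed by the power Q + 1 = 2^t.
    found (yes (i , ρᴱ≢1)) = ρ i ^ E , ^-nonzero E (ρ≢0 i) , ρᴱ≢1 , (begin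
      (ρ i ^ E) ^ (2 ℕ.^ t)     ≡⟨ cong ((ρ i ^ E) ^_) suc-Q ⟨
      ρ i ^ E * (ρ i ^ E) ^ Q   ≡⟨ cong (ρ i ^ E *_) (trans (^-assocʳ (ρ i) E Q) (^-order-1 size (ρ≢0 i))) ⟩
      ρ i ^ E * 1#              ≡⟨ *-identityʳ _ ⟩
      ρ i ^ E                   ∎)
    found (no all) = contradiction
      (trans (sym leading) (many-roots⇒zero (E ℕ.* Q) p ρ (proj₁ (proj₂ units))
        (λ j le → coeff-length p j (ℕ.≤-trans (ℕ.≤-reflexive length-p) (ℕ.≤-trans many le))) root (suc (E-1 ℕ.+ 0))))
      1≢0
      where
      ρᴱ≡1 : ∀ i → ρ i ^ E ≡ 1#
      ρᴱ≡1 i with ρ i ^ E ≟ 1#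
      ... | yes eq = eq
      ... | no neq = contradiction (i , neq) all
      root : ∀ i → eval p (ρ i) ≡ 0#
      root i = begin
        eval p (ρ i)              ≡⟨ eval-monomialMinusConstant 1# E-1 (ρ i) ⟩
        1# + ρ i ^ suc E-1        ≡⟨ cong (λ e → 1# + ρ i ^ e) suc-E-1 ⟩
        1# + ρ i ^ E              ≡⟨ ≡⇒+-≡0 (sym (ρᴱ≡1 i)) ⟩
        0#                        ∎

  abstract
    fixed-∣ : ∀ {e} → t ∣ e → ∃ λ y → y ≢ 0# × y ≢ 1# × Fixed e y
    fixed-∣ (divides a refl) = multiple fixed-nontrivial
      where
      multiple : (∃ λ y → y ≢ 0# × y ≢ 1# × Fixed t y) → ∃ λ y → y ≢ 0# × y ≢ 1# × Fixed (a ℕ.* t) y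
      multiple (y , y≢0 , y≢1 , fix) = y , y≢0 , y≢1 , fixed-* a t fix

  norm-* : ∀ x y → norm (x * y) ≡ norm x * norm y
  norm-* x y = ^-distrib-* x y normExponent

  -- After multiplication by x the left side is x to the power 1 + q + ... + q^t, whose last term
  -- contributes x^(q^t) = x.
  norm-q : ∀ {x} → x ≢ 0# → norm x ^ q ≡ norm x
  norm-q {x} x≢0 = *-cancelˡ x≢0 (begin
    x * norm x ^ q                       ≡⟨ cong (x *_) (trans (^-assocʳ x normExponent q) (cong (x ^_) (ℕ.*-comm normExponent q))) ⟩
    x ^ suc (q ℕ.* normExponent)         ≡⟨ cong (x ^_) (geometricSum-suc q t) ⟨
    x ^ geometricSum q (suc t)           ≡⟨ cong (x ^_) (geometricSum-last q t) ⟩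
    x ^ (normExponent ℕ.+ q ℕ.^ t)       ≡⟨ ^-homo-* x normExponent (q ℕ.^ t) ⟩
    norm x * x ^ (q ℕ.^ t)               ≡⟨ cong (norm x *_) (^-order x) ⟩
    norm x * x                           ≡⟨ *-comm _ _ ⟩
    x * norm x                           ∎)

  ^-comm : ∀ x i j → (x ^ i) ^ j ≡ (x ^ j) ^ i
  ^-comm x i j = trans (^-assocʳ x i j) (trans (cong (x ^_) (ℕ.*-comm i j)) (sym (^-assocʳ x j i)))

  norm-q^ : ∀ m {x} → x ≢ 0# → norm (x ^ (q ℕ.^ m)) ≡ norm x
  norm-q^ zero    {x} _   = cong norm (*-identityʳ x)
  norm-q^ (suc m) {x} x≢0 = begin
    norm (x ^ (q ℕ.* q ℕ.^ m))   ≡⟨ cong norm (^-assocʳ x q (q ℕ.^ m)) ⟨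
    norm ((x ^ q) ^ (q ℕ.^ m))   ≡⟨ norm-q^ m (^-nonzero q x≢0) ⟩
    norm (x ^ q)                 ≡⟨ ^-comm x q normExponent ⟩
    norm x ^ q                   ≡⟨ norm-q x≢0 ⟩
    norm x                       ∎

  -- Dividing one equation by the other removes p and r and leaves a condition on the ratio of the
  -- chords d and d′.
  ratio-fixed : ∀ {p r d d′} a b → p ≢ 0# → d ≢ 0# → d′ ≢ 0# →
                p * d ^ a ≡ r * d ^ b → p * d′ ^ a ≡ r * d′ ^ b →
                ∃ λ y → y ≢ 0# × d ≡ y * d′ × y ^ a ≡ y ^ b
  ratio-fixed {p} {r} {d} {d′} a b p≢0 d≢0 d′≢0 eq eq′ = y , y≢0 , d≡yd′ ,
    *-cancelˡ (*-nonzero p≢0 (^-nonzero a d′≢0)) (begin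
      p * d′ ^ a * y ^ a        ≡⟨ solve 3 (λ p x y → p :* x :* y := p :* (y :* x)) refl p (d′ ^ a) (y ^ a) ⟩
      p * (y ^ a * d′ ^ a)      ≡⟨ cong (p *_) (trans (sym (^-distrib-* y d′ a)) (cong (_^ a) (sym d≡yd′))) ⟩
      p * d ^ a                 ≡⟨ eq ⟩
      r * d ^ b                 ≡⟨ cong (r *_) (trans (cong (_^ b) d≡yd′) (^-distrib-* y d′ b)) ⟩
      r * (y ^ b * d′ ^ b)      ≡⟨ solve 3 (λ r x y → r :* (y :* x) := r :* x :* y) refl r (d′ ^ b) (y ^ b) ⟩
      r * d′ ^ b * y ^ b        ≡⟨ cong (_* y ^ b) eq′ ⟨
      p * d′ ^ a * y ^ b        ∎)
    where
    y = d * d′ ⁻¹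
    y≢0 : y ≢ 0#
    y≢0 = *-nonzero d≢0 (⁻¹-nonzero d′≢0)
    d≡yd′ : d ≡ y * d′
    d≡yd′ = sym (quotient d d′≢0)

-- Conics tangent to the line at infinity.

module Conics (h k : ℕ) (1≤h : 1 ℕ.≤ h) (F : FiniteField ((2 ℕ.^ h) ℕ.^ (3 ℕ.+ k))) where
  open Arithmetic h k 1≤h F public
  open ≡-Reasoning

  ∧≡0⇒multiple : ∀ {v w} → v ≢ 0ᵥ → v ∧ w ≡ 0# → ∃ λ m → w ≡ m • v
  ∧≡0⇒multiple {v@(a ∷ b ∷ [])} {w@(c ∷ d ∷ [])} v≢0 eq = cases (c ≟ 0#) (d ≟ 0#)
    where
    nonzero : w ≢ 0ᵥ → ∃ λ m → w ≡ m • v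
    nonzero w≢0 with ∧≡0⇒∝ v≢0 w≢0 eq
    ... | m , _ , w≡mv = m , w≡mv
    cases : Dec (c ≡ 0#) → Dec (d ≡ 0#) → ∃ λ m → w ≡ m • v
    cases (yes refl) (yes refl) = 0# , cong₂ (λ x y → x ∷ y ∷ []) (sym (zeroˡ a)) (sym (zeroˡ b))
    cases (no c≢0) _ = nonzero (c≢0 ∘ proj₁ ∘ ∷₂-injective)
    cases _ (no d≢0) = nonzero (d≢0 ∘ proj₂ ∘ ∷₂-injective)

  •-zero : ∀ {n} {m} (v : Vec K n) → m ≡ 0# → m • v ≡ 0ᵥ
  •-zero []      refl = refl
  •-zero (x ∷ v) refl = cong₂ _∷_ (zeroˡ x) (•-zero v refl)

  ∧-nonzeroʳ : ∀ v {w} → v ∧ w ≢ 0# → w ≢ 0ᵥ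
  ∧-nonzeroʳ v {w} vw≢0 refl = vw≢0 (trans (∧-comm v 0ᵥ) (0∧ v))

  ∧-nonzeroˡ : ∀ {v} w → v ∧ w ≢ 0# → v ≢ 0ᵥ
  ∧-nonzeroˡ w vw≢0 refl = vw≢0 (0∧ w)

  module TangentConic (C : Conic) (N₀ N₁ T₀ T₁ : K)
    (N≢0 : (N₀ ∷ N₁ ∷ []) ≢ 0ᵥ) (T≢0 : (T₀ ∷ T₁ ∷ []) ≢ 0ᵥ)
    (isNucleus : IsNucleus C (at∞ (_ , N≢0))) (tangent : TangentAt C ℓ∞ (at∞ (_ , T≢0))) where
    open Conic C
    open QuadraticForm form renaming (h to h′; eval to Q)

    private
      N T n : Vec K 2
      N = N₀ ∷ N₁ ∷ []
      T = T₀ ∷ T₁ ∷ []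
      -- In characteristic 2 the nucleus of the form is (f, g, h′), a point of ℓ∞ once h′ = 0 is
      -- known.
      n = f ∷ g ∷ []

      eval∞ : ∀ x y → Q (x ∷ y ∷ 0# ∷ []) ≡ a * (x * x) + b * (y * y) + h′ * (x * y)
      eval∞ x y = solve 8 (λ a b c f g h x y →
        a :* (x :* x) :+ b :* (y :* y) :+ c :* (con false :* con false) :+ f :* (y :* con false) :+ g :* (x :* con false) :+ h :* (x :* y)
        := a :* (x :* x) :+ b :* (y :* y) :+ h :* (x :* y)) refl a b c f g h′ x y

      eval∞-T : a * (T₀ * T₀) + b * (T₁ * T₁) + h′ * (T₀ * T₁) ≡ 0#
      eval∞-T = trans (sym (eval∞ T₀ T₁)) (proj₁ tangent)

      on-ℓ∞ : ∀ x y → 0# * x + 0# * y + 1# * 0# ≡ 0#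
      on-ℓ∞ = solve 2 (λ x y → con false :* x :+ con false :* y :+ con true :* con false := con false) refl

      independent : ∃ λ w → w ∧ T ≢ 0#
      independent with T₀ ≟ 0# | T₁ ≟ 0#
      ... | no T₀≢0 | _ = (0# ∷ 1# ∷ []) , T₀≢0 ∘ trans
        (solve 2 (λ x y → x := con false :* y :+ con true :* x) refl T₀ T₁)
      ... | _ | no T₁≢0 = (1# ∷ 0# ∷ []) , T₁≢0 ∘ trans
        (solve 2 (λ x y → y := con true :* y :+ con false :* x) refl T₀ T₁)
      ... | yes T₀≡0 | yes T₁≡0 = contradiction (cong₂ (λ x y → x ∷ y ∷ []) T₀≡0 T₁≡0) T≢0

    -- Otherwise ℓ∞ would be a secant: reflect a second point of ℓ∞ in T.
    h′≡0 : h′ ≡ 0#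
    h′≡0 with h′ ≟ 0# | independent
    ... | yes eq | _ = eq
    ... | no h′≢0 | (w₀ ∷ w₁ ∷ []) , wT≢0 = contradiction
        (∝⇒∧≡0 (P∝T (proj₂ (proj₂ tangent) (at∞ (P , P≢0)) P-on-C (on-ℓ∞ P₀ P₁)))) (wT≢0 ∘ trans (sym P∧T))
      where
      w = w₀ ∷ w₁ ∷ []
      qw = a * (w₀ * w₀) + b * (w₁ * w₁) + h′ * (w₀ * w₁)
      -- As T is on the conic, the form at w + μ T is `qw` + μ h′ (w ∧ T), linear in μ; this is its
      -- zero.
      μ = qw * (h′ * w ∧ T) ⁻¹
      P₀ = w₀ + μ * T₀
      P₁ = w₁ + μ * T₁
      P = P₀ ∷ P₁ ∷ []
      P∧T : P ∧ T ≡ w ∧ T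
      P∧T = solve 5 (λ w₀ w₁ T₀ T₁ μ → (w₀ :+ μ :* T₀) :* T₁ :+ (w₁ :+ μ :* T₁) :* T₀ := w₀ :* T₁ :+ w₁ :* T₀)
        refl w₀ w₁ T₀ T₁ μ
      P≢0 : P ≢ 0ᵥ
      P≢0 = ∧-nonzeroˡ T (wT≢0 ∘ trans (sym P∧T))
      P-on-C : Q (P₀ ∷ P₁ ∷ 0# ∷ []) ≡ 0#
      P-on-C = begin
        Q (P₀ ∷ P₁ ∷ 0# ∷ []) ≡⟨ eval∞ P₀ P₁ ⟩
        a * (P₀ * P₀) + b * (P₁ * P₁) + h′ * (P₀ * P₁)
          ≡⟨ solve 8 (λ a b h w₀ w₁ T₀ T₁ μ →
               a :* ((w₀ :+ μ :* T₀) :* (w₀ :+ μ :* T₀)) :+ b :* ((w₁ :+ μ :* T₁) :* (w₁ :+ μ :* T₁)) :+ h :* ((w₀ :+ μ :* T₀) :* (w₁ :+ μ :* T₁))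
               := (a :* (w₀ :* w₀) :+ b :* (w₁ :* w₁) :+ h :* (w₀ :* w₁)) :+ μ :* (h :* (w₀ :* T₁ :+ w₁ :* T₀))
                  :+ μ :* μ :* (a :* (T₀ :* T₀) :+ b :* (T₁ :* T₁) :+ h :* (T₀ :* T₁))) refl a b h′ w₀ w₁ T₀ T₁ μ ⟩
        qw + μ * (h′ * w ∧ T) + μ * μ * (a * (T₀ * T₀) + b * (T₁ * T₁) + h′ * (T₀ * T₁))
          ≡⟨ cong₂ (λ x y → qw + x + μ * μ * y) (quotient qw (*-nonzero h′≢0 wT≢0)) eval∞-T ⟩
        qw + qw + μ * μ * 0#
          ≡⟨ solve 2 (λ x y → x :+ x :+ y :* con false := con false) refl qw (μ * μ) ⟩
        0# ∎
      P∝T : (P₀ ∷ P₁ ∷ 0# ∷ []) ∝ (T₀ ∷ T₁ ∷ 0# ∷ []) → P ∝ T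
      P∝T (m , m≢0 , eq) = m , m≢0 , cong (λ { (x ∷ y ∷ _) → x ∷ y ∷ [] }) eq

    private
      eval-xyz : ∀ x y z → Q (x ∷ y ∷ z ∷ []) ≡ a * (x * x) + b * (y * y) + c * (z * z) + z * (f * y + g * x)
      eval-xyz x y z = begin
        S + h′ * (x * y)  ≡⟨ cong (λ e → S + e * (x * y)) h′≡0 ⟩
        S + 0# * (x * y)  ≡⟨ solve 8 (λ a b c f g x y z →
          a :* (x :* x) :+ b :* (y :* y) :+ c :* (z :* z) :+ f :* (y :* z) :+ g :* (x :* z) :+ con false :* (x :* y)
          := a :* (x :* x) :+ b :* (y :* y) :+ c :* (z :* z) :+ z :* (f :* y :+ g :* x)) refl a b c f g x y z ⟩
        a * (x * x) + b * (y * y) + c * (z * z) + z * (f * y + g * x) ∎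
        where S = a * (x * x) + b * (y * y) + c * (z * z) + f * (y * z) + g * (x * z)

      scaled-square-+ : ∀ m x x′ → m * ((x + x′) * (x + x′)) ≡ m * (x * x) + m * (x′ * x′)
      scaled-square-+ = solve 3 (λ m x x′ → m :* ((x :+ x′) :* (x :+ x′)) := m :* (x :* x) :+ m :* (x′ :* x′)) refl

      -- The squares are additive in characteristic 2 and cancel, so with h′ = 0 only the
      -- coefficients f and g remain.
      polar-xyz : ∀ x y z x′ y′ z′ → polar (x ∷ y ∷ z ∷ []) (x′ ∷ y′ ∷ z′ ∷ []) ≡ z * (f * y′ + g * x′) + z′ * (f * y + g * x)
      polar-xyz x y z x′ y′ z′ = begin
        Q (x + x′ ∷ y + y′ ∷ z + z′ ∷ []) + - Q (x ∷ y ∷ z ∷ []) + - Q (x′ ∷ y′ ∷ z′ ∷ [])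
          ≡⟨ cong₂ _+_ (cong₂ (λ u v → u + - v) (eval-xyz _ _ _) (eval-xyz x y z)) (cong -_ (eval-xyz x′ y′ z′)) ⟩
        a * ((x + x′) * (x + x′)) + b * ((y + y′) * (y + y′)) + c * ((z + z′) * (z + z′)) + (z + z′) * (f * (y + y′) + g * (x + x′))
          + - (S x y z + z * L x y) + - (S x′ y′ z′ + z′ * L x′ y′)
          ≡⟨ cong₂ (λ u v → u + (z + z′) * v + - (S x y z + z * L x y) + - (S x′ y′ z′ + z′ * L x′ y′)) S-+ L-+ ⟩
        S x y z + S x′ y′ z′ + (z + z′) * (L x y + L x′ y′) + - (S x y z + z * L x y) + - (S x′ y′ z′ + z′ * L x′ y′)
          ≡⟨ solve 6 (λ s s′ z z′ l l′ → s :+ s′ :+ (z :+ z′) :* (l :+ l′) :+ :- (s :+ z :* l) :+ :- (s′ :+ z′ :* l′)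
               := z :* l′ :+ z′ :* l) refl (S x y z) (S x′ y′ z′) z z′ (L x y) (L x′ y′) ⟩
        z * L x′ y′ + z′ * L x y ∎
        where
        S : K → K → K → K
        S x y z = a * (x * x) + b * (y * y) + c * (z * z)
        L : K → K → K
        L x y = f * y + g * x
        S-+ : S (x + x′) (y + y′) (z + z′) ≡ S x y z + S x′ y′ z′
        S-+ = trans (cong₂ _+_ (cong₂ _+_ (scaled-square-+ a x x′) (scaled-square-+ b y y′)) (scaled-square-+ c z z′))
          (solve 6 (λ p p′ r r′ s s′ → (p :+ p′) :+ (r :+ r′) :+ (s :+ s′) := (p :+ r :+ s) :+ (p′ :+ r′ :+ s′)) refl
            (a * (x * x)) (a * (x′ * x′)) (b * (y * y)) (b * (y′ * y′)) (c * (z * z)) (c * (z′ * z′)))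
        L-+ : L (x + x′) (y + y′) ≡ L x y + L x′ y′
        L-+ = solve 6 (λ f g x y x′ y′ → f :* (y :+ y′) :+ g :* (x :+ x′) := (f :* y :+ g :* x) :+ (f :* y′ :+ g :* x′)) refl f g x y x′ y′

      -- The form restricted to ℓ∞, diagonal because h′ = 0.
      q₂ : Vec K 2 → K
      q₂ (x ∷ y ∷ []) = a * (x * x) + b * (y * y)

      q₂-• : ∀ m v → q₂ (m • v) ≡ m * m * q₂ v
      q₂-• m (x ∷ y ∷ []) = solve 5 (λ a b m x y → a :* ((m :* x) :* (m :* x)) :+ b :* ((m :* y) :* (m :* y))
        := m :* m :* (a :* (x :* x) :+ b :* (y :* y))) refl a b m x y

      q₂-T : q₂ T ≡ 0#
      q₂-T = begin
        q₂ T                                             ≡⟨ solve 3 (λ x y z → x :+ y := x :+ y :+ con false :* z) refl _ _ (T₀ * T₁) ⟩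
        a * (T₀ * T₀) + b * (T₁ * T₁) + 0# * (T₀ * T₁)   ≡⟨ cong (λ e → a * (T₀ * T₀) + b * (T₁ * T₁) + e * (T₀ * T₁)) h′≡0 ⟨
        a * (T₀ * T₀) + b * (T₁ * T₁) + h′ * (T₀ * T₁)   ≡⟨ eval∞-T ⟩
        0#                                               ∎

    -- For f = g = 0 the polar form would vanish identically, and the point T of the conic would
    -- contradict nondegeneracy.
    n≢0 : n ≢ 0ᵥ
    n≢0 eq with ∷₂-injective eq
    ... | f≡0 , g≡0 = nondegenerate (T₀ ∷ T₁ ∷ 0# ∷ []) (proj₂ (at∞ (T , T≢0)))
      (λ { (x ∷ y ∷ z ∷ []) → begin
        polar (T₀ ∷ T₁ ∷ 0# ∷ []) (x ∷ y ∷ z ∷ [])     ≡⟨ polar-xyz T₀ T₁ 0# x y z ⟩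
        0# * (f * y + g * x) + z * (f * T₁ + g * T₀)   ≡⟨ cong₂ (λ f g → 0# * (f * y + g * x) + z * (f * T₁ + g * T₀)) f≡0 g≡0 ⟩
        0# * (0# * y + 0# * x) + z * (0# * T₁ + 0# * T₀) ≡⟨ solve 5 (λ x y z u v →
          con false :* (con false :* y :+ con false :* x) :+ z :* (con false :* v :+ con false :* u) := con false) refl x y z T₀ T₁ ⟩
        0#                                             ∎ })
      (proj₁ tangent)

    -- n lies in the radical of the polar form, where nondegeneracy forbids nontrivial zeros.
    q₂n≢0 : q₂ n ≢ 0#
    q₂n≢0 eq = nondegenerate (f ∷ g ∷ 0# ∷ []) (proj₂ (at∞ (n , n≢0)))
      (λ { (x ∷ y ∷ z ∷ []) → trans (polar-xyz f g 0# x y z)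
        (solve 5 (λ f g x y z → con false :* (f :* y :+ g :* x) :+ z :* (f :* g :+ g :* f) := con false) refl f g x y z) })
      (trans (eval-xyz f g 0#) (trans
        (solve 5 (λ a b c f g → a :* (f :* f) :+ b :* (g :* g) :+ c :* (con false :* con false) :+ con false :* (f :* g :+ g :* f)
          := a :* (f :* f) :+ b :* (g :* g)) refl a b c f g) eq))

    -- The line through n and the origin is tangent, so it contains N.
    tangent-through-n : ∀ l → l * l * q₂ n ≡ c → n ∧ N ≡ 0#
    tangent-through-n l l² = trans (solve 4 (λ f g x y → f :* y :+ g :* x := g :* x :+ f :* y :+ con false :* con false) refl f g N₀ N₁)
      (isNucleus line (affine P , P-on-C , P-on-line , only))
      where
      P = l * f ∷ l * g ∷ []
      line : LinePG
      line = (g ∷ f ∷ 0# ∷ []) , λ eq → n≢0 (cong (λ { (x ∷ y ∷ _) → y ∷ x ∷ [] }) eq)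
      -- Since c = l^2 `q₂ n`, the form is a multiple of a square on this line and has a single zero
      -- there.
      eval-on-line : ∀ ρ z → Q (ρ * f ∷ ρ * g ∷ z ∷ []) ≡ q₂ n * ((ρ + z * l) * (ρ + z * l))
      eval-on-line ρ z = begin
        Q (ρ * f ∷ ρ * g ∷ z ∷ [])
          ≡⟨ eval-xyz (ρ * f) (ρ * g) z ⟩
        a * ((ρ * f) * (ρ * f)) + b * ((ρ * g) * (ρ * g)) + c * (z * z) + z * (f * (ρ * g) + g * (ρ * f))
          ≡⟨ cong (λ c → a * ((ρ * f) * (ρ * f)) + b * ((ρ * g) * (ρ * g)) + c * (z * z) + z * (f * (ρ * g) + g * (ρ * f))) l² ⟨
        a * ((ρ * f) * (ρ * f)) + b * ((ρ * g) * (ρ * g)) + l * l * q₂ n * (z * z) + z * (f * (ρ * g) + g * (ρ * f))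
          ≡⟨ solve 7 (λ a b f g l z ρ →
               a :* ((ρ :* f) :* (ρ :* f)) :+ b :* ((ρ :* g) :* (ρ :* g)) :+ (l :* l :* (a :* (f :* f) :+ b :* (g :* g))) :* (z :* z) :+ z :* (f :* (ρ :* g) :+ g :* (ρ :* f))
               := (a :* (f :* f) :+ b :* (g :* g)) :* ((ρ :+ z :* l) :* (ρ :+ z :* l))) refl a b f g l z ρ ⟩
        q₂ n * ((ρ + z * l) * (ρ + z * l)) ∎
      P-on-C : affine P OnConic C
      P-on-C = trans (eval-on-line l 1#)
        (solve 2 (λ q l → q :* ((l :+ con true :* l) :* (l :+ con true :* l)) := con false) refl (q₂ n) l)
      P-on-line : affine P OnLine line
      P-on-line = solve 3 (λ f g l → g :* (l :* f) :+ f :* (l :* g) :+ con false :* con true := con false) refl f g l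
      only : ∀ R → R OnConic C → R OnLine line → R ∼ affine P
      only ((x ∷ y ∷ z ∷ []) , R≢0) on-C on-line with ∧≡0⇒multiple {w = x ∷ y ∷ []} n≢0
        (trans (solve 5 (λ f g x y z → f :* y :+ g :* x := g :* x :+ f :* y :+ con false :* z) refl f g x y z) on-line)
      ... | ρ , refl = z ⁻¹ , ⁻¹-nonzero z≢0 , cong₂ _∷_ (coordinate f)
              (cong₂ _∷_ (coordinate g) (cong (_∷ []) (sym (trans (*-comm _ _) (⁻¹-inverse z≢0)))))
        where
        square≡0 : (ρ + z * l) * (ρ + z * l) ≡ 0#
        square≡0 = *-zero⁻¹ q₂n≢0 (trans (sym (eval-on-line ρ z)) on-C)
        ρ≡zl : ρ ≡ z * l
        ρ≡zl = +-≡0⇒≡ (^-zero⁻¹ 2 (trans (cong ((ρ + z * l) *_) (*-identityʳ _)) square≡0))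
        z≢0 : z ≢ 0#
        z≢0 refl = R≢0 (cong₂ (λ x y → x ∷ y ∷ 0# ∷ []) (vanish f) (vanish g))
          where
          vanish : ∀ u → ρ * u ≡ 0#
          vanish u = trans (cong (_* u) (trans ρ≡zl (zeroˡ l))) (zeroˡ u)
        coordinate : ∀ u → l * u ≡ z ⁻¹ * (ρ * u)
        coordinate u = sym (begin
          z ⁻¹ * (ρ * u)       ≡⟨ cong (λ r → z ⁻¹ * (r * u)) ρ≡zl ⟩
          z ⁻¹ * (z * l * u)   ≡⟨ solve 4 (λ i z l u → i :* (z :* l :* u) := (z :* i) :* (l :* u)) refl (z ⁻¹) z l u ⟩
          z * z ⁻¹ * (l * u)   ≡⟨ cong (_* (l * u)) (⁻¹-inverse z≢0) ⟩
          1# * (l * u)         ≡⟨ *-identityˡ _ ⟩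
          l * u                ∎)

    -- N is only assumed to lie on all tangents. As it is on ℓ∞, one affine tangent identifies it
    -- with n; the point of contact needs a square root of c / `q₂ n`.
    n∧N≡0 : n ∧ N ≡ 0#
    n∧N≡0 = tangent-through-n (√ (c * q₂ n ⁻¹)) (trans (cong (_* q₂ n) (√-square _)) (quotient c q₂n≢0))

    Parabola : Vec K 2 → Vec K 2 → Set
    Parabola u v = ∃₂ λ α γ → α ≢ 0# × ∀ x y → (affine (x • u +ᵥ y • v) OnConic C) ⇔ (y ≡ α * (x * x) + γ)

    parabola-along : ∀ {u v} ρ σ → u ≡ ρ • n → v ≡ σ • T → u ∧ v ≢ 0# → Parabola u v
    parabola-along {u@(u₀ ∷ u₁ ∷ [])} {v@(v₀ ∷ v₁ ∷ [])} ρ σ u≡ρn v≡σT uv≢0 =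
      A * J ⁻¹ , c * J ⁻¹ , *-nonzero A≢0 (⁻¹-nonzero J≢0) , λ x y → mk⇔
        (λ on-C → *-cancelˡ J≢0 (begin
          J * y                               ≡⟨ +-≡0⇒≡ (trans (+-comm (J * y) _) (trans (sym (eval-affine x y)) on-C)) ⟩
          A * (x * x) + c                     ≡⟨ on-parabola x ⟨
          J * (A * J ⁻¹ * (x * x) + c * J ⁻¹) ∎))
        (λ { refl → trans (eval-affine x _) (≡⇒+-≡0 (sym (on-parabola x))) })
      where
      A = q₂ u
      J = n ∧ v
      ρ≢0 : ρ ≢ 0#
      ρ≢0 ρ≡0 = ∧-nonzeroˡ v uv≢0 (trans u≡ρn (•-zero n ρ≡0))
      A≢0 : A ≢ 0#
      A≢0 eq = *-nonzero (*-nonzero ρ≢0 ρ≢0) q₂n≢0 (trans (sym (q₂-• ρ n)) (trans (cong q₂ (sym u≡ρn)) eq))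
      J≢0 : J ≢ 0#
      J≢0 = *-nonzeroʳ ρ λ eq → uv≢0 (trans (cong (_∧ v) u≡ρn) (trans (•-∧ ρ n v) eq))
      n∧u≡0 : n ∧ u ≡ 0#
      n∧u≡0 = trans (cong (n ∧_) u≡ρn) (trans (∧-comm n (ρ • n)) (trans (•-∧ ρ n n) (trans (cong (ρ *_) (∧-self n)) (zeroʳ ρ))))
      q₂v≡0 : q₂ v ≡ 0#
      q₂v≡0 = trans (cong q₂ v≡σT) (trans (q₂-• σ T) (trans (cong (σ * σ *_) q₂-T) (zeroʳ _)))
      -- The form is diagonal on ℓ∞, so there is no x y term. The x term is n ∧ u and the y^2 term
      -- is `q₂ v`; both vanish since u is a multiple of n and v of T.
      eval-affine : ∀ x y → Q (x * u₀ + y * v₀ ∷ x * u₁ + y * v₁ ∷ 1# ∷ []) ≡ A * (x * x) + c + J * y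
      eval-affine x y = begin
        Q (x * u₀ + y * v₀ ∷ x * u₁ + y * v₁ ∷ 1# ∷ [])
          ≡⟨ eval-xyz _ _ 1# ⟩
        a * (X′ * X′) + b * (Y′ * Y′) + c * (1# * 1#) + 1# * (f * Y′ + g * X′)
          ≡⟨ cong₂ (λ r s → r + c * (1# * 1#) + 1# * s) (cong₂ _+_ (square-combination a u₀ v₀) (square-combination b u₁ v₁))
               (solve 8 (λ f g u₀ u₁ v₀ v₁ x y → f :* (x :* u₁ :+ y :* v₁) :+ g :* (x :* u₀ :+ y :* v₀)
                 := x :* (f :* u₁ :+ g :* u₀) :+ y :* (f :* v₁ :+ g :* v₀)) refl f g u₀ u₁ v₀ v₁ x y) ⟩
        ((x * x) * (a * (u₀ * u₀)) + (y * y) * (a * (v₀ * v₀))) + ((x * x) * (b * (u₁ * u₁)) + (y * y) * (b * (v₁ * v₁)))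
          + c * (1# * 1#) + 1# * (x * n ∧ u + y * J)
          ≡⟨ solve 9 (λ s s′ p p′ r r′ c e j → (s :* p :+ s′ :* p′) :+ (s :* r :+ s′ :* r′) :+ c :* (con true :* con true) :+ con true :* (e :+ j)
               := (p :+ r) :* s :+ c :+ j :+ (e :+ s′ :* (p′ :+ r′))) refl
               (x * x) (y * y) (a * (u₀ * u₀)) (a * (v₀ * v₀)) (b * (u₁ * u₁)) (b * (v₁ * v₁)) c (x * n ∧ u) (y * J) ⟩
        A * (x * x) + c + y * J + (x * n ∧ u + y * y * q₂ v)
          ≡⟨ cong (λ e → A * (x * x) + c + e + (x * n ∧ u + y * y * q₂ v)) (*-comm y J) ⟩
        A * (x * x) + c + J * y + (x * n ∧ u + y * y * q₂ v)
          ≡⟨ cong₂ (λ r s → A * (x * x) + c + J * y + (x * r + y * y * s)) n∧u≡0 q₂v≡0 ⟩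
        A * (x * x) + c + J * y + (x * 0# + y * y * 0#)
          ≡⟨ solve 3 (λ s x y → s :+ (x :* con false :+ y :* con false) := s) refl (A * (x * x) + c + J * y) x (y * y) ⟩
        A * (x * x) + c + J * y ∎
        where
        X′ = x * u₀ + y * v₀
        Y′ = x * u₁ + y * v₁
        square-combination : ∀ m u v → m * ((x * u + y * v) * (x * u + y * v)) ≡ (x * x) * (m * (u * u)) + (y * y) * (m * (v * v))
        square-combination m u v = solve 5 (λ m u v x y → m :* ((x :* u :+ y :* v) :* (x :* u :+ y :* v))
          := (x :* x) :* (m :* (u :* u)) :+ (y :* y) :* (m :* (v :* v))) refl m u v x y
      on-parabola : ∀ x → J * (A * J ⁻¹ * (x * x) + c * J ⁻¹) ≡ A * (x * x) + c
      on-parabola x = begin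
        J * (A * J ⁻¹ * (x * x) + c * J ⁻¹) ≡⟨ solve 5 (λ A J i c s → J :* (A :* i :* s :+ c :* i) := (J :* i) :* (A :* s :+ c))
                                                refl A J (J ⁻¹) c (x * x) ⟩
        J * J ⁻¹ * (A * (x * x) + c)        ≡⟨ cong (_* (A * (x * x) + c)) (⁻¹-inverse J≢0) ⟩
        1# * (A * (x * x) + c)              ≡⟨ *-identityˡ _ ⟩
        A * (x * x) + c                     ∎

    parabola : ∀ {u v} → u ∧ v ≢ 0# → u ∧ N ≡ 0# → v ∧ T ≡ 0# → Parabola u v
    parabola {u} {v} uv≢0 uN≡0 vT≡0 = parabola-along (proj₁ u-multiple) (proj₁ v-multiple) (proj₂ u-multiple) (proj₂ v-multiple) uv≢0
      where
      u∧n≡0 : N ∝ n → n ∧ u ≡ 0#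
      u∧n≡0 (m , m≢0 , n≡mN) = begin
        n ∧ u         ≡⟨ cong (_∧ u) n≡mN ⟩
        (m • N) ∧ u   ≡⟨ •-∧ m N u ⟩
        m * N ∧ u     ≡⟨ cong (m *_) (trans (∧-comm N u) uN≡0) ⟩
        m * 0#        ≡⟨ zeroʳ m ⟩
        0#            ∎
      u-multiple : ∃ λ ρ → u ≡ ρ • n
      u-multiple = ∧≡0⇒multiple n≢0 (u∧n≡0 (∧≡0⇒∝ N≢0 n≢0 (trans (∧-comm N n) n∧N≡0)))
      v-multiple : ∃ λ σ → v ≡ σ • T
      v-multiple = ∧≡0⇒multiple T≢0 (trans (∧-comm T v) vT≡0)

-- Lines of the André plane, and completion of an arc by the vertical direction.

module AndréPlanes (h k : ℕ) (1≤h : 1 ℕ.≤ h) (F : FiniteField ((2 ℕ.^ h) ℕ.^ (3 ℕ.+ k))) where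
  open Conics h k 1≤h F public
  open ≡-Reasoning

  linear-zero : ∀ {a} x b → a ≢ 0# → (a * x + b ≡ 0#) ⇔ (x ≡ a ⁻¹ * b)
  linear-zero {a} x b a≢0 = mk⇔
    (λ eq → *-cancelˡ a≢0 (trans (+-≡0⇒≡ eq) (sym cancel)))
    (λ { refl → trans (cong (_+ b) cancel) (x+x≡0 b) })
    where
    cancel : a * (a ⁻¹ * b) ≡ b
    cancel = trans (sym (*-assoc a (a ⁻¹) b)) (trans (cong (_* b) (⁻¹-inverse a≢0)) (*-identityˡ b))

  module Coordinates {D : Pred (PG 2) 0ℓ} (ix : Indexing D) where
    open Indexing ix
    open Matrix φ renaming (m₀₀ to p; m₀₁ to r; m₁₀ to s; m₁₁ to w)

    Δ : K
    Δ = e₀ φ ∧ e₁ φ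

    Δ≢0 : Δ ≢ 0#
    Δ≢0 = invertible ∘ trans (det≡∧ φ)

    point : K → K → Vec K 2
    point x y = act φ (x ∷ y ∷ [])

    abstract
      coordinates : ∀ v → ∃₂ λ x y → v ≡ point x y
      coordinates (a ∷ b ∷ []) = Δ ⁻¹ * (w * a + r * b) , Δ ⁻¹ * (s * a + p * b) ,
        cong₂ (λ x y → x ∷ y ∷ [])
          (sym (trans (solve 7 (λ p r s w a b i → p :* (i :* (w :* a :+ r :* b)) :+ r :* (i :* (s :* a :+ p :* b))
                 := ((p :* w :+ s :* r) :* i) :* a) refl p r s w a b (Δ ⁻¹)) (cancel a)))
          (sym (trans (solve 7 (λ p r s w a b i → s :* (i :* (w :* a :+ r :* b)) :+ w :* (i :* (s :* a :+ p :* b))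
                 := ((p :* w :+ s :* r) :* i) :* b) refl p r s w a b (Δ ⁻¹)) (cancel b)))
        where
        cancel : ∀ z → Δ * Δ ⁻¹ * z ≡ z
        cancel z = trans (cong (_* z) (⁻¹-inverse Δ≢0)) (*-identityˡ z)

      point-injective : ∀ {x y x′ y′} → point x y ≡ point x′ y′ → x ≡ x′ × y ≡ y′
      point-injective {x} {y} {x′} {y′} eq with ∷₂-injective eq
      ... | eq₀ , eq₁ =
        *-cancelˡ Δ≢0 (trans (solve-x x y) (trans (cong₂ (λ a b → w * a + r * b) eq₀ eq₁) (sym (solve-x x′ y′)))) ,
        *-cancelˡ Δ≢0 (trans (solve-y x y) (trans (cong₂ (λ a b → s * a + p * b) eq₀ eq₁) (sym (solve-y x′ y′))))
        where
        solve-x : ∀ x y → Δ * x ≡ w * (p * x + r * y) + r * (s * x + w * y)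
        solve-x x y = solve 6 (λ p r s w x y → (p :* w :+ s :* r) :* x := w :* (p :* x :+ r :* y) :+ r :* (s :* x :+ w :* y)) refl p r s w x y
        solve-y : ∀ x y → Δ * y ≡ s * (p * x + r * y) + p * (s * x + w * y)
        solve-y x y = solve 6 (λ p r s w x y → (p :* w :+ s :* r) :* y := s :* (p :* x :+ r :* y) :+ p :* (s :* x :+ w :* y)) refl p r s w x y

      point-+ : ∀ x y x′ y′ → point x y +ᵥ point x′ y′ ≡ point (x + x′) (y + y′)
      point-+ x y x′ y′ = cong₂ (λ a b → a ∷ b ∷ []) (row p r) (row s w)
        where
        row : ∀ a b → (a * x + b * y) + (a * x′ + b * y′) ≡ a * (x + x′) + b * (y + y′)
        row a b = solve 6 (λ a b x y x′ y′ → (a :* x :+ b :* y) :+ (a :* x′ :+ b :* y′) := a :* (x :+ x′) :+ b :* (y :+ y′)) refl a b x y x′ y′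

      dot-point : ∀ a b c x y → dot (a ∷ b ∷ c ∷ []) (vec (affine (point x y))) ≡ (a * p + b * s) * x + c + (a * r + b * w) * y
      dot-point a b c x y = begin
        a * (p * x + r * y) + b * (s * x + w * y) + c * 1#
          ≡⟨ cong₂ (λ u v → u + v + c * 1#) (expand-row a p r) (expand-row b s w) ⟩
        (a * p * x + a * r * y) + (b * s * x + b * w * y) + c * 1#
          ≡⟨ solve 7 (λ ap ar bs bw c x y → (ap :* x :+ ar :* y) :+ (bs :* x :+ bw :* y) :+ c :* con true
               := (ap :+ bs) :* x :+ c :+ (ar :+ bw) :* y) refl (a * p) (a * r) (b * s) (b * w) c x y ⟩
        (a * p + b * s) * x + c + (a * r + b * w) * y ∎
        where
        expand-row : ∀ a p r → a * (p * x + r * y) ≡ a * p * x + a * r * y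
        expand-row a p r = solve 5 (λ a p r x y → a :* (p :* x :+ r :* y) := a :* p :* x :+ a :* r :* y) refl a p r x y

    e₁≡point : e₁ φ ≡ point 0# 1#
    e₁≡point = cong₂ (λ a b → a ∷ b ∷ []) (row p r) (row s w)
      where
      row : ∀ a b → b ≡ a * 0# + b * 1#
      row = solve 2 (λ a b → b := a :* con false :+ b :* con true) refl

    -- Points of D have the form φ(1, θ), with nonzero first coordinate.
    e₁∉D : ∀ e₁≢0 → (e₁ φ , e₁≢0) ∉ D
    e₁∉D e₁≢0 e₁∈D with Equivalence.to (maps (e₁ φ , e₁≢0)) e₁∈D
    ... | _ , (θ , _ , _ , κ , κ≢0 , refl) , κ′ , κ′≢0 , eq =
      *-nonzero κ′≢0 (*-nonzero κ≢0 1≢0) (sym (proj₁ (point-injective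
        (trans (sym e₁≡point) (trans eq (sym (act-• φ κ′ (κ * 1# ∷ κ * θ ∷ []))))))))

    module AndréLines (m : ℕ) where

      On : Vec K 2 → AndréLine ix m → Set
      On = OnAndré ix m

      open IncidenceStructure (affineAndréPlane ix m) using (_∥_)

      q^m≡ : q ℕ.^ m ≡ 2 ℕ.^ (h ℕ.* m)
      q^m≡ = ℕ.^-*-assoc 2 h m

      on-block : ∀ {u v₀ v₁ x y} (u≢0 : u ≢ 0#) (u-norm : norm u ≡ δ) c →
                 x ≡ v₀ + c → y ≡ v₁ + c ^ (q ℕ.^ m) * u →
                 On (point x y) (block u u≢0 u-norm (point v₀ v₁))
      on-block {u} {v₀} {v₁} _ _ c refl refl =
        _ , (c , refl) , sym (point-+ v₀ v₁ c (c ^ (q ℕ.^ m) * u))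

      -- The exponent j covers both kinds of lines at once: 0 for lines kept from PG(2, q^t), h m
      -- for blocks.
      data Shape (l : AndréLine ix m) : Set where
        vertical : ∀ c → (∀ x y → On (point x y) l ⇔ (x ≡ c)) → Shape l
        graph    : ∀ u j b → j ≡ 0 ⊎ j ≡ h ℕ.* m →
                   (∀ x y → On (point x y) l ⇔ (y ≡ u * x ^ (2 ℕ.^ j) + b)) → Shape l

      shape : ∀ l → Shape l
      shape (old ((a ∷ b ∷ c ∷ []) , nz) ℓ≁ℓ∞ P on P∉D) with a * r + b * w ≟ 0#
      ... | no B≢0 = graph (B ⁻¹ * A) 0 (B ⁻¹ * c) (inj₁ refl) λ x y → mk⇔
          (λ eq → trans (Equivalence.to (linear-zero y (A * x + c) B≢0) (trans (sym (dot≡ x y)) eq)) (normalise x))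
          (λ eq → trans (dot≡ x y) (Equivalence.from (linear-zero y (A * x + c) B≢0) (trans eq (sym (normalise x)))))
        where
        A = a * p + b * s
        B = a * r + b * w
        dot≡ : ∀ x y → a * (p * x + r * y) + b * (s * x + w * y) + c * 1# ≡ B * y + (A * x + c)
        dot≡ x y = trans (dot-point a b c x y) (+-comm _ _)
        normalise : ∀ x → B ⁻¹ * (A * x + c) ≡ B ⁻¹ * A * (x * 1#) + B ⁻¹ * c
        normalise x = solve 4 (λ i A x c → i :* (A :* x :+ c) := i :* A :* (x :* con true) :+ i :* c) refl (B ⁻¹) A x c
      ... | yes B≡0 = vertical (A ⁻¹ * c) λ x y → mk⇔
          (λ eq → Equivalence.to (linear-zero x c A≢0) (trans (sym (dot≡ x y)) eq))
          (λ eq → trans (dot≡ x y) (Equivalence.from (linear-zero x c A≢0) eq))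
        where
        A = a * p + b * s
        B = a * r + b * w
        dot≡ : ∀ x y → a * (p * x + r * y) + b * (s * x + w * y) + c * 1# ≡ A * x + c
        dot≡ x y = begin
          dot (a ∷ b ∷ c ∷ []) (vec (affine (point x y))) ≡⟨ dot-point a b c x y ⟩
          A * x + c + B * y  ≡⟨ cong (λ z → A * x + c + z * y) B≡0 ⟩
          A * x + c + 0# * y ≡⟨ solve 2 (λ z y → z :+ con false :* y := z) refl (A * x + c) y ⟩
          A * x + c          ∎
        -- If A = B = 0, invertibility of φ gives a = b = 0, and the line would be ℓ∞.
        A≢0 : A ≢ 0#
        A≢0 A≡0 = ℓ≁ℓ∞ (c ⁻¹ , ⁻¹-nonzero c≢0 , cong₂ _∷_ (vanish a≡0) (cong₂ _∷_ (vanish b≡0)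
                    (cong (_∷ []) (sym (trans (*-comm _ c) (⁻¹-inverse c≢0))))))
          where
          combination : ∀ x y → x * A + y * B ≡ 0#
          combination x y = trans (cong₂ (λ A B → x * A + y * B) A≡0 B≡0)
            (solve 2 (λ x y → x :* con false :+ y :* con false := con false) refl x y)
          a≡0 : a ≡ 0#
          a≡0 = *-zero⁻¹ Δ≢0 (trans (solve 6 (λ a b p r s w → (p :* w :+ s :* r) :* a
            := w :* (a :* p :+ b :* s) :+ s :* (a :* r :+ b :* w)) refl a b p r s w) (combination w s))
          b≡0 : b ≡ 0#
          b≡0 = *-zero⁻¹ Δ≢0 (trans (solve 6 (λ a b p r s w → (p :* w :+ s :* r) :* b
            := r :* (a :* p :+ b :* s) :+ p :* (a :* r :+ b :* w)) refl a b p r s w) (combination r p))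
          c≢0 : c ≢ 0#
          c≢0 c≡0 = nz (cong₂ _∷_ a≡0 (cong₂ _∷_ b≡0 (cong (_∷ []) c≡0)))
          vanish : ∀ {z} → z ≡ 0# → 0# ≡ c ⁻¹ * z
          vanish refl = sym (zeroʳ _)
      -- Powers with exponent 2^(h m) are additive, so translating a block changes only the constant
      -- b.
      shape (block u u≢0 u-norm v) with coordinates v
      ... | v₀ , v₁ , refl = graph u (h ℕ.* m) (v₁ + u * v₀ ^ J) (inj₂ refl) λ x y → mk⇔ (to x y)
          (λ { refl → on-block u≢0 u-norm (x + v₀) (solve 2 (λ x v → x := v :+ (x :+ v)) refl x v₀) (trans (from x)
                 (cong (λ i → v₁ + (x + v₀) ^ i * u) (sym q^m≡))) })
        where
        J = 2 ℕ.^ (h ℕ.* m)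
        to : ∀ x y → On (point x y) (block u u≢0 u-norm (point v₀ v₁)) → y ≡ u * x ^ J + (v₁ + u * v₀ ^ J)
        to x y (_ , (c , refl) , eq) with point-injective (trans eq (point-+ v₀ v₁ c (c ^ (q ℕ.^ m) * u)))
        ... | refl , refl = begin
          v₁ + c ^ (q ℕ.^ m) * u                       ≡⟨ cong (λ i → v₁ + c ^ i * u) q^m≡ ⟩
          v₁ + c ^ J * u                               ≡⟨ solve 4 (λ v₁ cJ u vJ → v₁ :+ cJ :* u := u :* (vJ :+ cJ) :+ (v₁ :+ u :* vJ))
                                                            refl v₁ (c ^ J) u (v₀ ^ J) ⟩
          u * (v₀ ^ J + c ^ J) + (v₁ + u * v₀ ^ J)     ≡⟨ cong (λ z → u * z + (v₁ + u * v₀ ^ J)) (frobenius-+ (h ℕ.* m) v₀ c) ⟨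
          u * (v₀ + c) ^ J + (v₁ + u * v₀ ^ J)         ∎
        from : ∀ x → u * x ^ J + (v₁ + u * v₀ ^ J) ≡ v₁ + (x + v₀) ^ J * u
        from x = begin
          u * x ^ J + (v₁ + u * v₀ ^ J)   ≡⟨ solve 4 (λ u xJ v₁ vJ → u :* xJ :+ (v₁ :+ u :* vJ) := v₁ :+ (xJ :+ vJ) :* u)
                                               refl u (x ^ J) v₁ (v₀ ^ J) ⟩
          v₁ + (x ^ J + v₀ ^ J) * u       ≡⟨ cong (λ z → v₁ + z * u) (frobenius-+ (h ℕ.* m) x v₀) ⟨
          v₁ + (x + v₀) ^ J * u           ∎

      Vertical : AndréLine ix m → Set
      Vertical l = ∃ λ c → ∀ x y → On (point x y) l ⇔ (x ≡ c)

      vertical-∥ : ∀ {l l′} → Vertical l → Vertical l′ → l ∥ l′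
      vertical-∥ {l} {l′} (c , on-l) (c′ , on-l′) with c ≟ c′
      ... | yes refl = inj₁ same
        where
        same : ∀ P → On P l ⇔ On P l′
        same P with coordinates P
        ... | x , y , refl = mk⇔ (Equivalence.from (on-l′ x y) ∘ Equivalence.to (on-l x y))
                                 (Equivalence.from (on-l x y) ∘ Equivalence.to (on-l′ x y))
      ... | no c≢c′ = inj₂ disjoint
        where
        disjoint : ∀ P → ¬ (On P l × On P l′)
        disjoint P (on , on′) with coordinates P
        ... | x , y , refl = c≢c′ (trans (sym (Equivalence.to (on-l x y) on)) (Equivalence.to (on-l′ x y) on′))

      ∥-sym : ∀ {l l′} → l ∥ l′ → l′ ∥ l
      ∥-sym (inj₁ same)     = inj₁ λ P → mk⇔ (Equivalence.from (same P)) (Equivalence.to (same P))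
      ∥-sym (inj₂ disjoint) = inj₂ λ P (on , on′) → disjoint P (on′ , on)

      -- A graph meets x = c in exactly one point, so it can be neither equal to nor disjoint from a
      -- vertical line.
      ∥-vertical : ∀ {l l′} → l ∥ l′ → Vertical l′ → Vertical l
      ∥-vertical {l} {l′} l∥l′ (c , on-l′) with shape l
      ... | vertical c′ on-l = c′ , on-l
      ... | graph u j b _ on-l = ⊥-elim (cases l∥l′)
        where
        y₀ = u * c ^ (2 ℕ.^ j) + b
        cases : l ∥ l′ → ⊥
        cases (inj₁ same) = 1≢0 (begin
          1#             ≡⟨ solve 1 (λ y → con true := y :+ (y :+ con true)) refl y₀ ⟩
          y₀ + (y₀ + 1#) ≡⟨ ≡⇒+-≡0 (sym (Equivalence.to (on-l c (y₀ + 1#))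
                              (Equivalence.from (same _) (Equivalence.from (on-l′ c (y₀ + 1#)) refl)))) ⟩
          0#             ∎)
        cases (inj₂ disjoint) = disjoint _ (Equivalence.from (on-l c y₀) refl , Equivalence.from (on-l′ c y₀) refl)

      -- The line x = 0. Its direction `e₁ φ` is outside D, so the replacement keeps it; it
      -- represents the vertical parallel class.
      ℓ₀ : AndréLine ix m
      ℓ₀ = old ((w ∷ r ∷ 0# ∷ []) , λ eq → e₁≢0 (cong (λ { (a ∷ b ∷ _) → b ∷ a ∷ [] }) eq))
        (λ (κ , _ , eq) → 1≢0 (trans (cong (λ { (_ ∷ _ ∷ c ∷ []) → c }) eq) (zeroʳ κ)))
        (e₁ φ , e₁≢0)
        (solve 2 (λ r w → w :* r :+ r :* w :+ con false :* con false := con false) refl r w)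
        (e₁∉D e₁≢0)
        where
        e₁≢0 : e₁ φ ≢ 0ᵥ
        e₁≢0 = ∧-nonzeroʳ (e₀ φ) Δ≢0

      ℓ₀-vertical : Vertical ℓ₀
      ℓ₀-vertical = 0# , λ x y → mk⇔
        (λ eq → *-zero⁻¹ Δ≢0 (trans (dot≡ x y) eq))
        (λ { refl → trans (sym (dot≡ 0# y)) (zeroʳ Δ) })
        where
        dot≡ : ∀ x y → Δ * x ≡ w * (p * x + r * y) + r * (s * x + w * y) + 0# * 1#
        dot≡ x y = solve 6 (λ p r s w x y → (p :* w :+ s :* r) :* x
          := w :* (p :* x :+ r :* y) :+ r :* (s :* x :+ w :* y) :+ con false :* con true) refl p r s w x y

      -- One construction for both forms of the conic, which is parametrised by (ξ c, η c);
      -- injectivity of ξ says that a vertical line meets it at most once.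
      module Oval (C : Conic) (ξ η : K → K)
        (ξ-injective : ∀ {c c′} → ξ c ≡ ξ c′ → c ≡ c′)
        (on-conic : ∀ c → affine (point (ξ c) (η c)) OnConic C)
        (parametrised : ∀ x y → affine (point x y) OnConic C → ∃ λ c → x ≡ ξ c × y ≡ η c)
        (no-three : ∀ u j b → j ≡ 0 ⊎ j ≡ h ℕ.* m → ∀ {c₁ c₂ c₃} →
          η c₁ ≡ u * ξ c₁ ^ (2 ℕ.^ j) + b → η c₂ ≡ u * ξ c₂ ^ (2 ℕ.^ j) + b → η c₃ ≡ u * ξ c₃ ^ (2 ℕ.^ j) + b →
          c₁ ≢ c₂ → c₁ ≢ c₃ → c₂ ≢ c₃ → ⊥)
        where

        private
          module Π = IncidenceStructure (andréPlane ix m)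

        Param : Vec K 2 → Set
        Param v = ∃ λ c → v ≡ point (ξ c) (η c)

        param : ∀ v → affine v OnConic C → Param v
        param v on with coordinates v
        ... | x , y , refl with parametrised x y on
        ... | c , refl , refl = c , refl

        vertical-secant : ∀ {l v v′} → Vertical l → affine v OnConic C → affine v′ OnConic C → On v l → On v′ l → v ≡ v′
        vertical-secant {l} {v} {v′} (c , on-l) v∈C v′∈C on on′ with param v v∈C | param v′ v′∈C
        ... | a , refl | a′ , refl = cong (λ c → point (ξ c) (η c)) (ξ-injective
          (trans (Equivalence.to (on-l (ξ a) (η a)) on) (sym (Equivalence.to (on-l (ξ a′) (η a′)) on′))))

        no-three-on-line : ∀ {v₁ v₂ v₃} l →
          affine v₁ OnConic C → affine v₂ OnConic C → affine v₃ OnConic C →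
          v₁ ≢ v₂ → v₁ ≢ v₃ → v₂ ≢ v₃ → On v₁ l → On v₂ l → On v₃ l → ⊥
        no-three-on-line {v₁} {v₂} {v₃} l v₁∈C v₂∈C v₃∈C v₁≢v₂ v₁≢v₃ v₂≢v₃ on₁ on₂ on₃ with shape l
        ... | vertical c on-l = v₁≢v₂ (vertical-secant (c , on-l) v₁∈C v₂∈C on₁ on₂)
        ... | graph u j b j-cases on-l with param v₁ v₁∈C | param v₂ v₂∈C | param v₃ v₃∈C
        ... | c₁ , refl | c₂ , refl | c₃ , refl =
          no-three u j b j-cases
            (Equivalence.to (on-l (ξ c₁) (η c₁)) on₁) (Equivalence.to (on-l (ξ c₂) (η c₂)) on₂) (Equivalence.to (on-l (ξ c₃) (η c₃)) on₃)
            (λ { refl → v₁≢v₂ refl }) (λ { refl → v₁≢v₃ refl }) (λ { refl → v₂≢v₃ refl })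

        isArc : ReplacedIsArc ix m C
        isArc {inj₁ _} {inj₁ _} {inj₁ _} P∈ Q∈ R∈ P≉Q P≉R Q≉R (just l , onP , onQ , onR) =
          no-three-on-line l P∈ Q∈ R∈ (P≉Q ∘ inj₁) (P≉R ∘ inj₁) (Q≉R ∘ inj₁) onP onQ onR
        isArc {inj₁ _} {inj₁ _} {inj₁ _} P∈ Q∈ R∈ P≉Q P≉R Q≉R (nothing , () , _)

        -- The single added point is a parallel class with many representatives, hence `Vertical`
        -- instead of equality with `ℓ₀`.
        O : Pred Π.Point 0ℓ
        O (inj₁ v) = affine v OnConic C
        O (inj₂ l) = Vertical l

        -- An affine line through the added point is parallel to a vertical line, so it is vertical
        -- and meets the conic at most once.
        tangent-at-infinity : ∀ {v v′ l} x → affine v OnConic C → affine v′ OnConic C → Vertical l → v ≢ v′ →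
                              inj₁ v Π.On x → inj₁ v′ Π.On x → inj₂ l Π.On x → ⊥
        tangent-at-infinity (just l′) v∈C v′∈C vert v≢v′ on on′ l∥l′ =
          v≢v′ (vertical-secant (∥-vertical (∥-sym l∥l′) vert) v∈C v′∈C on on′)

        oval-isArc : Π.IsArc O
        oval-isArc {inj₁ _} {inj₁ _} {inj₁ _} P∈ Q∈ R∈ P≉Q P≉R Q≉R ons = isArc P∈ Q∈ R∈ P≉Q P≉R Q≉R ons
        oval-isArc {inj₁ _} {inj₁ _} {inj₂ _} P∈ Q∈ R∈ P≉Q P≉R Q≉R (x , onP , onQ , onR) = tangent-at-infinity x P∈ Q∈ R∈ (P≉Q ∘ inj₁) onP onQ onR
        oval-isArc {inj₁ _} {inj₂ _} {inj₁ _} P∈ Q∈ R∈ P≉Q P≉R Q≉R (x , onP , onQ , onR) = tangent-at-infinity x P∈ R∈ Q∈ (P≉R ∘ inj₁) onP onR onQ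
        oval-isArc {inj₂ _} {inj₁ _} {inj₁ _} P∈ Q∈ R∈ P≉Q P≉R Q≉R (x , onP , onQ , onR) = tangent-at-infinity x Q∈ R∈ P∈ (Q≉R ∘ inj₁) onQ onR onP
        oval-isArc {inj₂ _} {inj₂ _} {_}      P∈ Q∈ R∈ P≉Q P≉R Q≉R _ = P≉Q (inj₂ (vertical-∥ P∈ Q∈))
        oval-isArc {inj₂ _} {inj₁ _} {inj₂ _} P∈ Q∈ R∈ P≉Q P≉R Q≉R _ = P≉R (inj₂ (vertical-∥ P∈ R∈))
        oval-isArc {inj₁ _} {inj₂ _} {inj₂ _} P∈ Q∈ R∈ P≉Q P≉R Q≉R _ = Q≉R (inj₂ (vertical-∥ Q∈ R∈))

        private
          module ↔ = Inverse finite

        enumerate : Fin (suc (q ℕ.^ t)) → Π.Point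
        enumerate zero    = inj₂ ℓ₀
        enumerate (suc i) = inj₁ (point (ξ (↔.from i)) (η (↔.from i)))

        enumerate-injective : ∀ {i j} → enumerate i Π.≈ enumerate j → i ≡ j
        enumerate-injective {zero}  {zero}  _         = refl
        enumerate-injective {suc i} {suc j} (inj₁ eq) = cong suc (trans (sym (↔.strictlyInverseˡ i))
          (trans (cong ↔.to (ξ-injective (proj₁ (point-injective eq)))) (↔.strictlyInverseˡ j)))

        enumerate-O : ∀ P → O P ⇔ ∃ λ i → enumerate i Π.≈ P
        enumerate-O (inj₁ v) = mk⇔ to from
          where
          to : affine v OnConic C → ∃ λ i → enumerate i Π.≈ inj₁ v
          to v∈C with param v v∈C
          ... | c , refl = suc (↔.to c) , inj₁ (cong (λ c → point (ξ c) (η c)) (↔.strictlyInverseʳ c))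
          from : (∃ λ i → enumerate i Π.≈ inj₁ v) → affine v OnConic C
          from (suc i , inj₁ refl) = on-conic (↔.from i)
        enumerate-O (inj₂ l) = mk⇔ (λ vert → zero , inj₂ (vertical-∥ {ℓ₀} {l} ℓ₀-vertical vert)) from
          where
          from : (∃ λ i → enumerate i Π.≈ inj₂ l) → Vertical l
          from (zero , inj₂ ℓ₀∥l) = ∥-vertical {l} {ℓ₀} (∥-sym {ℓ₀} {l} ℓ₀∥l) ℓ₀-vertical

        completes : ReplacedCompletes ix m C
        completes = O , (oval-isArc , enumerate , enumerate-injective , enumerate-O) , λ { {inj₁ v} v∈C → v∈C }

-- Chords of the conic, blocks with three of its points, and the two coordinate forms.

module ReplacedConics (h k : ℕ) (1≤h : 1 ℕ.≤ h) (F : FiniteField ((2 ℕ.^ h) ℕ.^ (3 ℕ.+ k))) where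
  open AndréPlanes h k 1≤h F public
  open ≡-Reasoning

  fixed-0 : ∀ e → Fixed e 0#
  fixed-0 e = 0^ (2^≥1 e)

  fixed-1# : ∀ e → Fixed e 1#
  fixed-1# e = 1^ (2 ℕ.^ e)

  chord-square : ∀ {α γ x x′} → (α * (x * x) + γ) + (α * (x′ * x′) + γ) ≡ α * (x + x′) ^ 2
  chord-square {α} {γ} {x} {x′} = solve 4 (λ α γ x x′ → (α :* (x :* x) :+ γ) :+ (α :* (x′ :* x′) :+ γ)
    := α :* ((x :+ x′) :* ((x :+ x′) :* con true))) refl α γ x x′

  chord-graph : ∀ j {u b x x′} → (u * x ^ (2 ℕ.^ j) + b) + (u * x′ ^ (2 ℕ.^ j) + b) ≡ u * (x + x′) ^ (2 ℕ.^ j)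
  chord-graph j {u} {b} {x} {x′} = trans
    (solve 4 (λ u b x x′ → (u :* x :+ b) :+ (u :* x′ :+ b) := u :* (x :+ x′)) refl u b (x ^ (2 ℕ.^ j)) (x′ ^ (2 ℕ.^ j)))
    (cong (u *_) (sym (frobenius-+ j x x′)))

  -- Three collinear points give two chords from c₁ with the same equation p d^a = r d^b. Their
  -- ratio must be 1, so c₂ = c₃.
  equal-chords : ∀ {p r c₁ c₂ c₃} a b → p ≢ 0# → (∀ {y} → y ≢ 0# → y ^ a ≡ y ^ b → y ≡ 1#) →
    p * (c₁ + c₂) ^ a ≡ r * (c₁ + c₂) ^ b → p * (c₁ + c₃) ^ a ≡ r * (c₁ + c₃) ^ b →
    c₁ ≢ c₂ → c₁ ≢ c₃ → c₂ ≢ c₃ → ⊥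
  equal-chords {c₁ = c₁} {c₂} {c₃} a b p≢0 collapse eq eq′ c₁≢c₂ c₁≢c₃ c₂≢c₃ =
    equal (ratio-fixed a b p≢0 (c₁≢c₂ ∘ +-≡0⇒≡) (c₁≢c₃ ∘ +-≡0⇒≡) eq eq′)
    where
    equal : (∃ λ y → y ≢ 0# × c₁ + c₂ ≡ y * (c₁ + c₃) × y ^ a ≡ y ^ b) → ⊥
    equal (y , y≢0 , d≡yd′ , fix) = c₂≢c₃ (begin
      c₂             ≡⟨ solve 2 (λ c₁ c₂ → c₂ := c₁ :+ (c₁ :+ c₂)) refl c₁ c₂ ⟩
      c₁ + (c₁ + c₂) ≡⟨ cong (c₁ +_) (trans d≡yd′ (trans (cong (_* (c₁ + c₃)) (collapse y≢0 fix)) (*-identityˡ _))) ⟩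
      c₁ + (c₁ + c₃) ≡⟨ solve 2 (λ c₁ c₃ → c₁ :+ (c₁ :+ c₃) := c₃) refl c₁ c₃ ⟩
      c₃             ∎)

  module _ {D : Pred (PG 2) 0ℓ} (ix : Indexing D) where
    open Indexing ix
    open Coordinates ix

    ArcAndCompletes : ℕ → Conic → Set₁
    ArcAndCompletes m C = ReplacedIsArc ix m C × ReplacedCompletes ix m C

    -- The three points have c = 0, 1 and an element y ≠ 0, 1 fixed by c ↦ c^(2^e); u is chosen
    -- with σ^(q^m) u = θ σ, so that it has the norm of θ.
    three-on-block : ∀ m e C {θ σ v₀ v₁} → θ ≢ 0# → norm θ ≡ δ → σ ≢ 0# → t ∣ e →
      (∀ c → Fixed e c → affine (point (v₀ + σ * c) (v₁ + θ * σ * c ^ (q ℕ.^ m))) OnConic C) →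
      ¬ ReplacedIsArc ix m C
    three-on-block m e C {θ} {σ} {v₀} {v₁} θ≢0 θ-norm σ≢0 t∣e on-C arc with fixed-∣ t∣e
    ... | y , y≢0 , y≢1 , fix = arc {inj₁ (P 0#)} {inj₁ (P 1#)} {inj₁ (P y)}
      (on-C 0# (fixed-0 e)) (on-C 1# (fixed-1# e)) (on-C y fix)
      (λ { (inj₁ eq) → 0≢1 (P-injective eq) }) (λ { (inj₁ eq) → y≢0 (sym (P-injective eq)) }) (λ { (inj₁ eq) → y≢1 (sym (P-injective eq)) })
      (just (block u u≢0 u-norm (point v₀ v₁)) , on-line 0# , on-line 1# , on-line y)
      where
      open AndréLines m
      I = q ℕ.^ m
      P : K → Vec K 2
      P c = point (v₀ + σ * c) (v₁ + θ * σ * c ^ I)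
      P-injective : ∀ {c c′} → P c ≡ P c′ → c ≡ c′
      P-injective {c} {c′} eq = *-cancelˡ σ≢0 (begin
        σ * c               ≡⟨ solve 2 (λ v s → s := v :+ (v :+ s)) refl v₀ (σ * c) ⟩
        v₀ + (v₀ + σ * c)   ≡⟨ cong (v₀ +_) (proj₁ (point-injective eq)) ⟩
        v₀ + (v₀ + σ * c′)  ≡⟨ solve 2 (λ v s → v :+ (v :+ s) := s) refl v₀ (σ * c′) ⟩
        σ * c′              ∎)
      u = θ * σ * (σ ^ I) ⁻¹
      u≢0 : u ≢ 0#
      u≢0 = *-nonzero (*-nonzero θ≢0 σ≢0) (⁻¹-nonzero (^-nonzero I σ≢0))
      uσ : u * σ ^ I ≡ θ * σ
      uσ = quotient (θ * σ) (^-nonzero I σ≢0)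
      -- σ^(q^m) is a conjugate of σ over the field of order q and has the same norm.
      u-norm : norm u ≡ δ
      u-norm = trans (*-cancelˡ (^-nonzero normExponent σ≢0) (begin
        norm σ * norm u          ≡⟨ *-comm _ _ ⟩
        norm u * norm σ          ≡⟨ cong (norm u *_) (norm-q^ m σ≢0) ⟨
        norm u * norm (σ ^ I)    ≡⟨ norm-* u (σ ^ I) ⟨
        norm (u * σ ^ I)         ≡⟨ cong norm uσ ⟩
        norm (θ * σ)             ≡⟨ norm-* θ σ ⟩
        norm θ * norm σ          ≡⟨ *-comm _ _ ⟩
        norm σ * norm θ          ∎)) θ-norm
      on-line : ∀ c → On (P c) (block u u≢0 u-norm (point v₀ v₁))
      on-line c = on-block u≢0 u-norm (σ * c) refl (cong (v₁ +_) (begin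
        θ * σ * c ^ I          ≡⟨ cong (_* c ^ I) uσ ⟨
        u * σ ^ I * c ^ I      ≡⟨ solve 3 (λ u a b → u :* a :* b := a :* b :* u) refl u (σ ^ I) (c ^ I) ⟩
        σ ^ I * c ^ I * u      ≡⟨ cong (_* u) (^-distrib-* σ c I) ⟨
        (σ * c) ^ I * u        ∎))

    abstract
      -- The base point of the orbit lies in D through the identity of H; its preimage in `𝒜 δ`
      -- supplies θ.
      norm-of-δ : ∀ {E₀ E₁ : PG 2} → IsAndréSet E₀ E₁ D → ∃ λ θ → θ ≢ 0# × norm θ ≡ δ
      norm-of-δ (_ , H , group , _ , _ , P@((x ∷ y ∷ []) , _) , _ , _ , orbit)
        with Equivalence.to (maps P) (Equivalence.from (orbit P) (identity , IsSubgroupPGL.identity∈ group , 1# , 1≢0 , P≡))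
        where
        P≡ : (x ∷ y ∷ []) ≡ 1# • act identity (x ∷ y ∷ [])
        P≡ = cong₂ (λ a b → a ∷ b ∷ [])
          (solve 2 (λ x y → x := con true :* (con true :* x :+ con false :* y)) refl x y)
          (solve 2 (λ x y → y := con true :* (con false :* x :+ con true :* y)) refl x y)
      ... | _ , (θ , θ≢0 , θ-norm , _) , _ = θ , θ≢0 , θ-norm

    module VerticalAxis (C : Conic) {α γ : K} (α≢0 : α ≢ 0#)
      (equation : ∀ x y → (affine (point x y) OnConic C) ⇔ (y ≡ α * (x * x) + γ)) where

      arcAndCompletes : ∀ m → 1 ℕ.≤ m → Coprime (h ℕ.* m ℕ.∸ 1) (h ℕ.* t) → ArcAndCompletes m C
      arcAndCompletes m 1≤m coprime = isArc , completes
        where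
        e = h ℕ.* m ℕ.∸ 1
        suc-e : suc e ≡ h ℕ.* m
        suc-e = ℕ.m+[n∸m]≡n (ℕ.*-mono-≤ 1≤h 1≤m)
        collapse : ∀ {j} → j ≡ 0 ⊎ j ≡ h ℕ.* m → ∀ {y} → y ≢ 0# → y ^ 2 ≡ y ^ (2 ℕ.^ j) → y ≡ 1#
        collapse (inj₁ refl) {y} y≢0 eq = fixed-1 y≢0 (trans eq (*-identityʳ y))
        -- Both sides are squares; taking roots lowers the exponent h m to e = h m - 1.
        collapse (inj₂ refl) {y} y≢0 eq = fixed-coprime⇒1 {e} coprime y≢0 (frobenius-injective 1 (begin
          (y ^ (2 ℕ.^ e)) ^ 2     ≡⟨ frobenius-∘ e 1 y ⟨
          y ^ (2 ℕ.^ (e ℕ.+ 1))   ≡⟨ cong (λ i → y ^ (2 ℕ.^ i)) (trans (ℕ.+-comm e 1) suc-e) ⟩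
          y ^ (2 ℕ.^ (h ℕ.* m))   ≡⟨ eq ⟨
          y ^ 2                   ∎))
        open AndréLines m
        open Oval C (λ c → c) (λ c → α * (c * c) + γ) (λ eq → eq)
          (λ c → Equivalence.from (equation c _) refl)
          (λ x y on → x , refl , Equivalence.to (equation x y) on)
          (λ u j b j-cases eq₁ eq₂ eq₃ → equal-chords 2 (2 ℕ.^ j) α≢0 (collapse j-cases)
            (trans (sym chord-square) (trans (cong₂ _+_ eq₁ eq₂) (chord-graph j)))
            (trans (sym chord-square) (trans (cong₂ _+_ eq₁ eq₃) (chord-graph j))))

      notArc : ∀ {θ} → θ ≢ 0# → norm θ ≡ δ → ∀ m → 1 ℕ.≤ m → t ∣ h ℕ.* m ℕ.∸ 1 → ¬ ReplacedIsArc ix m C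
      notArc {θ} θ≢0 θ-norm m 1≤m t∣e = three-on-block m e C {θ} {σ} {0#} {γ} θ≢0 θ-norm σ≢0 t∣e on-C
        where
        e = h ℕ.* m ℕ.∸ 1
        -- With c^(q^m) = c^2, the conic equation at x = σ c requires θ σ c^2 = α σ^2 c^2.
        σ = θ * α ⁻¹
        σ≢0 : σ ≢ 0#
        σ≢0 = *-nonzero θ≢0 (⁻¹-nonzero α≢0)
        power : ∀ c → Fixed e c → c ^ (q ℕ.^ m) ≡ c * c
        power c fix = begin
          c ^ (q ℕ.^ m)          ≡⟨ cong (c ^_) (ℕ.^-*-assoc 2 h m) ⟩
          c ^ (2 ℕ.^ (h ℕ.* m))  ≡⟨ cong (λ i → c ^ (2 ℕ.^ i)) (trans (ℕ.+-comm e 1) (ℕ.m+[n∸m]≡n (ℕ.*-mono-≤ 1≤h 1≤m))) ⟨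
          c ^ (2 ℕ.^ (e ℕ.+ 1))  ≡⟨ frobenius-∘ e 1 c ⟩
          (c ^ (2 ℕ.^ e)) ^ 2    ≡⟨ cong (_^ 2) fix ⟩
          c * (c * 1#)           ≡⟨ cong (c *_) (*-identityʳ c) ⟩
          c * c                  ∎
        on-C : ∀ c → Fixed e c → affine (point (0# + σ * c) (γ + θ * σ * c ^ (q ℕ.^ m))) OnConic C
        on-C c fix = Equivalence.from (equation _ _) (begin
          γ + θ * σ * c ^ (q ℕ.^ m)                  ≡⟨ cong₂ (λ x z → γ + x * σ * z) (sym (quotient θ α≢0)) (power c fix) ⟩
          γ + σ * α * σ * (c * c)                    ≡⟨ solve 4 (λ γ σ α c → γ :+ σ :* α :* σ :* (c :* c)
            := α :* ((con false :+ σ :* c) :* (con false :+ σ :* c)) :+ γ) refl γ σ α c ⟩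
          α * ((0# + σ * c) * (0# + σ * c)) + γ      ∎)

    module HorizontalAxis (C : Conic) {α γ : K} (α≢0 : α ≢ 0#)
      (equation : ∀ x y → (affine (point x y) OnConic C) ⇔ (x ≡ α * (y * y) + γ)) where

      arcAndCompletes : ∀ m → 1 ℕ.≤ m → Coprime (suc (h ℕ.* m)) (h ℕ.* t) → ArcAndCompletes m C
      arcAndCompletes m 1≤m coprime = isArc , completes
        where
        ξ : K → K
        ξ c = α * (c * c) + γ
        ξ-injective : ∀ {c c′} → ξ c ≡ ξ c′ → c ≡ c′
        ξ-injective eq = +-≡0⇒≡ (^-zero⁻¹ 2 (*-zero⁻¹ α≢0 (trans (sym chord-square) (≡⇒+-≡0 eq))))
        collapse : ∀ {j} → j ≡ 0 ⊎ j ≡ h ℕ.* m → ∀ {y} → y ≢ 0# → y ^ 1 ≡ y ^ (2 ℕ.^ suc j) → y ≡ 1#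
        collapse {j} j-cases {y} y≢0 eq = fixed j-cases (trans (sym eq) (*-identityʳ y))
          where
          fixed : j ≡ 0 ⊎ j ≡ h ℕ.* m → Fixed (suc j) y → y ≡ 1#
          fixed (inj₁ refl) fix = fixed-1 y≢0 fix
          fixed (inj₂ refl) fix = fixed-coprime⇒1 {suc (h ℕ.* m)} coprime y≢0 fix
        chord : ∀ u j b {c c′} → c ≡ u * ξ c ^ (2 ℕ.^ j) + b → c′ ≡ u * ξ c′ ^ (2 ℕ.^ j) + b →
                1# * (c + c′) ^ 1 ≡ u * α ^ (2 ℕ.^ j) * (c + c′) ^ (2 ℕ.^ suc j)
        chord u j b {c} {c′} eq eq′ = begin
          1# * (c + c′) ^ 1                                      ≡⟨ trans (*-identityˡ _) (*-identityʳ _) ⟩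
          c + c′                                                 ≡⟨ trans (cong₂ _+_ eq eq′) (chord-graph j) ⟩
          u * (ξ c + ξ c′) ^ (2 ℕ.^ j)                           ≡⟨ cong (λ z → u * z ^ (2 ℕ.^ j)) chord-square ⟩
          u * (α * (c + c′) ^ 2) ^ (2 ℕ.^ j)                     ≡⟨ cong (u *_) (^-distrib-* α _ (2 ℕ.^ j)) ⟩
          u * (α ^ (2 ℕ.^ j) * ((c + c′) ^ 2) ^ (2 ℕ.^ j))       ≡⟨ cong (λ z → u * (α ^ (2 ℕ.^ j) * z)) (^-assocʳ (c + c′) 2 (2 ℕ.^ j)) ⟩
          u * (α ^ (2 ℕ.^ j) * (c + c′) ^ (2 ℕ.^ suc j))         ≡⟨ *-assoc u _ _ ⟨
          u * α ^ (2 ℕ.^ j) * (c + c′) ^ (2 ℕ.^ suc j)           ∎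
        open AndréLines m
        open Oval C ξ (λ c → c) ξ-injective
          (λ c → Equivalence.from (equation _ c) refl)
          (λ x y on → y , Equivalence.to (equation x y) on , refl)
          (λ u j b j-cases eq₁ eq₂ eq₃ → equal-chords 1 (2 ℕ.^ suc j) 1≢0 (collapse j-cases)
            (chord u j b eq₁ eq₂) (chord u j b eq₁ eq₃))

      notArc : ∀ {θ} → θ ≢ 0# → norm θ ≡ δ → ∀ m → 1 ℕ.≤ m → t ∣ suc (h ℕ.* m) → ¬ ReplacedIsArc ix m C
      notArc {θ} θ≢0 θ-norm m _ t∣e = three-on-block m e C {θ} {σ} {γ} {0#} θ≢0 θ-norm σ≢0 t∣e on-C
        where
        e = suc (h ℕ.* m)
        β = α * (θ * θ)
        β≢0 : β ≢ 0#
        β≢0 = *-nonzero α≢0 (*-nonzero θ≢0 θ≢0)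
        -- With c^(2 I) = c, the conic equation at y = θ σ c^I requires σ c = β σ^2 c.
        σ = β ⁻¹
        σ≢0 : σ ≢ 0#
        σ≢0 = ⁻¹-nonzero β≢0
        I = q ℕ.^ m
        power : ∀ c → Fixed e c → c ^ I * c ^ I ≡ c
        power c fix = begin
          c ^ I * c ^ I                 ≡⟨ cong (c ^ I *_) (*-identityʳ (c ^ I)) ⟨
          (c ^ I) ^ 2                   ≡⟨ ^-comm c I 2 ⟩
          (c ^ 2) ^ I                   ≡⟨ ^-assocʳ c 2 I ⟩
          c ^ (2 ℕ.* I)                 ≡⟨ cong (λ i → c ^ (2 ℕ.* i)) (ℕ.^-*-assoc 2 h m) ⟩
          c ^ (2 ℕ.^ e)                 ≡⟨ fix ⟩
          c                             ∎
        on-C : ∀ c → Fixed e c → affine (point (γ + σ * c) (0# + θ * σ * c ^ I)) OnConic C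
        on-C c fix = Equivalence.from (equation _ _) (begin
          γ + σ * c                                   ≡⟨ cong₂ (λ x z → γ + x * z)
            (trans (sym (*-identityˡ σ)) (cong (_* σ) (sym (⁻¹-inverse β≢0)))) (sym (power c fix)) ⟩
          γ + β * σ * σ * (c ^ I * c ^ I)             ≡⟨ solve 5 (λ γ α θ σ x → γ :+ α :* (θ :* θ) :* σ :* σ :* (x :* x)
            := α :* ((con false :+ θ :* σ :* x) :* (con false :+ θ :* σ :* x)) :+ γ) refl γ α θ σ (c ^ I) ⟩
          α * ((0# + θ * σ * c ^ I) * (0# + θ * σ * c ^ I)) + γ ∎)

    -- The dichotomy on h modulo t.

    Dichotomy : Conic → Set₁
    Dichotomy C =
      (t ∣ h → ∀ m → 1 ℕ.≤ m → m ℕ.< t → ArcAndCompletes m C)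
      ×
      (¬ (t ∣ h) → ∃ λ n →
        (1 ℕ.≤ n × n ℕ.< t × ¬ ReplacedIsArc ix n C) ×
        (∀ m → 1 ℕ.≤ m → m ℕ.< t → ¬ ReplacedIsArc ix m C → m ≡ n) ×
        (∀ m → 1 ℕ.≤ m → m ℕ.< t → m ≢ n → ArcAndCompletes m C))

    -- As `e m` is coprime to h, the prime t is the only possible obstruction to coprimality with h
    -- t, so t ∣ `e m` separates bad indices from good ones.
    dichotomy : ∀ {e} C → Prime t → ExponentFamily h t e →
      (∀ m → 1 ℕ.≤ m → Coprime (e m) (h ℕ.* t) → ArcAndCompletes m C) →
      (∀ m → 1 ℕ.≤ m → t ∣ e m → ¬ ReplacedIsArc ix m C) → Dichotomy C
    dichotomy {e} C t-prime family good bad =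
      (λ t∣h m 1≤m _ → good′ m 1≤m (not-divisible t-prime family t∣h 1≤m)) , exceptional
      where
      good′ : ∀ m → 1 ℕ.≤ m → ¬ (t ∣ e m) → ArcAndCompletes m C
      good′ m 1≤m t∤em = good m 1≤m (coprime-*-prime t-prime (ExponentFamily.coprime family 1≤m) t∤em)
      exceptional : ¬ (t ∣ h) → _
      exceptional t∤h with ExponentFamily.hit family t∤h
      ... | n , 1≤n , n<t , t∣en = n , (1≤n , n<t , bad n 1≤n t∣en) , unique , others
        where
        unique : ∀ m → 1 ℕ.≤ m → m ℕ.< t → ¬ ReplacedIsArc ix m C → m ≡ n
        unique m 1≤m m<t ¬arc with t ∣? e m
        ... | yes t∣em = hit-unique t-prime family t∤h 1≤m 1≤n m<t n<t t∣em t∣en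
        ... | no t∤em = contradiction (λ {P} {Q} {R} → proj₁ (good′ m 1≤m t∤em) {P} {Q} {R}) ¬arc
        others : ∀ m → 1 ℕ.≤ m → m ℕ.< t → m ≢ n → ArcAndCompletes m C
        others m 1≤m m<t m≢n = good′ m 1≤m λ t∣em → m≢n (hit-unique t-prime family t∤h 1≤m 1≤n m<t n<t t∣em t∣en)

    replaced-conic : Prime t → ∀ C N T → IsNucleus C (at∞ N) → TangentAt C ℓ∞ (at∞ T) → IsAndréSet T N D → Dichotomy C
    replaced-conic t-prime C N@((N₀ ∷ N₁ ∷ []) , N≢0) T@((T₀ ∷ T₁ ∷ []) , T≢0) nucleus tangent andré =
      cases (andréSet-transversals {T} {N} andré ix) (norm-of-δ {T} {N} andré)
      where
      open TangentConic C N₀ N₁ T₀ T₁ N≢0 T≢0 nucleus tangent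

      vertical-axis : (∃ λ θ → θ ≢ 0# × norm θ ≡ δ) → Parabola (e₀ φ) (e₁ φ) → Dichotomy C
      vertical-axis (θ , θ≢0 , θ-norm) (α , γ , α≢0 , equation) =
        dichotomy C t-prime (family⁻ t-prime 1≤h) arcAndCompletes (notArc θ≢0 θ-norm)
        where
        open VerticalAxis C {α} {γ} α≢0 (λ x y → subst (λ v → (affine v OnConic C) ⇔ (y ≡ α * (x * x) + γ))
          (cong₂ (λ a b → a ∷ b ∷ []) (cong₂ _+_ (*-comm x _) (*-comm y _)) (cong₂ _+_ (*-comm x _) (*-comm y _))) (equation x y))

      horizontal-axis : (∃ λ θ → θ ≢ 0# × norm θ ≡ δ) → Parabola (e₁ φ) (e₀ φ) → Dichotomy C
      horizontal-axis (θ , θ≢0 , θ-norm) (α , γ , α≢0 , equation) =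
        dichotomy C t-prime (family⁺ t-prime) arcAndCompletes (notArc θ≢0 θ-norm)
        where
        open HorizontalAxis C {α} {γ} α≢0 (λ x y → subst (λ v → (affine v OnConic C) ⇔ (x ≡ α * (y * y) + γ))
          (cong₂ (λ a b → a ∷ b ∷ []) (trans (+-comm _ _) (cong₂ _+_ (*-comm x _) (*-comm y _)))
                                      (trans (+-comm _ _) (cong₂ _+_ (*-comm x _) (*-comm y _)))) (equation y x))

      cases : (e₁ φ ∧ vec N ≡ 0# × e₀ φ ∧ vec T ≡ 0#) ⊎ (e₀ φ ∧ vec N ≡ 0# × e₁ φ ∧ vec T ≡ 0#) →
              (∃ λ θ → θ ≢ 0# × norm θ ≡ δ) → Dichotomy C
      cases (inj₁ (e₁N , e₀T)) θ = horizontal-axis θ (parabola (Δ≢0 ∘ trans (∧-comm (e₀ φ) (e₁ φ))) e₁N e₀T)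
      cases (inj₂ (e₀N , e₁T)) θ = vertical-axis θ (parabola Δ≢0 e₀N e₁T)

open import Data.Nat using (_≤_; _<_; _^_)

theorem14 : (h t : ℕ) → Prime t → 3 ≤ t → t ≤ 2 ^ h →
    (F : FiniteField ((2 ^ h) ^ t)) →
    let open Geometry (2 ^ h) t F in
    (C : Conic) (N T : PG 2) →
    IsNucleus C (at∞ N) → TangentAt C ℓ∞ (at∞ T) →
    (D : Pred (PG 2) 0ℓ) → IsAndréSet T N D →
    (ix : Indexing D) →
    (t ∣ h →
    ∀ m → 1 ≤ m → m < t →
    ReplacedIsArc ix m C × ReplacedCompletes ix m C)
    ×
    (¬ (t ∣ h) →
    ∃ λ n →
    (1 ≤ n × n < t × ¬ ReplacedIsArc ix n C) ×
    (∀ m → 1 ≤ m → m < t → ¬ ReplacedIsArc ix m C → m ≡ n) ×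
    (∀ m → 1 ≤ m → m < t → m ≢ n →
    ReplacedIsArc ix m C × ReplacedCompletes ix m C))
-- For h = 0 the bound t ≤ q = 1 contradicts t ≥ 3.
theorem14 zero    _ _ (s≤s (s≤s _)) (s≤s ())
theorem14 (suc h) (suc (suc (suc k))) t-prime (s≤s (s≤s (s≤s _))) _ F C N T nucleus tangent D andré ix =
  ReplacedConics.replaced-conic (suc h) k (s≤s z≤n) F ix t-prime C N T nucleus tangent andré
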